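{- There is an absolute constant $C'>0$ such that the following holds for every integer $n\ge 2$. Let $A,B$ be distinct subsets of $[n]$ that are each $n^{1/3}$-separated. Then there is some prime $p\in\left[\tfrac12 C'n^{1/3}\log^6 n,\; C'n^{1/3}\log^6 n\right]$ and some $i\in\{0,1,\dots,p-1\}$ such that $|A_{i,p}|\ne |B_{i,p}|$.
   Context: Write $[n]=\{1,\dots,n\}$. For a real $d>0$, a set $A\subseteq[n]$ is called $d$-separated if $|a-a'|\ge d$ for all $a,a'\in A$ with $a\neq a'$. For a set $A\subseteq[n]$, a prime $p$ and $i\in\{0,\dots,p-1\}$, let $A_{i,p}=\{a\in A: a\equiv i \pmod p\}$. Here $\log$ is the natural logarithm and $\log^6 n=(\log n)^6$. -}

module Defs where

open import Data.Fin.Base using (Fin; toℕ)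
open import Data.Fin.Subset using (Subset; _∈_; _∩_)
open import Data.Integer.Base as ℤ using (+_; +[1+_])
import Data.Integer.Properties as ℤ
open import Data.Nat.Base as ℕ using (ℕ; zero; suc)
open import Data.Nat.Divisibility using (_∣?_)
import Data.Nat.Properties as ℕ
open import Data.Nat.Solver using (module +-*-Solver)
open import Data.Product.Base using (∃-syntax; _×_; _,_)
open import Data.Rational.Base as ℚ using (ℚ; mkℚ; _/_; 0ℚ; 1ℚ)
import Data.Rational.Properties as ℚ
open import Data.Rational.Solver renaming (module +-*-Solver to ℚ-Solver)
open import Data.Rational.Unnormalised.Base as ℚᵘ using (mkℚᵘ)
import Data.Rational.Unnormalised.Properties as ℚᵘ
open import Data.Sum.Base using (inj₁; inj₂)
open import Data.Vec.Base using (tabulate)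
open import Relation.Binary.PropositionalEquality
open import Relation.Nullary using (yes; no)
open import Relation.Nullary.Decidable using (does)

record ℝ : Set where
  constructor mkℝ
  field
    seq    : ℕ → ℚ
    cauchy : ∀ ε → 0ℚ ℚ.< ε → ∃[ N ] (∀ i j → N ℕ.≤ i → N ℕ.≤ j →
               ℚ.∣ seq i ℚ.- seq j ∣ ℚ.< ε)

open ℝ public

infix 4 _≤ᴿ_ _<ᴿ_

-- Reals are not quotiented; both orders depend only on the limits of the
-- sequences.

_≤ᴿ_ : ℝ → ℝ → Set
x ≤ᴿ y = ∀ ε → 0ℚ ℚ.< ε →
  ∃[ N ] (∀ i → N ℕ.≤ i → seq x i ℚ.≤ seq y i ℚ.+ ε)

_<ᴿ_ : ℝ → ℝ → Set
x <ᴿ y = ∃[ ε ] (0ℚ ℚ.< ε ×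
  ∃[ N ] (∀ i → N ℕ.≤ i → seq x i ℚ.+ ε ℚ.≤ seq y i))

fromℚ : ℚ → ℝ
fromℚ q = mkℝ (λ _ → q) λ ε ε>0 → 0 , λ _ _ _ _ →
  subst (ℚ._< ε) (sym (cong ℚ.∣_∣ (ℚ.+-inverseʳ q))) ε>0

fromℕ : ℕ → ℝ
fromℕ n = fromℚ (+ n / 1)

bounded : ∀ x → ∃[ B ] (0ℚ ℚ.< B ×
  ∃[ N ] (∀ i → N ℕ.≤ i → ℚ.∣ seq x i ∣ ℚ.≤ B))
bounded x with cauchy x 1ℚ (ℚ.positive⁻¹ 1ℚ)
... | N , close = B , B>0 , N , bound
  where
  B : ℚ
  B = 1ℚ ℚ.+ ℚ.∣ seq x N ∣

  B>0 : 0ℚ ℚ.< B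
  B>0 = ℚ.+-mono-<-≤ {0ℚ} {1ℚ} (ℚ.positive⁻¹ 1ℚ) (ℚ.0≤∣p∣ (seq x N))

  open ℚ.≤-Reasoning

  bound : ∀ i → N ℕ.≤ i → ℚ.∣ seq x i ∣ ℚ.≤ B
  bound i N≤i = begin
    ℚ.∣ seq x i ∣
      ≡⟨ cong ℚ.∣_∣ (solve 2 (λ a b → a := (a :- b) :+ b) refl
           (seq x i) (seq x N)) ⟩
    ℚ.∣ (seq x i ℚ.- seq x N) ℚ.+ seq x N ∣
      ≤⟨ ℚ.∣p+q∣≤∣p∣+∣q∣ (seq x i ℚ.- seq x N) (seq x N) ⟩
    ℚ.∣ seq x i ℚ.- seq x N ∣ ℚ.+ ℚ.∣ seq x N ∣
      ≤⟨ ℚ.+-monoˡ-≤ ℚ.∣ seq x N ∣ (ℚ.<⇒≤ (close i N N≤i ℕ.≤-refl)) ⟩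
    B ∎
    where open ℚ-Solver

divide : ∀ S ε → 0ℚ ℚ.< S → 0ℚ ℚ.< ε → ∃[ η ] (0ℚ ℚ.< η × S ℚ.* η ≡ ε)
divide S ε S>0 ε>0 = T ℚ.* ε , ℚ.positive⁻¹ (T ℚ.* ε) {{pos}} , eq
  where
  S+ : ℚ.Positive S
  S+ = ℚ.positive S>0

  S≠0 : ℚ.NonZero S
  S≠0 = ℚ.pos⇒nonZero S {{S+}}

  T : ℚ
  T = ℚ.1/_ S {{S≠0}}

  pos : ℚ.Positive (T ℚ.* ε)
  pos = ℚ.pos*pos⇒pos T {{ℚ.1/pos⇒pos S {{S+}}}} ε {{ℚ.positive ε>0}}

  eq : S ℚ.* (T ℚ.* ε) ≡ ε
  eq = trans (sym (ℚ.*-assoc S T ε))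
    (trans (cong (ℚ._* ε) (ℚ.*-inverseʳ S {{S≠0}})) (ℚ.*-identityˡ ε))

*-close : ∀ a b c d {B C η} → 0ℚ ℚ.< B → 0ℚ ℚ.< C →
  ℚ.∣ a ∣ ℚ.≤ B → ℚ.∣ d ∣ ℚ.≤ C →
  ℚ.∣ a ℚ.- c ∣ ℚ.< η → ℚ.∣ b ℚ.- d ∣ ℚ.< η →
  ℚ.∣ a ℚ.* b ℚ.- c ℚ.* d ∣ ℚ.< (B ℚ.+ C) ℚ.* η
*-close a b c d {B} {C} {η} B>0 C>0 a≤B d≤C a~c b~d = begin-strict
  ℚ.∣ a ℚ.* b ℚ.- c ℚ.* d ∣
    ≡⟨ cong ℚ.∣_∣ (regroup a b c d) ⟩
  ℚ.∣ a ℚ.* (b ℚ.- d) ℚ.+ d ℚ.* (a ℚ.- c) ∣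
    ≤⟨ ℚ.∣p+q∣≤∣p∣+∣q∣ (a ℚ.* (b ℚ.- d)) (d ℚ.* (a ℚ.- c)) ⟩
  ℚ.∣ a ℚ.* (b ℚ.- d) ∣ ℚ.+ ℚ.∣ d ℚ.* (a ℚ.- c) ∣
    <⟨ ℚ.+-mono-< (bound-* a (b ℚ.- d) B>0 a≤B b~d)
                  (bound-* d (a ℚ.- c) C>0 d≤C a~c) ⟩
  B ℚ.* η ℚ.+ C ℚ.* η
    ≡⟨ ℚ.*-distribʳ-+ η B C ⟨
  (B ℚ.+ C) ℚ.* η ∎
  where
  open ℚ.≤-Reasoning

  regroup : ∀ a b c d → a ℚ.* b ℚ.- c ℚ.* d
                      ≡ a ℚ.* (b ℚ.- d) ℚ.+ d ℚ.* (a ℚ.- c)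
  regroup = solve 4 (λ a b c d →
    a :* b :- c :* d := a :* (b :- d) :+ d :* (a :- c)) refl
    where open ℚ-Solver

  bound-* : ∀ x y {X Y} → 0ℚ ℚ.< X → ℚ.∣ x ∣ ℚ.≤ X → ℚ.∣ y ∣ ℚ.< Y →
            ℚ.∣ x ℚ.* y ∣ ℚ.< X ℚ.* Y
  bound-* x y {X} {Y} X>0 x≤X y<Y = begin-strict
    ℚ.∣ x ℚ.* y ∣
      ≡⟨ ℚ.∣p*q∣≡∣p∣*∣q∣ x y ⟩
    ℚ.∣ x ∣ ℚ.* ℚ.∣ y ∣
      ≤⟨ ℚ.*-monoʳ-≤-nonNeg ℚ.∣ y ∣ {{ℚ.∣-∣-nonNeg y}} x≤X ⟩
    X ℚ.* ℚ.∣ y ∣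
      <⟨ ℚ.*-monoʳ-<-pos X {{ℚ.positive X>0}} y<Y ⟩
    X ℚ.* Y ∎

infixl 7 _*ᴿ_

_*ᴿ_ : ℝ → ℝ → ℝ
x *ᴿ y = mkℝ (λ i → seq x i ℚ.* seq y i) λ ε ε>0 →
  let B , B>0 , N₁ , boundˣ = bounded x
      C , C>0 , N₂ , boundʸ = bounded y
      η , η>0 , eq = divide (B ℚ.+ C) ε
        (ℚ.<-trans B>0 (subst (ℚ._< B ℚ.+ C) (ℚ.+-identityʳ B)
          (ℚ.+-monoʳ-< B C>0))) ε>0
      N₃ , closeˣ = cauchy x η η>0
      N₄ , closeʸ = cauchy y η η>0
      N = (N₁ ℕ.⊔ N₂) ℕ.⊔ (N₃ ℕ.⊔ N₄)
      N₁≤ = ℕ.≤-trans (ℕ.m≤m⊔n N₁ N₂) (ℕ.m≤m⊔n (N₁ ℕ.⊔ N₂) (N₃ ℕ.⊔ N₄))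
      N₂≤ = ℕ.≤-trans (ℕ.m≤n⊔m N₁ N₂) (ℕ.m≤m⊔n (N₁ ℕ.⊔ N₂) (N₃ ℕ.⊔ N₄))
      N₃≤ = ℕ.≤-trans (ℕ.m≤m⊔n N₃ N₄) (ℕ.m≤n⊔m (N₁ ℕ.⊔ N₂) (N₃ ℕ.⊔ N₄))
      N₄≤ = ℕ.≤-trans (ℕ.m≤n⊔m N₃ N₄) (ℕ.m≤n⊔m (N₁ ℕ.⊔ N₂) (N₃ ℕ.⊔ N₄))
  in N , λ i j N≤i N≤j → subst
    (ℚ.∣ seq x i ℚ.* seq y i ℚ.- seq x j ℚ.* seq y j ∣ ℚ.<_) eq
    (*-close (seq x i) (seq y i) (seq x j) (seq y j) B>0 C>0
      (boundˣ i (ℕ.≤-trans N₁≤ N≤i))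
      (boundʸ j (ℕ.≤-trans N₂≤ N≤j))
      (closeˣ i j (ℕ.≤-trans N₃≤ N≤i) (ℕ.≤-trans N₃≤ N≤j))
      (closeʸ i j (ℕ.≤-trans N₄≤ N≤i) (ℕ.≤-trans N₄≤ N≤j)))

infixr 8 _^ᴿ_

_^ᴿ_ : ℝ → ℕ → ℝ
x ^ᴿ zero  = fromℚ 1ℚ
x ^ᴿ suc k = x *ᴿ x ^ᴿ k

frac-≤ : ∀ a b c d → a ℕ.* suc d ℕ.≤ c ℕ.* suc b →
         + a / suc b ℚ.≤ + c / suc d
frac-≤ a b c d le = ℚ.toℚᵘ-cancel-≤ (begin
  ℚ.toℚᵘ (+ a / suc b)  ≃⟨ ℚ.toℚᵘ-fromℚᵘ (mkℚᵘ (+ a) b) ⟩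
  mkℚᵘ (+ a) b          ≤⟨ ℚᵘ.*≤* (subst₂ ℤ._≤_ (ℤ.pos-* a (suc d))
                             (ℤ.pos-* c (suc b)) (ℤ.+≤+ le)) ⟩
  mkℚᵘ (+ c) d          ≃⟨ ℚ.toℚᵘ-fromℚᵘ (mkℚᵘ (+ c) d) ⟨
  ℚ.toℚᵘ (+ c / suc d)  ∎)
  where open ℚᵘ.≤-Reasoning

frac-+ : ∀ a b d → + a / suc d ℚ.+ + b / suc d ≡ + (a ℕ.+ b) / suc d
frac-+ a b d = ℚ.toℚᵘ-injective (begin-equality
  ℚ.toℚᵘ (+ a / suc d ℚ.+ + b / suc d)
    ≃⟨ ℚ.toℚᵘ-homo-+ (+ a / suc d) (+ b / suc d) ⟩
  ℚ.toℚᵘ (+ a / suc d) ℚᵘ.+ ℚ.toℚᵘ (+ b / suc d)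
    ≃⟨ ℚᵘ.+-cong (ℚ.toℚᵘ-fromℚᵘ (mkℚᵘ (+ a) d))
                 (ℚ.toℚᵘ-fromℚᵘ (mkℚᵘ (+ b) d)) ⟩
  mkℚᵘ (+ a) d ℚᵘ.+ mkℚᵘ (+ b) d
    ≃⟨ ℚᵘ.*≡* (trans (cong (ℤ._* + suc d)
         (sym (ℤ.*-distribʳ-+ (+ suc d) (+ a) (+ b))))
         (ℤ.*-assoc (+ (a ℕ.+ b)) (+ suc d) (+ suc d))) ⟩
  mkℚᵘ (+ (a ℕ.+ b)) d
    ≃⟨ ℚ.toℚᵘ-fromℚᵘ (mkℚᵘ (+ (a ℕ.+ b)) d) ⟨
  ℚ.toℚᵘ (+ (a ℕ.+ b) / suc d) ∎)
  where open ℚᵘ.≤-Reasoning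

unit<ε : ∀ ε → 0ℚ ℚ.< ε → + 1 / suc (ℚ.↧ₙ ε) ℚ.< ε
unit<ε ε@(mkℚ +[1+ a ] d _) _ = ℚ.toℚᵘ-cancel-< (begin-strict
  ℚ.toℚᵘ (+ 1 / suc (suc d))  ≃⟨ ℚ.toℚᵘ-fromℚᵘ (mkℚᵘ (+ 1) (suc d)) ⟩
  mkℚᵘ (+ 1) (suc d)          <⟨ ℚᵘ.*<* (subst₂ ℤ._<_ (ℤ.pos-* 1 (suc d))
                                   (ℤ.pos-* (suc a) (suc (suc d)))
                                   (ℤ.+<+ lt)) ⟩
  ℚ.toℚᵘ ε                    ∎)
  where
  open ℚᵘ.≤-Reasoning
  lt : 1 ℕ.* suc d ℕ.< suc a ℕ.* suc (suc d)
  lt = ℕ.<-≤-trans (ℕ.≤-reflexive (cong suc (ℕ.*-identityˡ (suc d))))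
                   (ℕ.m≤m+n (suc (suc d)) (a ℕ.* suc (suc d)))
unit<ε (mkℚ (+ zero) _ _) (ℚ.*<* (ℤ.+<+ ()))
unit<ε (mkℚ ℤ.-[1+ _ ] _ _) (ℚ.*<* ())

fromRegular : (x : ℕ → ℚ) → (∀ i j → x i ℚ.≤ x j ℚ.+ + 1 / suc j) → ℝ
fromRegular x reg = mkℝ x λ ε ε>0 → ℚ.↧ₙ ε , λ i j N≤i N≤j →
  ℚ.≤-<-trans (abs≤ i j (within (ℚ.↧ₙ ε) i j N≤j) (within (ℚ.↧ₙ ε) j i N≤i))
              (unit<ε ε ε>0)
  where
  open ℚ.≤-Reasoning
  open ℚ-Solver

  within : ∀ N i j → N ℕ.≤ j → x i ℚ.- x j ℚ.≤ + 1 / suc N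
  within N i j N≤j = begin
    x i ℚ.- x j
      ≤⟨ ℚ.+-monoˡ-≤ (ℚ.- x j) (reg i j) ⟩
    x j ℚ.+ + 1 / suc j ℚ.- x j
      ≡⟨ solve 2 (λ a b → a :+ b :- a := b) refl (x j) (+ 1 / suc j) ⟩
    + 1 / suc j
      ≤⟨ frac-≤ 1 j 1 N (ℕ.*-monoʳ-≤ 1 (ℕ.s≤s N≤j)) ⟩
    + 1 / suc N ∎

  abs≤ : ∀ i j {e} → x i ℚ.- x j ℚ.≤ e → x j ℚ.- x i ℚ.≤ e →
         ℚ.∣ x i ℚ.- x j ∣ ℚ.≤ e
  abs≤ i j {e} p q with ℚ.∣p∣≡p∨∣p∣≡-p (x i ℚ.- x j)
  ... | inj₁ eq = subst (ℚ._≤ e) (sym eq) p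
  ... | inj₂ eq = subst (ℚ._≤ e)
    (trans (solve 2 (λ a b → b :- a := :- (a :- b)) refl (x i) (x j))
           (sym eq)) q

-- The largest r with r³ ≤ m.
⌊∛_⌋ : ℕ → ℕ
⌊∛ zero ⌋ = 0
⌊∛ suc m ⌋ with suc ⌊∛ m ⌋ ℕ.^ 3 ℕ.≤? suc m
... | yes _ = suc ⌊∛ m ⌋
... | no  _ = ⌊∛ m ⌋

⌊∛⌋-lower : ∀ m → ⌊∛ m ⌋ ℕ.^ 3 ℕ.≤ m
⌊∛⌋-lower zero = ℕ.z≤n
⌊∛⌋-lower (suc m) with suc ⌊∛ m ⌋ ℕ.^ 3 ℕ.≤? suc m
... | yes p = p
... | no  _ = ℕ.m≤n⇒m≤1+n (⌊∛⌋-lower m)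

⌊∛⌋-upper : ∀ m → m ℕ.< suc ⌊∛ m ⌋ ℕ.^ 3
⌊∛⌋-upper zero = ℕ.s≤s ℕ.z≤n
⌊∛⌋-upper (suc m) with suc ⌊∛ m ⌋ ℕ.^ 3 ℕ.≤? suc m
... | yes p = ℕ.≤-<-trans (⌊∛⌋-upper m) (ℕ.^-monoˡ-< 3 (ℕ.n<1+n (suc ⌊∛ m ⌋)))
... | no ¬p = ℕ.≰⇒> ¬p

-- n^{1/3} as the limit of its truncations to multiples of 1/K.
∛ : ℕ → ℝ
∛ n = fromRegular (λ k → + r k / suc k) reg
  where
  r : ℕ → ℕ
  r k = ⌊∛ n ℕ.* suc k ℕ.^ 3 ⌋

  ^3-* : ∀ a b → (a ℕ.* b) ℕ.^ 3 ≡ a ℕ.^ 3 ℕ.* b ℕ.^ 3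
  ^3-* = solve 2 (λ a b → (a :* b) :^ 3 := a :^ 3 :* b :^ 3) refl
    where open +-*-Solver

  cross : ∀ i j → r i ℕ.* suc j ℕ.< suc (r j) ℕ.* suc i
  cross i j = ℕ.≰⇒> λ le → ℕ.<-irrefl refl (begin-strict
    (suc (r j) ℕ.* suc i) ℕ.^ 3
      ≤⟨ ℕ.^-monoˡ-≤ 3 le ⟩
    (r i ℕ.* suc j) ℕ.^ 3
      ≡⟨ ^3-* (r i) (suc j) ⟩
    r i ℕ.^ 3 ℕ.* suc j ℕ.^ 3
      ≤⟨ ℕ.*-monoˡ-≤ (suc j ℕ.^ 3) (⌊∛⌋-lower (n ℕ.* suc i ℕ.^ 3)) ⟩
    n ℕ.* suc i ℕ.^ 3 ℕ.* suc j ℕ.^ 3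
      ≡⟨ swap n (suc i ℕ.^ 3) (suc j ℕ.^ 3) ⟩
    n ℕ.* suc j ℕ.^ 3 ℕ.* suc i ℕ.^ 3
      <⟨ ℕ.*-monoˡ-< (suc i ℕ.^ 3) {{ℕ.m^n≢0 (suc i) 3}}
           (⌊∛⌋-upper (n ℕ.* suc j ℕ.^ 3)) ⟩
    suc (r j) ℕ.^ 3 ℕ.* suc i ℕ.^ 3
      ≡⟨ ^3-* (suc (r j)) (suc i) ⟨
    (suc (r j) ℕ.* suc i) ℕ.^ 3 ∎)
    where
    open ℕ.≤-Reasoning
    swap : ∀ a b c → a ℕ.* b ℕ.* c ≡ a ℕ.* c ℕ.* b
    swap = solve 3 (λ a b c → a :* b :* c := a :* c :* b) refl
      where open +-*-Solver

  reg : ∀ i j → + r i / suc i ℚ.≤ + r j / suc j ℚ.+ + 1 / suc j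
  reg i j = subst (+ r i / suc i ℚ.≤_) (sym (frac-+ (r j) 1 j))
    (frac-≤ (r i) i (r j ℕ.+ 1) j
      (subst (λ s → r i ℕ.* suc j ℕ.≤ s ℕ.* suc i) (ℕ.+-comm 1 (r j))
        (ℕ.<⇒≤ (cross i j))))

∑ : ℕ → (ℕ → ℚ) → ℚ
∑ zero    f = 0ℚ
∑ (suc a) f = ∑ a f ℚ.+ f a

∑-mono : ∀ a {f g} → (∀ i → i ℕ.< a → f i ℚ.≤ g i) → ∑ a f ℚ.≤ ∑ a g
∑-mono zero    le = ℚ.≤-refl
∑-mono (suc a) le =
  ℚ.+-mono-≤ (∑-mono a (λ i i<a → le i (ℕ.m≤n⇒m≤1+n i<a))) (le a (ℕ.n<1+n a))

∑-+ : ∀ a b f → ∑ (a ℕ.+ b) f ≡ ∑ a f ℚ.+ ∑ b (λ i → f (a ℕ.+ i))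
∑-+ a zero f = trans (cong (λ c → ∑ c f) (ℕ.+-identityʳ a))
                     (sym (ℚ.+-identityʳ (∑ a f)))
∑-+ a (suc b) f = begin
  ∑ (a ℕ.+ suc b) f
    ≡⟨ cong (λ c → ∑ c f) (ℕ.+-suc a b) ⟩
  ∑ (a ℕ.+ b) f ℚ.+ f (a ℕ.+ b)
    ≡⟨ cong (ℚ._+ f (a ℕ.+ b)) (∑-+ a b f) ⟩
  ∑ a f ℚ.+ ∑ b (λ i → f (a ℕ.+ i)) ℚ.+ f (a ℕ.+ b)
    ≡⟨ ℚ.+-assoc (∑ a f) (∑ b (λ i → f (a ℕ.+ i))) (f (a ℕ.+ b)) ⟩
  ∑ a f ℚ.+ ∑ (suc b) (λ i → f (a ℕ.+ i)) ∎
  where open ≡-Reasoning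

∑-* : ∀ a b f → ∑ (a ℕ.* b) f ≡ ∑ a (λ j → ∑ b (λ i → f (j ℕ.* b ℕ.+ i)))
∑-* zero    b f = refl
∑-* (suc a) b f = begin
  ∑ (b ℕ.+ a ℕ.* b) f
    ≡⟨ cong (λ c → ∑ c f) (ℕ.+-comm b (a ℕ.* b)) ⟩
  ∑ (a ℕ.* b ℕ.+ b) f
    ≡⟨ ∑-+ (a ℕ.* b) b f ⟩
  ∑ (a ℕ.* b) f ℚ.+ ∑ b (λ i → f (a ℕ.* b ℕ.+ i))
    ≡⟨ cong (ℚ._+ ∑ b (λ i → f (a ℕ.* b ℕ.+ i))) (∑-* a b f) ⟩
  ∑ (suc a) (λ j → ∑ b (λ i → f (j ℕ.* b ℕ.+ i))) ∎
  where open ≡-Reasoning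

∑-const : ∀ a d → ∑ a (λ _ → + 1 / suc d) ≡ + a / suc d
∑-const zero    d = sym (ℚ.0/n≡0 (suc d))
∑-const (suc a) d = begin
  ∑ a (λ _ → + 1 / suc d) ℚ.+ + 1 / suc d
    ≡⟨ cong (ℚ._+ + 1 / suc d) (∑-const a d) ⟩
  + a / suc d ℚ.+ + 1 / suc d
    ≡⟨ frac-+ a 1 d ⟩
  + (a ℕ.+ 1) / suc d
    ≡⟨ cong (λ c → + c / suc d) (ℕ.+-comm a 1) ⟩
  + suc a / suc d ∎
  where open ≡-Reasoning

∑-shift : ∀ a f → ∑ a f ℚ.+ f a ≡ ∑ a (λ i → f (suc i)) ℚ.+ f 0
∑-shift zero    f = refl
∑-shift (suc a) f = begin
  ∑ a f ℚ.+ f a ℚ.+ f (suc a)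
    ≡⟨ cong (ℚ._+ f (suc a)) (∑-shift a f) ⟩
  ∑ a (λ i → f (suc i)) ℚ.+ f 0 ℚ.+ f (suc a)
    ≡⟨ solve 3 (λ s u v → s :+ u :+ v := s :+ v :+ u) refl
         (∑ a (λ i → f (suc i))) (f 0) (f (suc a)) ⟩
  ∑ a (λ i → f (suc i)) ℚ.+ f (suc a) ℚ.+ f 0 ∎
  where
  open ≡-Reasoning
  open ℚ-Solver

-- With K = suc k, the lower Riemann sum of ∫₁ⁿ dt/t for the mesh 1/K:
-- the intervals are [(K + j)/K , (K + j + 1)/K] for j < (n ∸ 1) K, and each
-- contributes (1/K) · K/(K + j + 1) = 1/(K + j + 1).
riemann : ℕ → ℕ → ℚ
riemann n k =
  ∑ ((n ℕ.∸ 1) ℕ.* suc k) (λ j → + 1 / suc (suc k ℕ.+ j))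

private
  module _ (n k p : ℕ) where
    P kp a : ℕ
    P = suc p
    kp = p ℕ.+ k ℕ.* P     -- suc kp is suc k * suc p
    a = (n ℕ.∸ 1) ℕ.* suc k

    blocks : riemann n kp
           ≡ ∑ a (λ j → ∑ P (λ i → + 1 / suc (suc kp ℕ.+ (j ℕ.* P ℕ.+ i))))
    blocks = trans
      (cong (λ c → ∑ c (λ j → + 1 / suc (suc kp ℕ.+ j)))
        (sym (ℕ.*-assoc (n ℕ.∸ 1) (suc k) P)))
      (∑-* a P (λ j → + 1 / suc (suc kp ℕ.+ j)))

    -- P · 1/(q P) = 1/q
    average : ∀ q → ∑ P (λ _ → + 1 / suc (p ℕ.+ q ℕ.* P)) ≡ + 1 / suc q
    average q = trans (∑-const P (p ℕ.+ q ℕ.* P)) (ℚ.≤-antisym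
      (frac-≤ P (p ℕ.+ q ℕ.* P) 1 q (ℕ.≤-reflexive eq))
      (frac-≤ 1 q P (p ℕ.+ q ℕ.* P) (ℕ.≤-reflexive (sym eq))))
      where
      eq : P ℕ.* suc q ≡ 1 ℕ.* (suc q ℕ.* P)
      eq = trans (ℕ.*-comm P (suc q)) (sym (ℕ.*-identityˡ (suc q ℕ.* P)))

    index : ∀ j i → suc kp ℕ.+ (j ℕ.* P ℕ.+ i) ≡ (suc k ℕ.+ j) ℕ.* P ℕ.+ i
    index j i = trans (sym (ℕ.+-assoc (suc kp) (j ℕ.* P) i))
      (cong (ℕ._+ i) (sym (ℕ.*-distribʳ-+ P (suc k) j)))

    riemann-refine : riemann n k ℚ.≤ riemann n kp
    riemann-refine = subst (riemann n k ℚ.≤_) (sym blocks)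
      (∑-mono a λ j _ → ℚ.≤-trans (ℚ.≤-reflexive (sym (average (suc k ℕ.+ j))))
        (∑-mono P λ i i<P →
          frac-≤ 1 (p ℕ.+ (suc k ℕ.+ j) ℕ.* P) 1 (suc kp ℕ.+ (j ℕ.* P ℕ.+ i))
            (ℕ.*-monoʳ-≤ 1 (ℕ.s≤s (ℕ.≤-trans (ℕ.≤-reflexive (index j i))
              (ℕ.≤-trans (ℕ.+-monoʳ-≤ ((suc k ℕ.+ j) ℕ.* P) (ℕ.s≤s⁻¹ i<P))
                (ℕ.≤-reflexive (ℕ.+-comm ((suc k ℕ.+ j) ℕ.* P) p))))))))

    riemann-upper : riemann n kp ℚ.≤ riemann n k ℚ.+ + 1 / suc k
    riemann-upper = begin
      riemann n kp
        ≡⟨ blocks ⟩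
      ∑ a (λ j → ∑ P (λ i → + 1 / suc (suc kp ℕ.+ (j ℕ.* P ℕ.+ i))))
        ≤⟨ ∑-mono a (λ j _ → ℚ.≤-trans
             (∑-mono P λ i _ →
               frac-≤ 1 (suc kp ℕ.+ (j ℕ.* P ℕ.+ i)) 1 (p ℕ.+ (k ℕ.+ j) ℕ.* P)
                 (ℕ.*-monoʳ-≤ 1 (ℕ.m≤n⇒m≤1+n
                   (ℕ.≤-trans (ℕ.m≤m+n ((suc k ℕ.+ j) ℕ.* P) i)
                     (ℕ.≤-reflexive (sym (index j i)))))))
             (ℚ.≤-reflexive (average (k ℕ.+ j)))) ⟩
      ∑ a g
        ≡⟨ ℚ.+-identityʳ (∑ a g) ⟨
      ∑ a g ℚ.+ 0ℚ
        ≤⟨ ℚ.+-monoʳ-≤ (∑ a g) (frac-≤ 0 0 1 (k ℕ.+ a) ℕ.z≤n) ⟩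
      ∑ a g ℚ.+ g a
        ≡⟨ ∑-shift a g ⟩
      ∑ a (λ j → g (suc j)) ℚ.+ g 0
        ≤⟨ ℚ.+-mono-≤
             (∑-mono a λ j _ → ℚ.≤-reflexive
               (cong (λ c → + 1 / suc c) (ℕ.+-suc k j)))
             (ℚ.≤-reflexive (cong (λ c → + 1 / suc c) (ℕ.+-identityʳ k))) ⟩
      riemann n k ℚ.+ + 1 / suc k ∎
      where
      open ℚ.≤-Reasoning
      g : ℕ → ℚ
      g j = + 1 / suc (k ℕ.+ j)

-- The natural logarithm log n = ∫₁ⁿ dt/t for n ≥ 1 (junk value: log 0 is 0).
log : ℕ → ℝ
log n = fromRegular (riemann n) λ i j → ℚ.≤-trans
  (riemann-refine n i j)
  (ℚ.≤-trans
    (ℚ.≤-reflexive (cong (riemann n) (ℕ.suc-injective (ℕ.*-comm (suc i) (suc j)))))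
    (riemann-upper n j i))

-- The index j : Fin n stands for the integer toℕ j + 1.
val : ∀ {n} → Fin n → ℕ
val j = suc (toℕ j)

Separated : ∀ {n} → ℝ → Subset n → Set
Separated d A = ∀ {a a′} → a ∈ A → a′ ∈ A → a ≢ a′ →
  d ≤ᴿ fromℕ ℕ.∣ val a - val a′ ∣

-- {a ∈ A : a ≡ i (mod p)}, with the congruence as p ∣ |a - i|.
residue : ∀ {n} → Subset n → (p : ℕ) → Fin p → Subset n
residue A p i = A ∩ tabulate λ a → does (p ∣? ℕ.∣ val a - toℕ i ∣)

{-# OPTIONS --safe #-}
-- Let r = ⌊n^{1/3}⌋ and let s be the least index at which A and B differ.  By
-- separation, at most one further differing index e lies within distance r of
-- s.  A Chebyshev polynomial of degree 3r, rescaled so as to be bounded by 1 on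
-- [s + r , s + n], is at least 2 at s; its 2ℓ-th power (2^ℓ > n) times (e - x)
-- is, after clearing denominators, an integer polynomial Q for which
--   S = Σ_{a ∈ A} Q(a) - Σ_{b ∈ B} Q(b)
-- is dominated by the term at s, so S ≠ 0, while log |S| = O(n^{1/3} log² n).
-- If A and B had the same residue counts modulo p then p would divide S.  But,
-- as in Erdős' proof of Bertrand's postulate, if nearly all primes in [N , 2N]
-- divide S then the binomial coefficient (2N choose N) divides S up to a factor
-- of about 4^{2N/3}, which is impossible for N much larger than log |S|.
module Submission where

-- The degree 3r comes from the growth of Chebyshev polynomials just outside [-1 , 1]. The rescaling
-- sends s to 1 + 2r/n, and T_k(1 + 2r/n) is about 1 + 2k²r/n for small k, so k has to be of order
-- (n/r)^{1/2}; this is of order r precisely because r is about n^{1/3}.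
--
-- The value 2 alone is too weak: up to n other terms compete with the one at s, and each carries a
-- factor |e - x| that may be as large as n. The exponent 2ℓ supplies 4^ℓ > n², which beats both.
-- The price is a degree of about 6rℓ, and since each unit of degree costs O(ℓ) bits in |Q|, log |S|
-- is of order rℓ².
--
-- The factor e - x answers an obstacle of its own: separation keeps the set that contains s away
-- from the gap above s, but the other set may have an element there, where the Chebyshev polynomial
-- is not yet small.
--
-- Neither coefficients nor cosines occur. Reduction modulo p needs only that x - y divides Q(x) -
-- Q(y), and both the bound inside the interval and the growth outside it are read off from Pell's
-- equation.

module Primes where

  open import Data.Empty using (⊥)
  open import Data.List.Base using ([]; _∷_)
  open import Data.List.Relation.Unary.All using (_∷_)
  open import Data.Nat.Base
  open import Data.Nat.Combinatorics
    using (_C_; nCk≡n!/k![n-k]!; k![n∸k]!∣n!; nCn≡1; nCk+nC[k+1]≡[n+1]C[k+1])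
  open import Data.Nat.Divisibility
  open import Data.Nat.DivMod using (_/_; m/n*n≡m; m/n*n≤m; m*n/n≡m; /-monoˡ-≤)
  open import Data.Nat.Induction using (<-rec)
  open import Data.Nat.Primality
  open import Data.Nat.Primality.Factorisation using (factorise; module PrimeFactorisation)
  open import Data.Nat.Properties
  open import Data.Nat.Tactic.RingSolver using (solve-∀)
  open import Data.Product.Base using (∃-syntax; _×_; _,_)
  open import Data.Sum.Base using (_⊎_; inj₁; inj₂)
  open import Data.Unit.Base using (tt)
  open import Relation.Binary.PropositionalEquality
  open import Relation.Nullary using (¬_; yes; no; contradiction)
  open import Relation.Nullary.Decidable using (_×-dec_; ¬?; decidable-stable)

  -- Prime factors of binomial coefficients and a prime in [N , 2N] not dividing a given number.

  1≤prime : ∀ {p} → Prime p → 1 ≤ p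
  1≤prime pp = >-nonZero⁻¹ _ {{prime⇒nonZero pp}}

  2≤prime : ∀ {p} → Prime p → 2 ≤ p
  2≤prime {p} pp = nonTrivial⇒n>1 p {{prime⇒nonTrivial pp}}

  prime∤* : ∀ {p m n} → Prime p → ¬ p ∣ m → ¬ p ∣ n → ¬ p ∣ m * n
  prime∤* {p} {m} {n} pp p∤m p∤n p∣mn with euclidsLemma m n pp p∣mn
  ... | inj₁ p∣m = p∤m p∣m
  ... | inj₂ p∣n = p∤n p∣n

  ≤⇒^∣^ : ∀ m {d e} → d ≤ e → m ^ d ∣ m ^ e
  ≤⇒^∣^ m {d} {e} d≤e = subst (m ^ d ∣_)
    (trans (sym (^-distribˡ-+-* m d (e ∸ d))) (cong (m ^_) (m+[n∸m]≡n d≤e))) (m∣m*n (m ^ (e ∸ d)))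

  *-squeeze-< : ∀ {p w} → 2 ≤ p → 1 ≤ w → w < p * w
  *-squeeze-< {p} {w} 2≤p 1≤w = begin-strict
    w       <⟨ m<m+n w 1≤w ⟩
    w + w   ≡⟨ cong (w +_) (+-identityʳ w) ⟨
    2 * w   ≤⟨ *-monoˡ-≤ w 2≤p ⟩
    p * w   ∎
    where open ≤-Reasoning

  split-power : ∀ {p} → Prime p → ∀ n → 1 ≤ n →
                ∃[ i ] ∃[ w ] (n ≡ p ^ i * w × ¬ p ∣ w)
  split-power {p} pp = <-rec _ λ n rec 1≤n → go n rec 1≤n (p ∣? n)
    where
    go : ∀ n → (∀ {m} → m < n → 1 ≤ m → ∃[ i ] ∃[ w ] (m ≡ p ^ i * w × ¬ p ∣ w)) →
         1 ≤ n → _ → ∃[ i ] ∃[ w ] (n ≡ p ^ i * w × ¬ p ∣ w)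
    go n rec 1≤n (no p∤n) = 0 , n , sym (+-identityʳ n) , p∤n
    go n rec 1≤n (yes (divides zero refl)) = contradiction 1≤n λ ()
    go n rec 1≤n (yes (divides q@(suc _) refl))
      with i , w , eq , p∤w ← rec {q} (subst (q <_) (*-comm p q)
          (*-squeeze-< (2≤prime pp) (s≤s z≤n))) (s≤s z≤n)
      = suc i , w , trans (*-comm q p) (trans (cong (p *_) eq) (sym (*-assoc p (p ^ i) w))) , p∤w

  power-∣-cancel : ∀ {p} → Prime p → ∀ e {w q} → ¬ p ∣ w → p ^ e ∣ w * q → p ^ e ∣ q
  power-∣-cancel pp zero p∤w _ = 1∣ _
  power-∣-cancel {p} pp (suc e) {w} {q} p∤w d
    with divides q′ refl ← power-∣-cancel pp e {w} {q} p∤w (∣-trans (n∣m*n p) d)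
    = *-monoˡ-∣ (p ^ e) p∣q′
    where
    instance
      _ = m^n≢0 p e {{prime⇒nonZero pp}}
    p∣q′ : p ∣ q′
    p∣q′ with euclidsLemma w q′ pp
                (*-cancelʳ-∣ (p ^ e) (subst (p * p ^ e ∣_) (sym (*-assoc w q′ (p ^ e))) d))
    ... | inj₁ p∣w = contradiction p∣w p∤w
    ... | inj₂ p∣q = p∣q

  ∃-prime-∣ : ∀ n → 2 ≤ n → ∃[ p ] (Prime p × p ∣ n)
  ∃-prime-∣ n@(suc _) 2≤n with factorise n
  ... | record { factors = [] ; isFactorisation = refl } = contradiction 2≤n λ { (s≤s ()) }
  ... | record { factors = p ∷ ps ; isFactorisation = eq ; factorsPrime = pp ∷ _ } =
    p , pp , subst (p ∣_) (sym eq) (m∣m*n _)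

  -- Strong induction on x: write x = p^(i+1) w with p not dividing w. The smaller w divides y by
  -- induction, and the power of p, being prime to w, divides the quotient.
  ∣-by-prime-powers : ∀ {y} x → 1 ≤ x → (∀ p e → Prime p → p ^ e ∣ x → p ^ e ∣ y) → x ∣ y
  ∣-by-prime-powers {y} = <-rec _ step
    where
    P : ℕ → Set
    P x = 1 ≤ x → (∀ p e → Prime p → p ^ e ∣ x → p ^ e ∣ y) → x ∣ y
    step : ∀ x → (∀ {z} → z < x → P z) → P x
    step 1 rec _ h = 1∣ _
    step x@(2+ _) rec 1≤x h with ∃-prime-∣ x (s≤s (s≤s z≤n))
    ... | p , pp , p∣x with split-power pp x 1≤x
    ... | zero , w , eq , p∤w = contradiction (subst (p ∣_) (trans eq (+-identityʳ w)) p∣x) p∤w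
    ... | suc i , zero , eq , p∤w = contradiction (p ∣0) p∤w
    ... | suc i , w@(suc _) , eq , p∤w = conclude (rec w<x (s≤s z≤n) λ r e pr d → h r e pr (∣-trans d w∣x))
      where
      w∣x : w ∣ x
      w∣x = subst (w ∣_) (sym eq) (n∣m*n (p ^ suc i))
      w<x : w < x
      w<x = subst (w <_) (sym eq) (*-squeeze-< (≤-trans (2≤prime pp)
              (m≤m*n p (p ^ i) {{m^n≢0 p i {{prime⇒nonZero pp}}}})) (s≤s z≤n))
      p^∣x : p ^ suc i ∣ x
      p^∣x = subst (p ^ suc i ∣_) (sym eq) (m∣m*n w)
      conclude : w ∣ y → x ∣ y
      conclude (divides q refl) = subst (_∣ q * w) (sym eq) (*-monoˡ-∣ w
        (power-∣-cancel pp (suc i) {w} p∤w (subst (p ^ suc i ∣_) (*-comm q w)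
          (h p (suc i) pp p^∣x))))

  -- A substitute for lcm(1, ..., n) in which only the power of p is economical: L = p^e W, with W
  -- the product of the prime-to-p parts of 1, ..., n. A number j = p^i w up to n has i ≤ e because
  -- p^i ≤ n < p^(e+1).
  ∃-common-multiple : ∀ {p e n} → Prime p → n < p ^ suc e →
    ∃[ L ] ((∀ j → 1 ≤ j → j ≤ n → j ∣ L) × ¬ p ^ suc e ∣ L)
  ∃-common-multiple {p} {e} {n} pp n<p^ with build n ≤-refl
    where
    instance
      _ = prime⇒nonZero pp
    build : ∀ m → m ≤ n → ∃[ W ] ((∀ j → 1 ≤ j → j ≤ m → j ∣ p ^ e * W) × ¬ p ∣ W)
    build zero _ = 1 , (λ j 1≤j j≤0 → contradiction (≤-trans 1≤j j≤0) λ ()) ,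
      λ p∣1 → contradiction (∣⇒≤ p∣1) (<⇒≱ (2≤prime pp))
    build (suc m) m<n with build m (<⇒≤ m<n) | split-power pp (suc m) (s≤s z≤n)
    ... | W , all , p∤W | i , w , eq , p∤w = W * w , all′ , prime∤* pp p∤W p∤w
      where
      i≤e : i ≤ e
      i≤e = ≮⇒≥ λ e<i → <⇒≱ n<p^ (≤-trans (^-monoʳ-≤ p e<i)
              (≤-trans (∣⇒≤ (subst (p ^ i ∣_) (sym eq) (m∣m*n w))) m<n))
      all′ : ∀ j → 1 ≤ j → j ≤ suc m → j ∣ p ^ e * (W * w)
      all′ j 1≤j j≤ with m≤n⇒m<n∨m≡n j≤
      ... | inj₁ j<  = subst (j ∣_) (*-assoc (p ^ e) W w) (∣m⇒∣m*n w (all j 1≤j (s≤s⁻¹ j<)))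
      ... | inj₂ refl = subst (_∣ p ^ e * (W * w)) (sym eq)
                          (*-pres-∣ (≤⇒^∣^ p i≤e) (n∣m*n W))
  ... | W , all , p∤W = p ^ e * W , all , λ d →
    p∤W (*-cancelˡ-∣ (p ^ e) {{m^n≢0 p e {{prime⇒nonZero pp}}}}
          (subst (_∣ p ^ e * W) (*-comm p (p ^ e)) d))

  C*!*! : ∀ a b → ((a + b) C a) * (a ! * b !) ≡ (a + b) !
  C*!*! a b = begin
    ((a + b) C a) * (a ! * b !)
      ≡⟨ cong (λ c → ((a + b) C a) * (a ! * c !)) (sym (m+n∸m≡n a b)) ⟩
    ((a + b) C a) * (a ! * (a + b ∸ a) !)
      ≡⟨ cong (_* (a ! * (a + b ∸ a) !)) (nCk≡n!/k![n-k]! (m≤m+n a b)) ⟩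
    ((a + b) ! / (a ! * (a + b ∸ a) !)) * (a ! * (a + b ∸ a) !)
      ≡⟨ m/n*n≡m (k![n∸k]!∣n! (m≤m+n a b)) ⟩
    (a + b) ! ∎
    where
    open ≡-Reasoning
    instance
      _ = a !* (a + b ∸ a) !≢0

  -- β a b = 1 / B(a+1, b+1) for Euler's Beta function.
  β : ℕ → ℕ → ℕ
  β a b = suc a * ((suc a + b) C suc a)

  β-! : ∀ a b → β a b * (a ! * b !) ≡ suc (a + b) !
  β-! a b = trans (regroup (suc a) ((suc a + b) C suc a) (a !) (b !)) (C*!*! (suc a) b)
    where
    regroup : ∀ k c x y → k * c * (x * y) ≡ c * (k * x * y)
    regroup = solve-∀

  β-suc₁ : ∀ a b → suc a * β (suc a) b ≡ (2 + a + b) * β a b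
  β-suc₁ a b = *-cancelʳ-≡ _ _ (a ! * b !) {{a !* b !≢0}} (begin
    suc a * β (suc a) b * (a ! * b !)      ≡⟨ regroup (suc a) (β (suc a) b) (a !) (b !) ⟩
    β (suc a) b * (suc a * a ! * b !)      ≡⟨ β-! (suc a) b ⟩
    (2 + a + b) * suc (a + b) !            ≡⟨ cong ((2 + a + b) *_) (sym (β-! a b)) ⟩
    (2 + a + b) * (β a b * (a ! * b !))    ≡⟨ sym (*-assoc (2 + a + b) (β a b) _) ⟩
    (2 + a + b) * β a b * (a ! * b !)      ∎)
    where
    open ≡-Reasoning
    regroup : ∀ k c x y → k * c * (x * y) ≡ c * (k * x * y)
    regroup = solve-∀

  β-suc₂ : ∀ a b → suc b * β a (suc b) ≡ (2 + a + b) * β a b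
  β-suc₂ a b = *-cancelʳ-≡ _ _ (a ! * b !) {{a !* b !≢0}} (begin
    suc b * β a (suc b) * (a ! * b !)      ≡⟨ regroup (suc b) (β a (suc b)) (a !) (b !) ⟩
    β a (suc b) * (a ! * (suc b * b !))    ≡⟨ β-! a (suc b) ⟩
    suc (a + suc b) !                      ≡⟨ cong (λ c → suc c !) (+-suc a b) ⟩
    (2 + a + b) * suc (a + b) !            ≡⟨ cong ((2 + a + b) *_) (sym (β-! a b)) ⟩
    (2 + a + b) * (β a b * (a ! * b !))    ≡⟨ sym (*-assoc (2 + a + b) (β a b) _) ⟩
    (2 + a + b) * β a b * (a ! * b !)      ∎)
    where
    open ≡-Reasoning
    regroup : ∀ k c x y → k * c * (x * y) ≡ c * (x * (k * y))
    regroup = solve-∀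

  1≤β : ∀ a b → 1 ≤ β a b
  1≤β a b = n≢0⇒n>0 λ eq → ≢-nonZero⁻¹ (suc (a + b) !) {{suc (a + b) !≢0}}
    (trans (sym (β-! a b)) (cong (_* (a ! * b !)) eq))

  -- B(a+1, b+1) = B(a+2, b+1) + B(a+1, b+2), cleared of denominators.
  β-harmonic : ∀ a b → β a (suc b) * β (suc a) b ≡ β a b * (β (suc a) b + β a (suc b))
  β-harmonic a b = *-cancelˡ-≡ _ _ (suc a * suc b) (begin
    suc a * suc b * (z * y)               ≡⟨ r₁ (suc a) (suc b) z y ⟩
    suc b * z * (suc a * y)               ≡⟨ cong₂ _*_ (β-suc₂ a b) (β-suc₁ a b) ⟩
    s * x * (s * x)                       ≡⟨ r₂ a b x ⟩
    x * (suc b * (s * x) + suc a * (s * x))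
      ≡⟨ cong₂ (λ c d → x * (suc b * c + suc a * d)) (sym (β-suc₁ a b)) (sym (β-suc₂ a b)) ⟩
    x * (suc b * (suc a * y) + suc a * (suc b * z)) ≡⟨ r₃ (suc a) (suc b) x y z ⟩
    suc a * suc b * (x * (y + z)) ∎)
    where
    open ≡-Reasoning
    x = β a b
    y = β (suc a) b
    z = β a (suc b)
    s = 2 + a + b
    r₁ : ∀ a b z y → a * b * (z * y) ≡ b * z * (a * y)
    r₁ = solve-∀
    r₂ : ∀ a b x → (2 + a + b) * x * ((2 + a + b) * x) ≡ x *
        (suc b * ((2 + a + b) * x) + suc a * ((2 + a + b) * x))
    r₂ = solve-∀
    r₃ : ∀ a b x y z → x * (b * (a * y) + a * (b * z)) ≡ a * b * (x * (y + z))
    r₃ = solve-∀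

  -- The equation says 1/x = 1/y + 1/z, so L/z = L/x - L/y is an integer.
  harmonic-∣ : ∀ {x y z L} → 1 ≤ x → 1 ≤ y → x ∣ L → y ∣ L → z * y ≡ x * (y + z) → z ∣ L
  harmonic-∣ {x} {y} {z} {L} 1≤x 1≤y (divides α Lα) (divides γ Lγ) eq =
    ∣m+n∣m⇒∣n (divides α (trans key (*-comm z α))) (m∣m*n γ)
    where
    open ≡-Reasoning
    instance
      _ = m*n≢0 x y {{>-nonZero 1≤x}} {{>-nonZero 1≤y}}
    r₁ : ∀ x y z g L → (z * g + L) * (x * y) ≡ z * x * (g * y) + L * (x * y)
    r₁ = solve-∀
    r₂ : ∀ x y z L → z * x * L + L * (x * y) ≡ L * (x * (y + z))
    r₂ = solve-∀
    r₃ : ∀ x y z a → a * x * (z * y) ≡ z * a * (x * y)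
    r₃ = solve-∀
    key : z * γ + L ≡ z * α
    key = *-cancelʳ-≡ _ _ (x * y) (begin
      (z * γ + L) * (x * y)           ≡⟨ r₁ x y z γ L ⟩
      z * x * (γ * y) + L * (x * y)   ≡⟨ cong (λ c → z * x * c + L * (x * y)) (sym Lγ) ⟩
      z * x * L + L * (x * y)         ≡⟨ r₂ x y z L ⟩
      L * (x * (y + z))               ≡⟨ cong₂ _*_ Lα (sym eq) ⟩
      α * x * (z * y)                 ≡⟨ r₃ x y z α ⟩
      z * α * (x * y)                 ∎)

  -- The numbers 1/β form Leibniz's harmonic triangle: `β a 0` is a + 1, and each further entry is a
  -- difference of two entries with smaller b, so divisibility spreads by `harmonic-∣`.
  β-∣ : ∀ b a {L} → (∀ j → 1 ≤ j → j ≤ suc (a + b) → j ∣ L) → β a b ∣ L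
  β-∣ zero a {L} all = subst (_∣ L) (sym eq) (all (suc a) (s≤s z≤n) (s≤s (m≤m+n a 0)))
    where
    eq : β a 0 ≡ suc a
    eq = trans (cong (suc a *_) (trans (cong (_C suc a) (+-identityʳ (suc a))) (nCn≡1 (suc a))))
        (*-identityʳ (suc a))
  β-∣ (suc b) a {L} all = harmonic-∣ (1≤β a b) (1≤β (suc a) b)
    (β-∣ b a λ j 1≤j j≤ → all j 1≤j (≤-trans j≤ (s≤s (+-monoʳ-≤ a (n≤1+n b)))))
    (β-∣ b (suc a) λ j 1≤j j≤ → all j 1≤j (≤-trans j≤ (≤-reflexive (cong suc (sym (+-suc a b))))))
    (β-harmonic a b)

  -- Takes the place of Legendre's formula. The binomial coefficient divides `β a b`, hence every
  -- common multiple of 1, ..., a + b + 1; were the prime power larger than a + b + 1,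
  -- `∃-common-multiple` would give one that it does not divide.
  prime-power-∣C⇒≤ : ∀ {p} e a b → Prime p → p ^ e ∣ (suc a + b) C suc a → p ^ e ≤ suc a + b
  prime-power-∣C⇒≤ zero a b pp d = s≤s z≤n
  prime-power-∣C⇒≤ {p} (suc e) a b pp d with p ^ suc e ≤? suc a + b
  ... | yes le = le
  ... | no ¬le with L , all , ∤L ← ∃-common-multiple {p} {e} pp (≰⇒> ¬le)
    = contradiction (∣-trans (∣-trans d (n∣m*n (suc a))) (β-∣ b a all)) ∤L

  ∣!⇒≤ : ∀ {p} n → Prime p → p ∣ n ! → p ≤ n
  ∣!⇒≤ zero pp d = contradiction (∣⇒≤ d) (<⇒≱ (2≤prime pp))
  ∣!⇒≤ (suc n) pp d with euclidsLemma (suc n) (n !) pp d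
  ... | inj₁ d′ = ∣⇒≤ d′
  ... | inj₂ d′ = m≤n⇒m≤1+n (∣!⇒≤ n pp d′)

  ≤⇒∣! : ∀ {m} n → 1 ≤ m → m ≤ n → m ∣ n !
  ≤⇒∣! zero 1≤m m≤0 = contradiction (≤-trans 1≤m m≤0) λ ()
  ≤⇒∣! (suc n) 1≤m m≤ with m≤n⇒m<n∨m≡n m≤
  ... | inj₁ m<  = ∣n⇒∣m*n (suc n) (≤⇒∣! n 1≤m (s≤s⁻¹ m<))
  ... | inj₂ refl = m∣m*n (n !)

  prime-∣C : ∀ {p} a b → Prime p → a < p → b < p → p ≤ a + b → p ∣ (a + b) C a
  prime-∣C {p} a b pp a<p b<p p≤ with euclidsLemma ((a + b) C a) (a ! * b !) pp
                                       (subst (p ∣_) (sym (C*!*! a b)) (≤⇒∣! (a + b) (1≤prime pp) p≤))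
  ... | inj₁ d = d
  ... | inj₂ d = contradiction d (prime∤* pp (λ d′ → <⇒≱ a<p (∣!⇒≤ a pp d′))
      (λ d′ → <⇒≱ b<p (∣!⇒≤ b pp d′)))

  C≤2^ : ∀ n k → n C k ≤ 2 ^ n
  -- Bounding two neighbours at once lets Pascal's rule close the induction, and is what makes the
  -- sharp bound `odd-C≤4^` possible.
  C+C≤2^ : ∀ n k → n C k + n C suc k ≤ 2 ^ n
  C≤2^ n k = ≤-trans (m≤m+n (n C k) _) (C+C≤2^ n k)
  C+C≤2^ zero zero = s≤s z≤n
  C+C≤2^ zero (suc k) = z≤n
  C+C≤2^ (suc n) zero = begin
    1 + suc n C 1          ≡⟨ cong (1 +_) (sym (nCk+nC[k+1]≡[n+1]C[k+1] n 0)) ⟩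
    1 + (1 + n C 1)        ≤⟨ +-mono-≤ (m^n>0 2 n) (C+C≤2^ n 0) ⟩
    2 ^ n + 2 ^ n          ≡⟨ cong (2 ^ n +_) (+-identityʳ (2 ^ n)) ⟨
    2 ^ suc n              ∎
    where open ≤-Reasoning
  C+C≤2^ (suc n) (suc k) = begin
    suc n C suc k + suc n C (2 + k)
      ≡⟨ cong₂ _+_ (nCk+nC[k+1]≡[n+1]C[k+1] n k) (nCk+nC[k+1]≡[n+1]C[k+1] n (suc k)) ⟨
    (n C k + n C suc k) + (n C suc k + n C (2 + k))
      ≤⟨ +-mono-≤ (C+C≤2^ n k) (C+C≤2^ n (suc k)) ⟩
    2 ^ n + 2 ^ n          ≡⟨ cong (2 ^ n +_) (+-identityʳ (2 ^ n)) ⟨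
    2 ^ suc n              ∎
    where open ≤-Reasoning

  4^≡2^2* : ∀ m → 4 ^ m ≡ 2 ^ (m + m)
  4^≡2^2* m = trans (^-*-assoc 2 2 m) (cong (λ c → 2 ^ (m + c)) (+-identityʳ m))

  -- (2m+1 choose m) and (2m+1 choose m+1) are equal and sum to at most 2^(2m+1).
  odd-C≤4^ : ∀ m → (suc m + m) C suc m ≤ 4 ^ m
  odd-C≤4^ m = *-cancelˡ-≤ 2 (begin
    2 * C′                     ≡⟨ cong (C′ +_) (+-identityʳ C′) ⟩
    C′ + C′                    ≡⟨ cong (_+ C′) symm ⟩
    (suc m + m) C m + C′       ≤⟨ C+C≤2^ (suc m + m) m ⟩
    2 ^ (suc m + m)            ≡⟨ cong (2 *_) (4^≡2^2* m) ⟨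
    2 * 4 ^ m                  ∎)
    where
    open ≤-Reasoning
    C′ = (suc m + m) C suc m
    symm : C′ ≡ (suc m + m) C m
    symm = *-cancelʳ-≡ _ _ (suc m ! * m !) {{suc m !* m !≢0}} (trans (C*!*! (suc m) m)
      (trans (cong _! (sym (+-suc m m))) (trans (sym (C*!*! m (suc m)))
        (cong₂ _*_ (cong (_C m) (+-suc m m)) (*-comm (m !) (suc m !))))))

  primorial : ℕ → ℕ
  primorial zero = 1
  primorial (suc n) with prime? (suc n)
  ... | yes _ = suc n * primorial n
  ... | no  _ = primorial n

  prime-∣primorial : ∀ {p} n → Prime p → p ≤ n → p ∣ primorial n
  prime-∣primorial zero pp p≤0 = contradiction (≤-trans (1≤prime pp) p≤0) λ ()
  prime-∣primorial (suc n) pp p≤ with prime? (suc n) | m≤n⇒m<n∨m≡n p≤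
  ... | yes _  | inj₁ p<  = ∣n⇒∣m*n (suc n) (prime-∣primorial n pp (s≤s⁻¹ p<))
  ... | yes _  | inj₂ refl = m∣m*n (primorial n)
  ... | no _   | inj₁ p<  = prime-∣primorial n pp (s≤s⁻¹ p<)
  ... | no ¬pp | inj₂ refl = contradiction pp ¬pp

  ∣primorial⇒≤ : ∀ {p} n → Prime p → p ∣ primorial n → p ≤ n
  ∣primorial⇒≤ zero pp d = contradiction (∣⇒≤ d) (<⇒≱ (2≤prime pp))
  ∣primorial⇒≤ (suc n) pp d with prime? (suc n)
  ... | no _ = m≤n⇒m≤1+n (∣primorial⇒≤ n pp d)
  ... | yes _ with euclidsLemma (suc n) (primorial n) pp d
  ...   | inj₁ d′ = ∣⇒≤ d′
  ...   | inj₂ d′ = m≤n⇒m≤1+n (∣primorial⇒≤ n pp d′)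

  primorial-∣ : ∀ {X} h d → (∀ p → Prime p → h < p → p ≤ d + h → p ∣ X) →
                primorial (d + h) ∣ primorial h * X
  primorial-∣ {X} h zero _ = m∣m*n X
  primorial-∣ {X} h (suc d) all
    with prime? (suc d + h) | primorial-∣ {X} h d (λ p pp h<p p≤ → all p pp h<p (m≤n⇒m≤1+n p≤))
  ... | no _   | ih = ih
  ... | yes pp | divides q eq = subst (suc (d + h) * primorial (d + h) ∣_) (sym eq)
                                  (*-monoˡ-∣ (primorial (d + h)) p∣q)
    where
    p∣q : suc (d + h) ∣ q
    p∣q with euclidsLemma q (primorial (d + h)) pp (subst (suc (d + h) ∣_) eq
               (∣n⇒∣m*n (primorial h) (all (suc (d + h)) pp (s≤s (m≤n+m h d)) ≤-refl)))
    ... | inj₁ d∣q = d∣q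
    ... | inj₂ d∣θ = contradiction (∣primorial⇒≤ (d + h) pp d∣θ) 1+n≰n

  1≤primorial : ∀ n → 1 ≤ primorial n
  1≤primorial zero = s≤s z≤n
  1≤primorial (suc n) with prime? (suc n)
  ... | yes _ = *-mono-≤ {1} {suc n} (s≤s z≤n) (1≤primorial n)
  ... | no  _ = 1≤primorial n

  halve : ∀ n → ∃[ m ] (n ≡ m + m ⊎ n ≡ suc (m + m))
  halve zero = 0 , inj₁ refl
  halve (suc n) with halve n
  ... | m , inj₁ refl = m , inj₂ refl
  ... | m , inj₂ refl = suc m , inj₁ (cong suc (sym (+-suc m m)))

  1≤C : ∀ a b → 1 ≤ (a + b) C a
  1≤C a b = n≢0⇒n>0 λ eq → ≢-nonZero⁻¹ ((a + b) !) {{(a + b) !≢0}}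
    (trans (sym (C*!*! a b)) (cong (_* (a ! * b !)) eq))

  primorial-+≤ : ∀ a b {e} → b ≤ a → primorial a ≤ 4 ^ a → (a + b) C a ≤ 4 ^ e →
                 primorial (b + a) ≤ 4 ^ (a + e)
  primorial-+≤ a b {e} b≤a θ≤ C≤ = begin
    primorial (b + a)             ≤⟨ ∣⇒≤
        {{m*n≢0 _ _ {{>-nonZero (1≤primorial a)}} {{>-nonZero (1≤C a b)}}}} (primorial-∣ a b λ p pp a<p p≤ →
                                       prime-∣C a b pp a<p (≤-<-trans b≤a a<p)
                                           (subst (p ≤_) (+-comm b a) p≤)) ⟩
    primorial a * ((a + b) C a)   ≤⟨ *-mono-≤ θ≤ C≤ ⟩
    4 ^ a * 4 ^ e                 ≡⟨ ^-distribˡ-+-* 4 a e ⟨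
    4 ^ (a + e)                   ∎
    where open ≤-Reasoning

  -- Erdős' induction, from m to 2m and from m + 1 to 2m + 1: the primes gained divide a binomial
  -- coefficient of size at most 4^m, and the exponents m + m and (m + 1) + m are exactly the new n.
  primorial≤4^ : ∀ n → primorial n ≤ 4 ^ n
  primorial≤4^ = <-rec _ step
    where
    step : ∀ n → (∀ {m} → m < n → primorial m ≤ 4 ^ m) → primorial n ≤ 4 ^ n
    step n rec with halve n
    ... | zero , inj₁ refl = s≤s z≤n
    ... | zero , inj₂ refl = s≤s z≤n
    ... | m@(suc _) , inj₁ refl = primorial-+≤ m m {m} ≤-refl (rec (m<m+n m (s≤s z≤n)))
            (subst ((m + m) C m ≤_) (sym (4^≡2^2* m)) (C≤2^ (m + m) m))
    ... | m@(suc _) , inj₂ refl = subst (λ x → primorial x ≤ 4 ^ suc (m + m)) (+-suc m m)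
            (primorial-+≤ (suc m) m {m} (n≤1+n m) (rec (s≤s (m<m+n m (s≤s z≤n)))) (odd-C≤4^ m))

  central : ℕ → ℕ
  central n = (n + n) C n

  central-suc : ∀ n → suc n * central (suc n) ≡ 2 * suc (n + n) * central n
  central-suc n = *-cancelʳ-≡ _ _ (suc n *
      (n ! * n !)) {{m*n≢0 (suc n) (n ! * n !) {{_}} {{n !* n !≢0}}}} (begin
    suc n * central (suc n) * (suc n * (n ! * n !))  ≡⟨ r₁ (suc n) (central (suc n)) (n !) ⟩
    central (suc n) * (suc n ! * suc n !)            ≡⟨ C*!*! (suc n) (suc n) ⟩
    (suc n + suc n) !                                ≡⟨ cong (λ c → suc c !) (+-suc n n) ⟩
    (2 + (n + n)) * (suc (n + n) * (n + n) !)
      ≡⟨ cong (λ c → (2 + (n + n)) * (suc (n + n) * c)) (sym (C*!*! n n)) ⟩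
    (2 + (n + n)) * (suc (n + n) * (central n * (n ! * n !))) ≡⟨ r₂ n (central n) (n ! * n !) ⟩
    2 * suc (n + n) * central n * (suc n * (n ! * n !)) ∎)
    where
    open ≡-Reasoning
    r₁ : ∀ a c x → a * c * (a * (x * x)) ≡ c * (a * x * (a * x))
    r₁ = solve-∀
    r₂ : ∀ n c x → (2 + (n + n)) * (suc (n + n) * (c * x)) ≡ 2 * suc (n + n) * c * (suc n * x)
    r₂ = solve-∀

  4^≤central : ∀ n → 1 ≤ n → 4 ^ n ≤ 2 * n * central n
  4^≤central (suc zero) _ = ≤-refl
  4^≤central (suc n@(suc _)) _ = begin
    4 * 4 ^ n                        ≤⟨ *-monoʳ-≤ 4 (4^≤central n (s≤s z≤n)) ⟩
    4 * (2 * n * central n)          ≤⟨ m≤m+n _ (4 * central n) ⟩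
    4 * (2 * n * central n) + 4 * central n ≡⟨ r n (central n) ⟩
    2 * (2 * suc (n + n) * central n) ≡⟨ cong (2 *_) (central-suc n) ⟨
    2 * (suc n * central (suc n))    ≡⟨ *-assoc 2 (suc n) (central (suc n)) ⟨
    2 * suc n * central (suc n)      ∎
    where
    open ≤-Reasoning
    r : ∀ n c → 4 * (2 * n * c) + 4 * c ≡ 2 * (2 * suc (n + n) * c)
    r = solve-∀

  -- Exact divisibility: c is the p-adic valuation of n.
  _^_∥_ : ℕ → ℕ → ℕ → Set
  p ^ c ∥ n = ∃[ w ] (n ≡ p ^ c * w × ¬ p ∣ w)

  module _ {p} (pp : Prime p) where

    ∥-* : ∀ {c n t} → ¬ p ∣ t → p ^ c ∥ n → p ^ c ∥ (t * n)
    ∥-* {c} {n} {t} p∤t (w , eq , p∤w) = t * w ,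
      trans (cong (t *_) eq) (r t (p ^ c) w) , prime∤* pp p∤t p∤w
      where
      r : ∀ t q w → t * (q * w) ≡ q * (t * w)
      r = solve-∀

    ∥-p* : ∀ {c n} → p ^ c ∥ n → p ^ suc c ∥ (p * n)
    ∥-p* {c} (w , eq , p∤w) = w , trans (cong (p *_) eq) (sym (*-assoc p (p ^ c) w)) , p∤w

    -- The factors of the factorial strictly between pm and p(m + 1) are prime to p and leave the
    -- valuation alone.
    ∥-!-+ : ∀ {c} m s → s < p → p ^ c ∥ ((p * m) !) → p ^ c ∥ ((s + p * m) !)
    ∥-!-+ m zero _ h = h
    ∥-!-+ {c} m (suc s) s<p h = ∥-* {c}
      (λ d → <⇒≱ s<p (∣⇒≤ (∣m+n∣n⇒∣m d (m∣m*n m)))) (∥-!-+ {c} m s (<-trans (n<1+n s) s<p) h)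
      where
      ∣m+n∣n⇒∣m : ∀ {k m n} → k ∣ m + n → k ∣ n → k ∣ m
      ∣m+n∣n⇒∣m {k} {m} {n} d = ∣m+n∣m⇒∣n (subst (k ∣_) (+-comm m n) d)

    ∥-!-suc : ∀ {c} m → ¬ p ∣ suc m → p ^ c ∥ ((p * m) !) → p ^ suc c ∥ ((p * suc m) !)
    ∥-!-suc {c} m p∤m h = subst (λ x → p ^ suc c ∥ x) eq
      (∥-* {suc c} {t = suc m} p∤m (∥-p* {c} (∥-!-+ {c} m (pred p) pred<p h)))
      where
      instance
        _ = prime⇒nonZero pp
      pred<p : pred p < p
      pred<p = ≤-reflexive (suc-pred p)
      idx : suc (pred p + p * m) ≡ p * suc m
      idx = trans (cong (_+ p * m) (suc-pred p)) (sym (*-suc p m))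
      eq : suc m * (p * (pred p + p * m) !) ≡ (p * suc m) !
      eq = trans (sym (*-assoc (suc m) p _)) (trans (cong (_* (pred p + p * m) !)
             (trans (*-comm (suc m) p) (sym idx))) (cong _! idx))

    -- With n = p + s and 2s < p, p divides n! once and (2n)! exactly twice.
    prime∤central : ∀ n → 3 ≤ p → p ≤ n → 2 * n < 3 * p → ¬ p ∣ central n
    prime∤central n 3≤p p≤n 2n<3p p∣C = contra n! 2n! (C*!*! n n)
      where
      p∤ : ∀ {k} → 1 ≤ k → k < p → ¬ p ∣ k
      p∤ 1≤k k<p d = <⇒≱ k<p (∣⇒≤ {{>-nonZero 1≤k}} d)
      s = n ∸ p
      n≡ : s + p ≡ n
      n≡ = m∸n+n≡m p≤n
      2s<p : s + s < p
      2s<p = +-cancelʳ-< (2 * p) (s + s) p (subst (_< p + 2 * p)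
        (trans (cong (2 *_) (sym n≡)) (r s p)) 2n<3p)
        where
        r : ∀ s p → 2 * (s + p) ≡ s + s + 2 * p
        r = solve-∀
      0! : p ^ 0 ∥ ((p * 0) !)
      0! = 1 , cong _! (*-zeroʳ p) , p∤ ≤-refl (2≤prime pp)
      1! : p ^ 1 ∥ ((p * 1) !)
      1! = ∥-!-suc {0} 0 (p∤ ≤-refl (2≤prime pp)) 0!
      n! : p ^ 1 ∥ (n !)
      n! = subst (λ x → p ^ 1 ∥ (x !)) (trans (cong (s +_) (*-identityʳ p)) n≡)
        (∥-!-+ {1} 1 s (≤-<-trans (m≤m+n s s) 2s<p) 1!)
      2n! : p ^ 2 ∥ ((n + n) !)
      2n! = subst (λ x → p ^ 2 ∥ (x !)) (trans (r s p) (cong₂ _+_ n≡ n≡))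
        (∥-!-+ {2} 2 (s + s) 2s<p (∥-!-suc {1} 1 (p∤ (s≤s z≤n) 3≤p) 1!))
        where
        r : ∀ s p → s + s + p * 2 ≡ (s + p) + (s + p)
        r = solve-∀
      contra : p ^ 1 ∥ (n !) → p ^ 2 ∥ ((n + n) !) → central n * (n ! * n !) ≡ (n + n) ! → ⊥
      contra (w , eq , _) (v , eq′ , p∤v) eq″ = p∤v (subst (p ∣_) C*w²≡v (∣m⇒∣m*n (w * w) p∣C))
        where
        r : ∀ c p w → p ^ 2 * (c * (w * w)) ≡ c * ((p ^ 1 * w) * (p ^ 1 * w))
        r c p w = r′ c p w
          where
          r′ : ∀ c p w → p * (p * 1) * (c * (w * w)) ≡ c * ((p * 1 * w) * (p * 1 * w))
          r′ = solve-∀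
        C*w²≡v : central n * (w * w) ≡ v
        C*w²≡v = *-cancelˡ-≡ _ _ (p ^ 2) {{m^n≢0 p 2 {{prime⇒nonZero pp}}}}
          (trans (r (central n) p w) (trans (cong (central n *_) (sym (cong₂ _*_ eq eq))) (trans eq″ eq′)))

  ⌊√⌋ : ∀ n → ∃[ r ] (r * r ≤ n × n < suc r * suc r)
  ⌊√⌋ zero = 0 , z≤n , s≤s z≤n
  ⌊√⌋ (suc n) with ⌊√⌋ n
  ... | r , lo , hi with suc r * suc r ≤? suc n
  ...   | yes le = suc r , le , ≤-<-trans hi (*-mono-< (n<1+n (suc r)) (n<1+n (suc r)))
  ...   | no ¬le = r , m≤n⇒m≤1+n lo , ≰⇒> ¬le

  ⌊log₂⌋ : ∀ n → 1 ≤ n → ∃[ h ] (2 ^ h ≤ n × n < 2 ^ suc h)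
  ⌊log₂⌋ 1 _ = 0 , ≤-refl , ≤-refl
  ⌊log₂⌋ (suc n@(suc _)) _ with ⌊log₂⌋ n (s≤s z≤n)
  ... | h , lo , hi with 2 ^ suc h ≤? suc n
  ...   | yes le = suc h , le , (begin-strict
            suc n                  ≤⟨ hi ⟩
            2 ^ suc h              <⟨ ^-monoʳ-< 2 (s≤s (s≤s z≤n)) (n<1+n (suc h)) ⟩
            2 ^ (2 + h)            ∎)
    where open ≤-Reasoning
  ...   | no ¬le = h , m≤n⇒m≤1+n lo , ≰⇒> ¬le

  -- Serves to make (2N)^{1/2} log² N a small fraction of N. The step from l to l + 1 multiplies the
  -- left side by at most (5/4)² < 2.
  quartic≤2^ : ∀ {l} → 32 ≤ l → 128 * ((l * l) * (l * l)) ≤ 2 ^ l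
  quartic≤2^ 32≤l = go (≤⇒≤′ 32≤l)
    where
    open ≤-Reasoning
    go : ∀ {l} → 32 ≤′ l → 128 * ((l * l) * (l * l)) ≤ 2 ^ l
    go ≤′-refl = ≤ᵇ⇒≤ (128 * ((32 * 32) * (32 * 32))) (2 ^ 32) tt
    go (≤′-step {l} 32≤′l) = *-cancelˡ-≤ 16 (begin
      16 * (128 * (q′ * q′))        ≡⟨ r₁ q′ ⟩
      128 * ((4 * q′) * (4 * q′))   ≤⟨ *-monoʳ-≤ 128 (*-mono-≤ 4q′≤5q 4q′≤5q) ⟩
      128 * ((5 * q) * (5 * q))     ≤⟨ m≤m+n _ (896 * (q * q)) ⟩
      128 * ((5 * q) * (5 * q)) + 896 * (q * q) ≡⟨ r₂ q ⟩
      16 * (2 * (128 * (q * q)))    ≤⟨ *-monoʳ-≤ 16 (*-monoʳ-≤ 2 (go 32≤′l)) ⟩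
      16 * 2 ^ suc l                ∎)
      where
      q = l * l
      q′ = suc l * suc l
      r₁ : ∀ q → 16 * (128 * (q * q)) ≡ 128 * ((4 * q) * (4 * q))
      r₁ = solve-∀
      r₂ : ∀ q → 128 * ((5 * q) * (5 * q)) + 896 * (q * q) ≡ 16 * (2 * (128 * (q * q)))
      r₂ = solve-∀
      r₃ : ∀ l → 4 * (suc l * suc l) ≡ 4 * (l * l) + (8 * l + 4)
      r₃ = solve-∀
      r₄ : ∀ l → 8 * l + l ≡ 9 * l
      r₄ = solve-∀
      r₅ : ∀ q → 4 * q + q ≡ 5 * q
      r₅ = solve-∀
      32≤ = ≤′⇒≤ 32≤′l
      4q′≤5q : 4 * q′ ≤ 5 * q
      4q′≤5q = begin
        4 * q′                ≡⟨ r₃ l ⟩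
        4 * q + (8 * l + 4)
          ≤⟨ +-monoʳ-≤ (4 * q) (+-monoʳ-≤ (8 * l) (≤-trans (≤ᵇ⇒≤ 4 32 tt) 32≤)) ⟩
        4 * q + (8 * l + l)   ≡⟨ cong (4 * q +_) (r₄ l) ⟩
        4 * q + 9 * l         ≤⟨ +-monoʳ-≤ (4 * q) (*-monoˡ-≤ l (≤-trans (≤ᵇ⇒≤ 9 32 tt) 32≤)) ⟩
        4 * q + q             ≡⟨ r₅ q ⟩
        5 * q                 ∎

  m*n≤o⇒m≤o/n : ∀ m n {o} .{{_ : NonZero n}} → m * n ≤ o → m ≤ o / n
  m*n≤o⇒m≤o/n m n {o} le = subst (_≤ o / n) (m*n/n≡m m n) (/-monoˡ-≤ n le)

  !≤^ : ∀ {x} r → r ≤ x → r ! ≤ x ^ r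
  !≤^ zero _ = ≤-refl
  !≤^ (suc r) r<x = *-mono-≤ r<x (!≤^ r (<⇒≤ r<x))

  ∣⇒^∣^ : ∀ {m n} e → m ∣ n → m ^ e ∣ n ^ e
  ∣⇒^∣^ zero _ = ∣-refl
  ∣⇒^∣^ (suc e) d = *-pres-∣ d (∣⇒^∣^ e d)

  *-self-cancel-< : ∀ {a b} → a * a < b * b → a < b
  *-self-cancel-< {a} {b} lt = ≰⇒> λ b≤a → <⇒≱ lt (*-mono-≤ b≤a b≤a)

  *-self-cancel-≤ : ∀ {a b} → a * a ≤ b * b → a ≤ b
  *-self-cancel-≤ {a} {b} le = ≮⇒≥ λ b<a → <⇒≱ (*-mono-< b<a b<a) le

  module _ {N S e : ℕ} (2^40≤N : 2 ^ 40 ≤ N) (4e≤N : 4 * e ≤ N) (1≤S : 1 ≤ S) (S≤ : S ≤ 2 ^ e)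
    (all : ∀ p → Prime p → 2 + N ≤ p → p ≤ 2 * N → p ∣ S) where

    private
      1≤N : 1 ≤ N
      1≤N = ≤-trans (m^n>0 2 40) 2^40≤N

      1≤2N : 1 ≤ 2 * N
      1≤2N = ≤-trans 1≤N (m≤n*m N 2)

      t = (2 * N) / 3

      3t≤2N : 3 * t ≤ 2 * N
      3t≤2N = subst (_≤ 2 * N) (*-comm t 3) (m/n*n≤m (2 * N) 3)

      module _ {R h : ℕ} (R²≤ : R * R ≤ 2 * N) (<R² : 2 * N < suc R * suc R)
               (2^h≤ : 2 ^ h ≤ 2 * N) (<2^l : 2 * N < 2 ^ suc h) where

        l = suc h

        -- One factor for each kind of prime power p^f in the central binomial coefficient. For f =
        -- 1: `S` for p above N + 1, `suc N` for p = N + 1, which `all` does not cover, and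
        -- `primorial t` for p up to 2N/3; primes between 2N/3 and N do not occur. For f ≥ 2, p² ≤
        -- 2N forces p ≤ R, and 2^f ≤ 2N forces f ≤ l, so `(R !) ^ l` suffices.
        T = S * (primorial t * (suc N * (R !) ^ l))

        C∣T : central N ∣ T
        C∣T = ∣-by-prime-powers (central N) (1≤C N N) power
          where
          p^≤ : ∀ p f → Prime p → p ^ f ∣ central N → p ^ f ≤ 2 * N
          p^≤ p f pp d = N-pos N 1≤N d
            where
            N-pos : ∀ N → 1 ≤ N → p ^ f ∣ central N → p ^ f ≤ 2 * N
            N-pos N@(suc N′) _ d = subst (p ^ f ≤_) (cong (N +_) (sym (+-identityʳ N)))
                                     (prime-power-∣C⇒≤ f N′ N pp d)

          power : ∀ p f → Prime p → p ^ f ∣ central N → p ^ f ∣ T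
          power p zero pp d = 1∣ T
          power p (suc zero) pp d = subst (_∣ T) (sym (*-identityʳ p)) p∣T
            where
            p∣C : p ∣ central N
            p∣C = subst (_∣ central N) (*-identityʳ p) d
            p≤2N : p ≤ 2 * N
            p≤2N = subst (_≤ 2 * N) (*-identityʳ p) (p^≤ p 1 pp d)
            p∣T : p ∣ T
            p∣T with p ≤? t
            ... | yes p≤t = ∣n⇒∣m*n S (∣m⇒∣m*n _ (prime-∣primorial t pp p≤t))
            ... | no p≰t with p ≤? N
            ...   | yes p≤N = contradiction p∣C (prime∤central pp N 3≤p p≤N 2N<3p)
              where
              t<p = ≰⇒> p≰t
              2≤t : 2 ≤ t
              2≤t = m*n≤o⇒m≤o/n 2 3 (≤-trans (≤ᵇ⇒≤ 6 (2 ^ 40) tt) (≤-trans 2^40≤N (m≤n*m N 2)))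
              3≤p : 3 ≤ p
              3≤p = ≤-trans (s≤s 2≤t) t<p
              2N<3p : 2 * N < 3 * p
              2N<3p = ≰⇒> λ 3p≤ → p≰t (m*n≤o⇒m≤o/n p 3 (subst (_≤ 2 * N) (*-comm 3 p) 3p≤))
            ...   | no p≰N with m≤n⇒m<n∨m≡n (≰⇒> p≰N)
            ...     | inj₁ N+1<p = ∣m⇒∣m*n _ (all p pp N+1<p p≤2N)
            ...     | inj₂ refl = ∣n⇒∣m*n S (∣n⇒∣m*n (primorial t) (m∣m*n _))
          power p f@(suc (suc f′)) pp d = ∣n⇒∣m*n S (∣n⇒∣m*n (primorial t) (∣n⇒∣m*n (suc N)
              (∣-trans (∣⇒^∣^ f (≤⇒∣! R (1≤prime pp) p≤R)) (≤⇒^∣^ (R !) f≤l))))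
            where
            open ≤-Reasoning
            instance _ = prime⇒nonZero pp
            p≤R : p ≤ R
            p≤R = s≤s⁻¹ (*-self-cancel-< (begin-strict
              p * p            ≤⟨ *-monoʳ-≤ p (m≤m*n p (p ^ f′) {{m^n≢0 p f′}}) ⟩
              p ^ f            ≤⟨ p^≤ p f pp d ⟩
              2 * N            <⟨ <R² ⟩
              suc R * suc R    ∎))
            f≤l : f ≤ l
            f≤l = ≮⇒≥ λ l<f → n≮n (2 * N) (begin-strict
              2 * N            <⟨ <2^l ⟩
              2 ^ l            ≤⟨ ^-monoʳ-≤ 2 (<⇒≤ l<f) ⟩
              2 ^ f            ≤⟨ ^-monoˡ-≤ f (2≤prime pp) ⟩
              p ^ f            ≤⟨ p^≤ p f pp d ⟩
              2 * N            ∎)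

        R≤2N : R ≤ 2 * N
        R≤2N = ≤-trans (R≤R*R R) R²≤
          where
          R≤R*R : ∀ R → R ≤ R * R
          R≤R*R zero = z≤n
          R≤R*R R@(suc _) = m≤m*n R R

        open ≤-Reasoning

        E = l + (e + ((t + t) + (l + R * (l * l))))

        4^N≤2^E : 2 ^ (N + N) ≤ 2 ^ E
        4^N≤2^E = begin
          2 ^ (N + N)          ≡⟨ 4^≡2^2* N ⟨
          4 ^ N                ≤⟨ 4^≤central N 1≤N ⟩
          2 * N * central N    ≤⟨ *-mono-≤ (<⇒≤ <2^l) (∣⇒≤ {{>-nonZero 1≤T}} C∣T) ⟩
          2 ^ l * T
            ≤⟨ *-monoʳ-≤ (2 ^ l) (*-mono-≤ S≤ (*-mono-≤ θ≤ (*-mono-≤ N<2^l !≤))) ⟩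
          2 ^ l * (2 ^ e * (2 ^ (t + t) * (2 ^ l * 2 ^ (R * (l * l)))))
            ≡⟨ cong (λ x → 2 ^ l * (2 ^ e * (2 ^ (t + t) * x))) (^-distribˡ-+-* 2 l (R * (l * l))) ⟨
          2 ^ l * (2 ^ e * (2 ^ (t + t) * 2 ^ (l + R * (l * l))))
            ≡⟨ cong (λ x → 2 ^ l * (2 ^ e * x)) (^-distribˡ-+-* 2 (t + t) (l + R * (l * l))) ⟨
          2 ^ l * (2 ^ e * 2 ^ ((t + t) + (l + R * (l * l))))
            ≡⟨ cong (2 ^ l *_) (^-distribˡ-+-* 2 e _) ⟨
          2 ^ l * 2 ^ (e + ((t + t) + (l + R * (l * l))))
            ≡⟨ ^-distribˡ-+-* 2 l _ ⟨
          2 ^ E                ∎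
          where
          1≤T : 1 ≤ T
          1≤T = *-mono-≤ 1≤S (*-mono-≤ (1≤primorial t)
              (*-mono-≤ {1} {suc N} (s≤s z≤n) (m^n>0 (R !) {{R !≢0}} l)))
          θ≤ : primorial t ≤ 2 ^ (t + t)
          θ≤ = subst (primorial t ≤_) (4^≡2^2* t) (primorial≤4^ t)
          N<2^l : suc N ≤ 2 ^ l
          N<2^l = ≤-<-trans (m≤n*m N 2) <2^l
          !≤ : (R !) ^ l ≤ 2 ^ (R * (l * l))
          !≤ = begin
            (R !) ^ l            ≤⟨ ^-monoˡ-≤ l (!≤^ R (<⇒≤ (≤-<-trans R≤2N <2^l))) ⟩
            ((2 ^ l) ^ R) ^ l    ≡⟨ cong (_^ l) (^-*-assoc 2 l R) ⟩
            (2 ^ (l * R)) ^ l    ≡⟨ ^-*-assoc 2 (l * R) l ⟩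
            2 ^ (l * R * l)      ≡⟨ cong (2 ^_) (r l R) ⟩
            2 ^ (R * (l * l))    ∎
            where
            r : ∀ l R → l * R * l ≡ R * (l * l)
            r = solve-∀

        32≤l : 32 ≤ l
        32≤l = ≮⇒≥ λ l<32 → n≮n (2 * N) (begin-strict
          2 * N     <⟨ <2^l ⟩
          2 ^ l     ≤⟨ ^-monoʳ-≤ 2 (≤-trans (<⇒≤ l<32) (≤ᵇ⇒≤ 32 40 tt)) ⟩
          2 ^ 40    ≤⟨ 2^40≤N ⟩
          N         ≤⟨ m≤n*m N 2 ⟩
          2 * N     ∎)

        q = l * l

        32l⁴≤N : 32 * (q * q) ≤ N
        32l⁴≤N = *-cancelˡ-≤ 4 (begin
          4 * (32 * (q * q))    ≡⟨ *-assoc 4 32 (q * q) ⟨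
          128 * (q * q)         ≤⟨ quartic≤2^ {l} 32≤l ⟩
          2 ^ l                 ≤⟨ *-monoʳ-≤ 2 2^h≤ ⟩
          2 * (2 * N)           ≡⟨ *-assoc 2 2 N ⟨
          4 * N                 ∎)

        4Rl²≤N : 4 * (R * q) ≤ N
        4Rl²≤N = *-self-cancel-≤ (begin
          4 * (R * q) * (4 * (R * q))   ≡⟨ r₁ R q ⟩
          R * R * (16 * (q * q))        ≤⟨ *-monoˡ-≤ _ R²≤ ⟩
          2 * N * (16 * (q * q))        ≡⟨ r₂ N (q * q) ⟩
          N * (32 * (q * q))            ≤⟨ *-monoʳ-≤ N 32l⁴≤N ⟩
          N * N                         ∎)
          where
          r₁ : ∀ R q → 4 * (R * q) * (4 * (R * q)) ≡ R * R * (16 * (q * q))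
          r₁ = solve-∀
          r₂ : ∀ N x → 2 * N * (16 * x) ≡ N * (32 * x)
          r₂ = solve-∀

        24l≤N : 24 * l ≤ N
        24l≤N = ≤-trans (*-mono-≤ (≤ᵇ⇒≤ 24 32 tt) (≤-trans (m≤m*n l l) (m≤m*n q q))) 32l⁴≤N

        E<2N : E < N + N
        -- After multiplication by 12 the logarithms, S, the primorial and the factorial contribute
        -- at most N, 3N, 16N and 3N: 23N in all, against 24N.
        E<2N = *-cancelˡ-< 12 E (N + N) (begin-strict
          12 * E      ≡⟨ r l e t (R * q) ⟩
          24 * l + 3 * (4 * e) + 8 * (3 * t) + 3 * (4 * (R * q))
                      ≤⟨ +-mono-≤ (+-mono-≤ (+-mono-≤ 24l≤N (*-monoʳ-≤ 3 4e≤N)) (*-monoʳ-≤ 8 3t≤2N))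
                          (*-monoʳ-≤ 3 4Rl²≤N) ⟩
          N + 3 * N + 8 * (2 * N) + 3 * N
                      <⟨ m<m+n _ 1≤N ⟩
          N + 3 * N + 8 * (2 * N) + 3 * N + N
                      ≡⟨ r′ N ⟩
          12 * (N + N) ∎)
          where
          r : ∀ l e t x → 12 * (l + (e + ((t + t) + (l + x)))) ≡ 24 * l + 3 * (4 * e) + 8 *
              (3 * t) + 3 * (4 * x)
          r = solve-∀
          r′ : ∀ N → N + 3 * N + 8 * (2 * N) + 3 * N + N ≡ 12 * (N + N)
          r′ = solve-∀

        absurd : ⊥
        absurd = <⇒≱ (^-monoʳ-< 2 (s≤s (s≤s z≤n)) E<2N) 4^N≤2^E

    ¬all-primes-∣ : ⊥
    ¬all-primes-∣ with R , R²≤ , <R² ← ⌊√⌋ (2 * N) | h , 2^h≤ , <2^l ← ⌊log₂⌋ (2 * N) 1≤2N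
      = absurd {R} {h} R²≤ <R² 2^h≤ <2^l

  -- The refutation `¬all-primes-∣` becomes a witness by a search over the finitely many candidates,
  -- all conditions being decidable.
  ∃-prime-∤ : ∀ {N S e} → 2 ^ 40 ≤ N → 4 * e ≤ N → 1 ≤ S → S ≤ 2 ^ e →
              ∃[ p ] (Prime p × 2 + N ≤ p × p ≤ 2 * N × ¬ p ∣ S)
  ∃-prime-∤ {N} {S} {e} N≥ 4e≤N 1≤S S≤ with anyUpTo?
      (λ p → prime? p ×-dec (2 + N ≤? p) ×-dec ¬? (p ∣? S)) (suc (2 * N))
  ... | yes (p , s≤s p≤ , pp , ≤p , p∤S) = p , pp , ≤p , p≤ , p∤S
  ... | no none = contradiction (λ p pp ≤p p≤ → decidable-stable (p ∣? S) λ p∤S → none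
      (p , s≤s p≤ , pp , ≤p , p∤S))
                    (¬all-primes-∣ {N} {S} {e} N≥ 4e≤N 1≤S S≤)

  -- Any p between N + 2 and 2N then satisfies p < m and m + 2 ≤ 2p, the two inequalities that place
  -- p in the real interval.
  ∃-half : ∀ m → 1 ≤ m → ∃[ N ] (2 * N < m × m ≤ 2 * N + 2)
  ∃-half m 1≤m with halve m
  ... | N , inj₂ refl = N , s≤s (≤-reflexive (cong (N +_) (+-identityʳ N))) ,
          subst (_≤ 2 * N + 2) (+-comm (N + N) 1)
              (+-mono-≤ (≤-reflexive (cong (N +_) (sym (+-identityʳ N)))) (s≤s z≤n))
  ... | zero , inj₁ refl = contradiction 1≤m λ ()
  ... | suc N , inj₁ refl = N , ≤-trans (s≤s (+-monoʳ-≤ N (≤-reflexive (+-identityʳ N))))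
      (s≤s (+-monoʳ-≤ N (n≤1+n N))) , ≤-reflexive (r N)
    where
    r : ∀ N → suc N + suc N ≡ 2 * N + 2
    r = solve-∀

-- Homogenised Chebyshev polynomials: bounds inside and growth outside the interval.

module Chebyshev where

  open import Data.Integer.Base as ℤ using (ℤ; +_; ∣_∣; 0ℤ; 1ℤ)
  open import Data.Integer.Divisibility.Signed
    using (divides; ∣m∣n⇒∣m+n; ∣m∣n⇒∣m-n; ∣n⇒∣m*n; ∣m⇒∣m*n; _∣_; ∣-refl)
  import Data.Integer.Properties as ℤ
  import Data.Integer.Tactic.RingSolver as ℤ-Solver
  open import Data.Nat.Base as ℕ using (ℕ; zero; suc; _≤_; z≤n)
  import Data.Nat.Properties as ℕ
  import Data.Nat.Tactic.RingSolver as ℕ-Solver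
  open import Relation.Binary.PropositionalEquality
  open Primes using (*-self-cancel-≤)

  -- T v u k = v^k T_k(u/v) for the Chebyshev polynomial T_k of the first kind;
  -- U is the companion solution of the Pell equation T² - (u² - v²) U² = v^2k.
  T U : ℤ → ℤ → ℕ → ℤ
  T v u zero    = 1ℤ
  T v u (suc k) = u ℤ.* T v u k ℤ.+ (u ℤ.* u ℤ.- v ℤ.* v) ℤ.* U v u k
  U v u zero    = 0ℤ
  U v u (suc k) = T v u k ℤ.+ u ℤ.* U v u k

  pell : ∀ v u k → T v u k ℤ.* T v u k ℤ.+ (v ℤ.* v ℤ.- u ℤ.* u) ℤ.* (U v u k ℤ.* U v u k)
                 ≡ (v ℤ.^ k) ℤ.* (v ℤ.^ k)
  pell v u zero = trans (cong (ℤ._+_ 1ℤ) (ℤ.*-zeroʳ (v ℤ.* v ℤ.- u ℤ.* u))) refl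
  pell v u (suc k) = trans (r (T v u k) (U v u k) v u)
    (trans (cong (ℤ._*_ (v ℤ.* v)) (pell v u k)) (r′ v (v ℤ.^ k)))
    where
    r : ∀ t s v u → (u ℤ.* t ℤ.+ (u ℤ.* u ℤ.- v ℤ.* v) ℤ.* s) ℤ.* (u ℤ.* t ℤ.+ (u ℤ.* u ℤ.- v ℤ.* v) ℤ.* s)
          ℤ.+ (v ℤ.* v ℤ.- u ℤ.* u) ℤ.* ((t ℤ.+ u ℤ.* s) ℤ.* (t ℤ.+ u ℤ.* s))
        ≡ (v ℤ.* v) ℤ.* (t ℤ.* t ℤ.+ (v ℤ.* v ℤ.- u ℤ.* u) ℤ.* (s ℤ.* s))
    r = ℤ-Solver.solve-∀
    r′ : ∀ v w → (v ℤ.* v) ℤ.* (w ℤ.* w) ≡ (v ℤ.* w) ℤ.* (v ℤ.* w)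
    r′ = ℤ-Solver.solve-∀

  i*i≡+∣i∣*∣i∣ : ∀ i → i ℤ.* i ≡ + (∣ i ∣ ℕ.* ∣ i ∣)
  i*i≡+∣i∣*∣i∣ (+ n) = sym (ℤ.pos-* n n)
  i*i≡+∣i∣*∣i∣ ℤ.-[1+ n ] = refl

  pos-^ : ∀ m k → (+ m) ℤ.^ k ≡ + (m ℕ.^ k)
  pos-^ m zero = refl
  pos-^ m (suc k) = trans (cong (ℤ._*_ (+ m)) (pos-^ m k)) (sym (ℤ.pos-* m (m ℕ.^ k)))

  ∣^∣ : ∀ i k → ∣ i ℤ.^ k ∣ ≡ ∣ i ∣ ℕ.^ k
  ∣^∣ i zero = refl
  ∣^∣ i (suc k) = trans (ℤ.abs-* i (i ℤ.^ k)) (cong (∣ i ∣ ℕ.*_) (∣^∣ i k))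

  -- For |u| ≤ v both summands on the left of `pell` are non-negative, so T² is at most v^2k. This
  -- is |T_k| ≤ 1 on [-1 , 1] without trigonometry.
  ∣T∣≤v^k : ∀ {v u} k → ∣ u ∣ ≤ v → ∣ T (+ v) u k ∣ ≤ v ℕ.^ k
  ∣T∣≤v^k {v} {u} k ∣u∣≤v = *-self-cancel-≤ (ℕ.m+n≤o⇒m≤o _ (ℕ.≤-reflexive (ℤ.+-injective (begin
    + (∣ t ∣ ℕ.* ∣ t ∣ ℕ.+ w ℕ.* (∣ s ∣ ℕ.* ∣ s ∣))
      ≡⟨ ℤ.pos-+ (∣ t ∣ ℕ.* ∣ t ∣) (w ℕ.* (∣ s ∣ ℕ.* ∣ s ∣)) ⟩
    + (∣ t ∣ ℕ.* ∣ t ∣) ℤ.+ + (w ℕ.* (∣ s ∣ ℕ.* ∣ s ∣))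
      ≡⟨ cong₂ ℤ._+_ (sym (i*i≡+∣i∣*∣i∣ t))
          (trans (ℤ.pos-* w (∣ s ∣ ℕ.* ∣ s ∣)) (cong (ℤ._*_ (+ w)) (sym (i*i≡+∣i∣*∣i∣ s)))) ⟩
    t ℤ.* t ℤ.+ + w ℤ.* (s ℤ.* s)
      ≡⟨ cong (λ x → t ℤ.* t ℤ.+ x ℤ.* (s ℤ.* s)) w≡ ⟩
    t ℤ.* t ℤ.+ (+ v ℤ.* + v ℤ.- u ℤ.* u) ℤ.* (s ℤ.* s)
      ≡⟨ pell (+ v) u k ⟩
    (+ v) ℤ.^ k ℤ.* (+ v) ℤ.^ k
      ≡⟨ cong₂ ℤ._*_ (pos-^ v k) (pos-^ v k) ⟩
    + (v ℕ.^ k) ℤ.* + (v ℕ.^ k)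
      ≡⟨ ℤ.pos-* (v ℕ.^ k) (v ℕ.^ k) ⟨
    + (v ℕ.^ k ℕ.* v ℕ.^ k) ∎))))
    where
    open ≡-Reasoning
    t = T (+ v) u k
    s = U (+ v) u k
    w = v ℕ.* v ℕ.∸ ∣ u ∣ ℕ.* ∣ u ∣
    w≡ : + w ≡ + v ℤ.* + v ℤ.- u ℤ.* u
    w≡ = trans (sym (ℤ.⊖-≥ (ℕ.*-mono-≤ ∣u∣≤v ∣u∣≤v)))
      (trans (sym (ℤ.[+m]-[+n]≡m⊖n (v ℕ.* v) (∣ u ∣ ℕ.* ∣ u ∣)))
          (cong₂ ℤ._-_ (ℤ.pos-* v v) (sym (i*i≡+∣i∣*∣i∣ u))))

  module _ (v w : ℕ) where

    private
      D = 2 ℕ.* (v ℕ.* w) ℕ.+ w ℕ.* w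

    -- `T` and `U` at u = v + w, to the right of the interval. There u² - v² is the natural number
    -- `D`, so the recursion has no signs and every term can serve as a lower bound.
    T⁺ U⁺ : ℕ → ℕ
    T⁺ zero    = 1
    T⁺ (suc k) = (v ℕ.+ w) ℕ.* T⁺ k ℕ.+ D ℕ.* U⁺ k
    U⁺ zero    = 0
    U⁺ (suc k) = T⁺ k ℕ.+ (v ℕ.+ w) ℕ.* U⁺ k

    D≡ : (+ (v ℕ.+ w)) ℤ.* (+ (v ℕ.+ w)) ℤ.- + v ℤ.* + v ≡ + D
    D≡ = trans (cong (λ x → x ℤ.* x ℤ.- + v ℤ.* + v) (ℤ.pos-+ v w)) (trans (r (+ v) (+ w)) (sym (begin
      + D                                                 ≡⟨ ℤ.pos-+ (2 ℕ.* (v ℕ.* w)) (w ℕ.* w) ⟩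
      + (2 ℕ.* (v ℕ.* w)) ℤ.+ + (w ℕ.* w)
        ≡⟨ cong₂ ℤ._+_ (ℤ.pos-* 2 (v ℕ.* w)) (ℤ.pos-* w w) ⟩
      + 2 ℤ.* + (v ℕ.* w) ℤ.+ + w ℤ.* + w
        ≡⟨ cong (λ x → + 2 ℤ.* x ℤ.+ + w ℤ.* + w) (ℤ.pos-* v w) ⟩
      + 2 ℤ.* (+ v ℤ.* + w) ℤ.+ + w ℤ.* + w               ∎)))
      where
      open ≡-Reasoning
      r : ∀ v w → (v ℤ.+ w) ℤ.* (v ℤ.+ w) ℤ.- v ℤ.* v ≡ + 2 ℤ.* (v ℤ.* w) ℤ.+ w ℤ.* w
      r = ℤ-Solver.solve-∀

    T≡+T⁺ : ∀ k → T (+ v) (+ (v ℕ.+ w)) k ≡ + T⁺ k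
    U≡+U⁺ : ∀ k → U (+ v) (+ (v ℕ.+ w)) k ≡ + U⁺ k
    T≡+T⁺ zero = refl
    T≡+T⁺ (suc k) = trans
      (cong₂ ℤ._+_
        (trans (cong (ℤ._*_ (+ (v ℕ.+ w))) (T≡+T⁺ k)) (sym (ℤ.pos-* (v ℕ.+ w) (T⁺ k))))
        (trans (cong₂ ℤ._*_ D≡ (U≡+U⁺ k)) (sym (ℤ.pos-* D (U⁺ k)))))
      (sym (ℤ.pos-+ ((v ℕ.+ w) ℕ.* T⁺ k) (D ℕ.* U⁺ k)))
    U≡+U⁺ zero = refl
    U≡+U⁺ (suc k) = trans
      (cong₂ ℤ._+_ (T≡+T⁺ k)
        (trans (cong (ℤ._*_ (+ (v ℕ.+ w))) (U≡+U⁺ k)) (sym (ℤ.pos-* (v ℕ.+ w) (U⁺ k)))))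
      (sym (ℤ.pos-+ (T⁺ k) ((v ℕ.+ w) ℕ.* U⁺ k)))

    pell⁺ : ∀ k → T⁺ k ℕ.* T⁺ k ≡ v ℕ.^ k ℕ.* v ℕ.^ k ℕ.+ D ℕ.* (U⁺ k ℕ.* U⁺ k)
    pell⁺ zero = sym (cong suc (ℕ.*-zeroʳ D))
    pell⁺ (suc k) = begin
      ((v ℕ.+ w) ℕ.* t ℕ.+ D ℕ.* s) ℕ.* ((v ℕ.+ w) ℕ.* t ℕ.+ D ℕ.* s)
        ≡⟨ r₁ v w t s ⟩
      (v ℕ.* v ℕ.+ D) ℕ.* (t ℕ.* t) ℕ.+ (2 ℕ.* (v ℕ.+ w) ℕ.* t ℕ.* D ℕ.* s ℕ.+ D ℕ.* s ℕ.* (D ℕ.* s))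
        ≡⟨ cong (ℕ._+ (2 ℕ.* (v ℕ.+ w) ℕ.* t ℕ.* D ℕ.* s ℕ.+ D ℕ.* s ℕ.* (D ℕ.* s)))
            (trans (ℕ.*-distribʳ-+ (t ℕ.* t) (v ℕ.* v) D)
            (cong (λ x → v ℕ.* v ℕ.* x ℕ.+ D ℕ.* (t ℕ.* t)) (pell⁺ k))) ⟩
      v ℕ.* v ℕ.* (v ℕ.^ k ℕ.* v ℕ.^ k ℕ.+ D ℕ.* (s ℕ.* s)) ℕ.+ D ℕ.* (t ℕ.* t) ℕ.+
          (2 ℕ.* (v ℕ.+ w) ℕ.* t ℕ.* D ℕ.* s ℕ.+ D ℕ.* s ℕ.* (D ℕ.* s))
        ≡⟨ r₂ v w t s (v ℕ.^ k) ⟩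
      v ℕ.* v ℕ.^ k ℕ.* (v ℕ.* v ℕ.^ k) ℕ.+ D ℕ.* ((t ℕ.+ (v ℕ.+ w) ℕ.* s) ℕ.* (t ℕ.+ (v ℕ.+ w) ℕ.* s)) ∎
      where
      open ≡-Reasoning
      t = T⁺ k
      s = U⁺ k
      r₁ : ∀ v w t s → let D = 2 ℕ.* (v ℕ.* w) ℕ.+ w ℕ.* w in
           ((v ℕ.+ w) ℕ.* t ℕ.+ D ℕ.* s) ℕ.* ((v ℕ.+ w) ℕ.* t ℕ.+ D ℕ.* s)
         ≡ (v ℕ.* v ℕ.+ D) ℕ.* (t ℕ.* t) ℕ.+ (2 ℕ.* (v ℕ.+ w) ℕ.* t ℕ.* D ℕ.* s ℕ.+ D ℕ.* s ℕ.* (D ℕ.* s))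
      r₁ = ℕ-Solver.solve-∀
      r₂ : ∀ v w t s x → let D = 2 ℕ.* (v ℕ.* w) ℕ.+ w ℕ.* w in
           v ℕ.* v ℕ.* (x ℕ.* x ℕ.+ D ℕ.* (s ℕ.* s)) ℕ.+ D ℕ.* (t ℕ.* t) ℕ.+
               (2 ℕ.* (v ℕ.+ w) ℕ.* t ℕ.* D ℕ.* s ℕ.+ D ℕ.* s ℕ.* (D ℕ.* s))
         ≡ v ℕ.* x ℕ.* (v ℕ.* x) ℕ.+ D ℕ.* ((t ℕ.+ (v ℕ.+ w) ℕ.* s) ℕ.* (t ℕ.+ (v ℕ.+ w) ℕ.* s))
      r₂ = ℕ-Solver.solve-∀

    open ℕ.≤-Reasoning

    v^k≤T⁺ : ∀ k → v ℕ.^ k ≤ T⁺ k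
    v^k≤T⁺ k = *-self-cancel-≤ (ℕ.m+n≤o⇒m≤o _ (ℕ.≤-reflexive (sym (pell⁺ k))))

    -- The companion polynomial is at least k to the right of 1, since each step adds T ≥ v^k. The
    -- extra factor v avoids the exponent k - 1.
    kv^k≤vU⁺ : ∀ k → k ℕ.* v ℕ.^ k ≤ v ℕ.* U⁺ k
    kv^k≤vU⁺ zero = z≤n
    kv^k≤vU⁺ (suc k) = begin
      suc k ℕ.* (v ℕ.* v ℕ.^ k)                ≡⟨ r v k (v ℕ.^ k) ⟩
      v ℕ.* v ℕ.^ k ℕ.+ v ℕ.* (k ℕ.* v ℕ.^ k)
        ≤⟨ ℕ.+-mono-≤ (ℕ.*-monoʳ-≤ v (v^k≤T⁺ k)) (ℕ.*-monoʳ-≤ v (kv^k≤vU⁺ k)) ⟩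
      v ℕ.* T⁺ k ℕ.+ v ℕ.* (v ℕ.* U⁺ k)
        ≤⟨ ℕ.+-monoʳ-≤ (v ℕ.* T⁺ k) (ℕ.*-monoʳ-≤ v (ℕ.*-monoˡ-≤ (U⁺ k) (ℕ.m≤m+n v w))) ⟩
      v ℕ.* T⁺ k ℕ.+ v ℕ.* ((v ℕ.+ w) ℕ.* U⁺ k) ≡⟨ ℕ.*-distribˡ-+ v (T⁺ k) _ ⟨
      v ℕ.* U⁺ (suc k)                         ∎
      where
      r : ∀ v k x → suc k ℕ.* (v ℕ.* x) ≡ v ℕ.* x ℕ.+ v ℕ.* (k ℕ.* x)
      r = ℕ-Solver.solve-∀

    -- Pell's equation with U ≥ k v^(k-1) gives T² ≥ v^2k (1 + D k²/v²), and the hypothesis makes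
    -- the bracket at least 4. Everything is multiplied by v² to stay in the naturals.
    2v^k≤T⁺ : ∀ k → .{{ℕ.NonZero v}} → 3 ℕ.* (v ℕ.* v) ≤ D ℕ.* (k ℕ.* k) → 2 ℕ.* v ℕ.^ k ≤ T⁺ k
    2v^k≤T⁺ k le = *-self-cancel-≤ (ℕ.*-cancelˡ-≤ (v ℕ.* v) {{ℕ.m*n≢0 v v}} (begin
      v ℕ.* v ℕ.* (2 ℕ.* x ℕ.* (2 ℕ.* x))                         ≡⟨ r₁ v x ⟩
      v ℕ.* v ℕ.* (x ℕ.* x) ℕ.+ 3 ℕ.* (v ℕ.* v) ℕ.* (x ℕ.* x)
        ≤⟨ ℕ.+-monoʳ-≤ (v ℕ.* v ℕ.* (x ℕ.* x)) (ℕ.*-monoˡ-≤ (x ℕ.* x) le) ⟩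
      v ℕ.* v ℕ.* (x ℕ.* x) ℕ.+ D ℕ.* (k ℕ.* k) ℕ.* (x ℕ.* x)
        ≡⟨ cong (v ℕ.* v ℕ.* (x ℕ.* x) ℕ.+_) (r₂ D k x) ⟩
      v ℕ.* v ℕ.* (x ℕ.* x) ℕ.+ D ℕ.* (k ℕ.* x ℕ.* (k ℕ.* x))
        ≤⟨ ℕ.+-monoʳ-≤ (v ℕ.* v ℕ.* (x ℕ.* x)) (ℕ.*-monoʳ-≤ D (ℕ.*-mono-≤ (kv^k≤vU⁺ k) (kv^k≤vU⁺ k))) ⟩
      v ℕ.* v ℕ.* (x ℕ.* x) ℕ.+ D ℕ.* (v ℕ.* s ℕ.* (v ℕ.* s))     ≡⟨ r₃ D v x s ⟩
      v ℕ.* v ℕ.* (x ℕ.* x ℕ.+ D ℕ.* (s ℕ.* s))                   ≡⟨ cong (v ℕ.* v ℕ.*_) (pell⁺ k) ⟨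
      v ℕ.* v ℕ.* (T⁺ k ℕ.* T⁺ k)                                 ∎))
      where
      x = v ℕ.^ k
      s = U⁺ k
      r₁ : ∀ v x → v ℕ.* v ℕ.* (2 ℕ.* x ℕ.* (2 ℕ.* x)) ≡ v ℕ.* v ℕ.* (x ℕ.* x) ℕ.+ 3 ℕ.*
          (v ℕ.* v) ℕ.* (x ℕ.* x)
      r₁ = ℕ-Solver.solve-∀
      r₂ : ∀ D k x → D ℕ.* (k ℕ.* k) ℕ.* (x ℕ.* x) ≡ D ℕ.* (k ℕ.* x ℕ.* (k ℕ.* x))
      r₂ = ℕ-Solver.solve-∀
      r₃ : ∀ D v x s → v ℕ.* v ℕ.* (x ℕ.* x) ℕ.+ D ℕ.* (v ℕ.* s ℕ.* (v ℕ.* s)) ≡ v ℕ.* v ℕ.*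
          (x ℕ.* x ℕ.+ D ℕ.* (s ℕ.* s))
      r₃ = ℕ-Solver.solve-∀

  module _ {v u : ℤ} {M : ℕ} (∣u∣+∣D∣≤M : ∣ u ∣ ℕ.+ ∣ u ℤ.* u ℤ.- v ℤ.* v ∣ ≤ M)
      (1+∣u∣≤M : 1 ℕ.+ ∣ u ∣ ≤ M) where

    -- A crude bound that does not need |u| ≤ v: each step of the recursion multiplies the common
    -- bound of |T| and |U| by at most M. It is used only for the size of S.
    ∣T∣≤M^k : ∀ k → ∣ T v u k ∣ ≤ M ℕ.^ k
    ∣U∣≤M^k : ∀ k → ∣ U v u k ∣ ≤ M ℕ.^ k

    private
      ∣*+*∣≤ : ∀ a x b y {N} → ∣ x ∣ ≤ N → ∣ y ∣ ≤ N → ∣ a ℤ.* x ℤ.+ b ℤ.* y ∣ ≤ (∣ a ∣ ℕ.+ ∣ b ∣) ℕ.* N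
      ∣*+*∣≤ a x b y {N} x≤ y≤ = begin
        ∣ a ℤ.* x ℤ.+ b ℤ.* y ∣               ≤⟨ ℤ.∣i+j∣≤∣i∣+∣j∣ (a ℤ.* x) (b ℤ.* y) ⟩
        ∣ a ℤ.* x ∣ ℕ.+ ∣ b ℤ.* y ∣           ≡⟨ cong₂ ℕ._+_ (ℤ.abs-* a x) (ℤ.abs-* b y) ⟩
        ∣ a ∣ ℕ.* ∣ x ∣ ℕ.+ ∣ b ∣ ℕ.* ∣ y ∣
          ≤⟨ ℕ.+-mono-≤ (ℕ.*-monoʳ-≤ ∣ a ∣ x≤) (ℕ.*-monoʳ-≤ ∣ b ∣ y≤) ⟩
        ∣ a ∣ ℕ.* N ℕ.+ ∣ b ∣ ℕ.* N           ≡⟨ ℕ.*-distribʳ-+ N ∣ a ∣ ∣ b ∣ ⟨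
        (∣ a ∣ ℕ.+ ∣ b ∣) ℕ.* N               ∎
        where open ℕ.≤-Reasoning

    ∣T∣≤M^k zero = ℕ.≤-refl
    ∣T∣≤M^k (suc k) = ℕ.≤-trans
      (∣*+*∣≤ u (T v u k) (u ℤ.* u ℤ.- v ℤ.* v) (U v u k) (∣T∣≤M^k k) (∣U∣≤M^k k))
      (ℕ.*-monoˡ-≤ (M ℕ.^ k) ∣u∣+∣D∣≤M)
    ∣U∣≤M^k zero = z≤n
    ∣U∣≤M^k (suc k) = ℕ.≤-trans
      (ℕ.≤-trans (ℕ.≤-reflexive (cong (λ x → ∣ x ℤ.+ u ℤ.* U v u k ∣) (sym (ℤ.*-identityˡ (T v u k)))))
        (∣*+*∣≤ 1ℤ (T v u k) u (U v u k) (∣T∣≤M^k k) (∣U∣≤M^k k)))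
      (ℕ.*-monoˡ-≤ (M ℕ.^ k) 1+∣u∣≤M)

  -- The only property of integer polynomials that matters here.
  record Polynomial (q : ℤ → ℤ) : Set where
    field
      difference : ∀ x y → (x ℤ.- y) ∣ (q x ℤ.- q y)

  open Polynomial

  const-poly : ∀ c → Polynomial (λ _ → c)
  difference (const-poly c) x y = divides 0ℤ (ℤ.+-inverseʳ c)

  id-poly : Polynomial (λ x → x)
  difference id-poly x y = ∣-refl

  module _ {f g} (F : Polynomial f) (G : Polynomial g) where

    +-poly : Polynomial (λ x → f x ℤ.+ g x)
    difference +-poly x y = subst (_ ∣_) (r (f x) (g x) (f y) (g y))
        (∣m∣n⇒∣m+n (difference F x y) (difference G x y))
      where
      r : ∀ a b c d → (a ℤ.- c) ℤ.+ (b ℤ.- d) ≡ a ℤ.+ b ℤ.- (c ℤ.+ d)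
      r = ℤ-Solver.solve-∀

    -‿poly : Polynomial (λ x → f x ℤ.- g x)
    difference -‿poly x y = subst (_ ∣_) (r (f x) (g x) (f y) (g y))
        (∣m∣n⇒∣m-n (difference F x y) (difference G x y))
      where
      r : ∀ a b c d → (a ℤ.- c) ℤ.- (b ℤ.- d) ≡ a ℤ.- b ℤ.- (c ℤ.- d)
      r = ℤ-Solver.solve-∀

    *-poly : Polynomial (λ x → f x ℤ.* g x)
    difference *-poly x y = subst (_ ∣_) (r (f x) (g x) (f y) (g y))
      (∣m∣n⇒∣m+n (∣n⇒∣m*n (f x) (difference G x y)) (∣m⇒∣m*n (g y) (difference F x y)))
      where
      r : ∀ a b c d → a ℤ.* (b ℤ.- d) ℤ.+ (a ℤ.- c) ℤ.* d ≡ a ℤ.* b ℤ.- c ℤ.* d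
      r = ℤ-Solver.solve-∀

  ^-poly : ∀ {f} k → Polynomial f → Polynomial (λ x → f x ℤ.^ k)
  ^-poly zero F = const-poly 1ℤ
  ^-poly (suc k) F = *-poly F (^-poly k F)

  T-poly : ∀ v {u} k → Polynomial u → Polynomial (λ x → T v (u x) k)
  U-poly : ∀ v {u} k → Polynomial u → Polynomial (λ x → U v (u x) k)
  T-poly v zero F = const-poly 1ℤ
  T-poly v (suc k) F = +-poly (*-poly F (T-poly v k F))
    (*-poly (-‿poly (*-poly F F) (const-poly (v ℤ.* v))) (U-poly v k F))
  U-poly v zero F = const-poly 0ℤ
  U-poly v (suc k) F = +-poly (T-poly v k F) (*-poly F (U-poly v k F))

-- Polynomial moments of a set, their reduction modulo p, and a non-zero moment difference.

module Moments where

  import Data.Integer.Properties as ℤ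
  open import Algebra.Properties.Semiring.Sum ℤ.+-*-semiring
  open import Data.Bool.Base using (Bool; true; false; if_then_else_; _∧_)
  import Data.Bool.Properties as Bool
  open import Data.Fin.Base using (Fin; zero; suc; toℕ; fromℕ<; punchIn)
  import Data.Fin.Properties as Fin
  open import Data.Fin.Subset as Subset using (Subset; _∈_)
  open import Data.Integer.Base as ℤ using (ℤ; +_; 0ℤ; 1ℤ)
  open import Data.Integer.Divisibility.Signed as ℤ using (divides)
  import Data.Integer.Tactic.RingSolver as ℤ-Solver
  open import Data.Nat.Base as ℕ using (ℕ; zero; suc; _≤_; _<_; s≤s; z≤n; NonZero)
  import Data.Nat.Divisibility as ℕ
  open import Data.Nat.DivMod using (_%_; _/_; m≡m%n+[m/n]*n; m%n<n)
  import Data.Nat.Properties as ℕ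
  import Data.Nat.Tactic.RingSolver as ℕ-Solver
  open import Data.Product.Base using (∃-syntax; _×_; _,_)
  open import Data.Sum.Base using (inj₁; inj₂)
  open import Data.Unit.Base using (tt)
  open import Data.Vec.Base using ([]; _∷_; lookup)
  open import Data.Vec.Properties
    using (lookup-zipWith; lookup∘tabulate; lookup⇒[]=; tabulate∘lookup; tabulate-cong)
  open import Defs using (val; residue)
  open import Function.Base using (_∘_)
  open import Relation.Binary.Definitions using (tri<; tri≈; tri>)
  open import Relation.Binary.PropositionalEquality
  open import Relation.Nullary using (Dec; yes; no; does; contradiction)
  open import Relation.Nullary.Decidable using (_×-dec_; ¬?; dec-true; dec-false; decidable-stable)
  open Chebyshev

  ∣⊖∣ : ∀ a b → ℤ.∣ a ℤ.⊖ b ∣ ≡ ℕ.∣ a - b ∣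
  ∣⊖∣ zero zero = refl
  ∣⊖∣ zero (suc b) = refl
  ∣⊖∣ (suc a) zero = refl
  ∣⊖∣ (suc a) (suc b) = trans (cong ℤ.∣_∣ (ℤ.[1+m]⊖[1+n]≡m⊖n a b)) (∣⊖∣ a b)

  ∣+-+∣ : ∀ a b → ℤ.∣ + a ℤ.- + b ∣ ≡ ℕ.∣ a - b ∣
  ∣+-+∣ a b = trans (cong ℤ.∣_∣ (ℤ.[+m]-[+n]≡m⊖n a b)) (∣⊖∣ a b)

  sum-0 : ∀ {n} {f : Fin n → ℤ} → (∀ j → f j ≡ 0ℤ) → sum f ≡ 0ℤ
  sum-0 {zero} eq = refl
  sum-0 {suc n} eq = cong₂ ℤ._+_ (eq zero) (sum-0 (eq ∘ suc))

  sum-minus : ∀ {n} (f g : Fin n → ℤ) → sum (λ j → f j ℤ.- g j) ≡ sum f ℤ.- sum g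
  sum-minus {zero} f g = refl
  sum-minus {suc n} f g = trans (cong (ℤ._+_ (f zero ℤ.- g zero)) (sum-minus (f ∘ suc) (g ∘ suc)))
    (r (f zero) (g zero) (sum (f ∘ suc)) (sum (g ∘ suc)))
    where
    r : ∀ a b c d → (a ℤ.- b) ℤ.+ (c ℤ.- d) ≡ (a ℤ.+ c) ℤ.- (b ℤ.+ d)
    r = ℤ-Solver.solve-∀

  ∣-sum : ∀ {p n} {f : Fin n → ℤ} → (∀ j → p ℤ.∣ f j) → p ℤ.∣ sum f
  ∣-sum {n = zero} h = divides 0ℤ refl
  ∣-sum {n = suc n} h = ℤ.∣m∣n⇒∣m+n (h zero) (∣-sum (h ∘ suc))

  ∣sum∣≤ : ∀ {n B} {f : Fin n → ℤ} → (∀ j → ℤ.∣ f j ∣ ≤ B) → ℤ.∣ sum f ∣ ≤ n ℕ.* B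
  ∣sum∣≤ {zero} h = z≤n
  ∣sum∣≤ {suc n} {f = f} h = ℕ.≤-trans (ℤ.∣i+j∣≤∣i∣+∣j∣ (f zero) (sum (f ∘ suc)))
    (ℕ.+-mono-≤ (h zero) (∣sum∣≤ (h ∘ suc)))

  𝟙 : Bool → ℤ
  𝟙 b = if b then 1ℤ else 0ℤ

  𝟙-∧ : ∀ a b → 𝟙 (a ∧ b) ≡ 𝟙 a ℤ.* 𝟙 b
  𝟙-∧ true true = refl
  𝟙-∧ true false = refl
  𝟙-∧ false true = refl
  𝟙-∧ false false = refl

  card-sum : ∀ {n} (A : Subset n) → + Subset.∣ A ∣ ≡ sum (λ j → 𝟙 (lookup A j))
  card-sum [] = refl
  card-sum (true ∷ A) = trans (ℤ.pos-+ 1 Subset.∣ A ∣) (cong (ℤ._+_ 1ℤ) (card-sum A))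
  card-sum (false ∷ A) = trans (card-sum A) (sym (ℤ.+-identityˡ _))

  module _ {p : ℕ} {{p≢0 : NonZero p}} where

    δ : ℕ → Fin p → Bool
    δ x i = does (p ℕ.∣? ℕ.∣ x - toℕ i ∣)

    ∣diff⇒ : ∀ x y → p ℕ.∣ ℕ.∣ x - y ∣ → (+ p) ℤ.∣ (+ x ℤ.- + y)
    ∣diff⇒ x y d = ℤ.∣ᵤ⇒∣ (subst (p ℕ.∣_) (sym (∣+-+∣ x y)) d)

    ∣diff⇐ : ∀ x y → (+ p) ℤ.∣ (+ x ℤ.- + y) → p ℕ.∣ ℕ.∣ x - y ∣
    ∣diff⇐ x y d = subst (p ℕ.∣_) (∣+-+∣ x y) (ℤ.∣⇒∣ᵤ d)

    residue-unique : ∀ x (i j : Fin p) → p ℕ.∣ ℕ.∣ x - toℕ i ∣ → p ℕ.∣ ℕ.∣ x - toℕ j ∣ → i ≡ j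
    residue-unique x i j di dj = Fin.toℕ-injective (ℕ.∣m-n∣≡0⇒m≡n (small ℕ.∣ toℕ i - toℕ j ∣ d lt))
      where
      r : ∀ x i j → (x ℤ.- j) ℤ.- (x ℤ.- i) ≡ i ℤ.- j
      r = ℤ-Solver.solve-∀
      d : p ℕ.∣ ℕ.∣ toℕ i - toℕ j ∣
      d = ∣diff⇐ (toℕ i) (toℕ j) (subst ((+ p) ℤ.∣_) (r (+ x) (+ toℕ i) (+ toℕ j))
            (ℤ.∣m∣n⇒∣m-n (∣diff⇒ x (toℕ j) dj) (∣diff⇒ x (toℕ i) di)))
      lt : ℕ.∣ toℕ i - toℕ j ∣ ℕ.< p
      lt = ℕ.≤-<-trans (ℕ.∣m-n∣≤m⊔n (toℕ i) (toℕ j)) (ℕ.⊔-lub (Fin.toℕ<n i) (Fin.toℕ<n j))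
      small : ∀ m → p ℕ.∣ m → m ℕ.< p → m ≡ 0
      small zero _ _ = refl
      small (suc m) d lt = contradiction (ℕ.∣⇒≤ d) (ℕ.<⇒≱ lt)

    rep : ℕ → Fin p
    rep x = fromℕ< (m%n<n x p)

    rep-∣ : ∀ x → p ℕ.∣ ℕ.∣ x - toℕ (rep x) ∣
    rep-∣ x = subst (p ℕ.∣_) (sym eq) (ℕ.n∣m*n (x / p))
      where
      eq : ℕ.∣ x - toℕ (rep x) ∣ ≡ (x / p) ℕ.* p
      eq = trans (cong₂ ℕ.∣_-_∣ (m≡m%n+[m/n]*n x p) (Fin.toℕ-fromℕ< (m%n<n x p)))
        (trans (ℕ.∣-∣-comm (x % p ℕ.+ (x / p) ℕ.* p) (x % p))
          (trans (ℕ.m≤n⇒∣m-n∣≡n∸m (ℕ.m≤m+n (x % p) _)) (ℕ.m+n∸m≡n (x % p) _)))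

  sum-δ : ∀ {p′} x (g : Fin (suc p′) → ℤ) → sum (λ i → g i ℤ.* 𝟙 (δ x i)) ≡ g (rep x)
  sum-δ {p′} x g = begin
    sum t                                        ≡⟨ sum-remove {i = rep x} t ⟩
    t (rep x) ℤ.+ sum (t ∘ punchIn (rep x))      ≡⟨ cong₂ ℤ._+_ hit (sum-0 miss) ⟩
    g (rep x) ℤ.+ 0ℤ                             ≡⟨ ℤ.+-identityʳ _ ⟩
    g (rep x)                                    ∎
    where
    open ≡-Reasoning
    p = suc p′
    t = λ i → g i ℤ.* 𝟙 (δ x i)
    hit : t (rep x) ≡ g (rep x)
    hit = trans (cong (λ b → g (rep x) ℤ.* 𝟙 b) (dec-true (p ℕ.∣? ℕ.∣ x - toℕ (rep {p} x) ∣) (rep-∣ x)))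
            (ℤ.*-identityʳ _)
    miss : ∀ k → t (punchIn (rep x) k) ≡ 0ℤ
    miss k = trans (cong (λ b → g (punchIn (rep x) k) ℤ.* 𝟙 b)
        (dec-false (p ℕ.∣? ℕ.∣ x - toℕ (punchIn (rep {p} x) k) ∣)
          λ d → Fin.punchInᵢ≢i (rep x) k (residue-unique x _ _ d (rep-∣ x))))
      (ℤ.*-zeroʳ (g (punchIn (rep x) k)))

  module _ {n : ℕ} {p : ℕ} {{p≢0 : NonZero p}} {Q : ℤ → ℤ} (poly : Polynomial Q) where

    moment : Subset n → ℤ
    moment A = sum (λ j → 𝟙 (lookup A j) ℤ.* Q (+ val j))

    residue-moment : Subset n → ℤ
    residue-moment A = sum (λ (i : Fin p) → Q (+ toℕ i) ℤ.* + Subset.∣ residue A p i ∣)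

    -- Double counting: each count is expanded as a sum over the elements of A, and the two
    -- summations are exchanged.
    residue-moment≡ : ∀ A → residue-moment A ≡
      sum (λ j → 𝟙 (lookup A j) ℤ.* sum (λ (i : Fin p) → Q (+ toℕ i) ℤ.* 𝟙 (δ (val j) i)))
    residue-moment≡ A = begin
      sum (λ i → q i ℤ.* + Subset.∣ residue A p i ∣)
        ≡⟨ sum-cong-≗ (λ i → trans (cong (ℤ._*_ (q i))
            (trans (card-sum (residue A p i)) (sum-cong-≗ (entry i)))) (*-distribˡ-sum {n} (q i) _)) ⟩
      sum (λ i → sum (λ j → q i ℤ.* (𝟙 (lookup A j) ℤ.* 𝟙 (δ (val j) i))))
        ≡⟨ ∑-comm (λ i j → q i ℤ.* (𝟙 (lookup A j) ℤ.* 𝟙 (δ (val j) i))) ⟩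
      sum (λ j → sum (λ i → q i ℤ.* (𝟙 (lookup A j) ℤ.* 𝟙 (δ (val j) i))))
        ≡⟨ sum-cong-≗ (λ j → trans (sum-cong-≗ (λ i → r (q i) (𝟙 (lookup A j)) (𝟙 (δ (val j) i))))
            (sym (*-distribˡ-sum {p} (𝟙 (lookup A j)) _))) ⟩
      sum (λ j → 𝟙 (lookup A j) ℤ.* sum (λ i → q i ℤ.* 𝟙 (δ (val j) i))) ∎
      where
      open ≡-Reasoning
      q : Fin p → ℤ
      q i = Q (+ toℕ i)
      r : ∀ a b c → a ℤ.* (b ℤ.* c) ≡ b ℤ.* (a ℤ.* c)
      r = ℤ-Solver.solve-∀
      entry : ∀ i j → 𝟙 (lookup (residue A p i) j) ≡ 𝟙 (lookup A j) ℤ.* 𝟙 (δ (val j) i)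
      entry i j = trans (cong 𝟙 (trans (lookup-zipWith _∧_ j A _)
          (cong (lookup A j ∧_) (lookup∘tabulate _ j))))
        (𝟙-∧ (lookup A j) (δ (val j) i))

    -- Term by term: the inner sum over residues collapses to Q at the representative of x, and Q(x)
    -- is congruent to that value because p divides the difference of the arguments.
    ∣moment-residue-moment : ∀ A → (+ p) ℤ.∣ (moment A ℤ.- residue-moment A)
    ∣moment-residue-moment A = subst ((+ p) ℤ.∣_)
      (trans (sum-minus {n} _ _) (cong (ℤ._-_ (moment A)) (sym (residue-moment≡ A))))
      (∣-sum λ j → subst ((+ p) ℤ.∣_) (r (𝟙 (lookup A j)) (Q (+ val j)) _)
        (ℤ.∣n⇒∣m*n (𝟙 (lookup A j)) (term (val j))))
      where
      r : ∀ a b c → a ℤ.* (b ℤ.- c) ≡ a ℤ.* b ℤ.- a ℤ.* c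
      r = ℤ-Solver.solve-∀
      term : ∀ x → (+ p) ℤ.∣ (Q (+ x) ℤ.- sum (λ (i : Fin p) → Q (+ toℕ i) ℤ.* 𝟙 (δ x i)))
      term x = subst (λ s → (+ p) ℤ.∣ (Q (+ x) ℤ.- s)) (sym (sum-δ′ x (λ i → Q (+ toℕ i))))
        (ℤ.∣-trans (∣diff⇒ x (toℕ (rep {p} x)) (rep-∣ x))
            (Polynomial.difference poly (+ x) (+ toℕ (rep {p} x))))
        where
        sum-δ′ : ∀ {p} {{_ : NonZero p}} x (g : Fin p → ℤ) → sum (λ i → g i ℤ.* 𝟙 (δ x i)) ≡ g (rep x)
        sum-δ′ {suc p′} = sum-δ

    ∣moment-moment : ∀ A B → (∀ i → Subset.∣ residue A p i ∣ ≡ Subset.∣ residue B p i ∣) →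
                     (+ p) ℤ.∣ (moment A ℤ.- moment B)
    ∣moment-moment A B eq = subst ((+ p) ℤ.∣_)
      (trans (cong (λ s → (moment A ℤ.- residue-moment A) ℤ.- (moment B ℤ.- s)) (sym residue-eq))
        (r (moment A) (moment B) (residue-moment A)))
      (ℤ.∣m∣n⇒∣m-n (∣moment-residue-moment A) (∣moment-residue-moment B))
      where
      residue-eq : residue-moment A ≡ residue-moment B
      residue-eq = sum-cong-≗ λ i → cong (λ c → Q (+ toℕ i) ℤ.* + c) (eq i)
      r : ∀ a b c → (a ℤ.- c) ℤ.- (b ℤ.- c) ≡ a ℤ.- b
      r = ℤ-Solver.solve-∀

  dominated⇒sum≢0 : ∀ {n B} (f : Fin n → ℤ) s → (∀ j → j ≢ s → ℤ.∣ f j ∣ ≤ B) →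
      n ℕ.* B < ℤ.∣ f s ∣ → sum f ≢ 0ℤ
  dominated⇒sum≢0 {suc n} {B} f s small large eq = ℕ.<⇒≱ large (begin
    ℤ.∣ f s ∣                          ≡⟨ cong ℤ.∣_∣ (r (f s) rest) ⟩
    ℤ.∣ (f s ℤ.+ rest) ℤ.- rest ∣
      ≡⟨ cong (λ x → ℤ.∣ x ℤ.- rest ∣) (trans (sym (sum-remove {i = s} f)) eq) ⟩
    ℤ.∣ 0ℤ ℤ.- rest ∣                  ≤⟨ ℤ.∣i-j∣≤∣i∣+∣j∣ 0ℤ rest ⟩
    ℤ.∣ rest ∣                         ≤⟨ ∣sum∣≤ (λ k → small (punchIn s k) (Fin.punchInᵢ≢i s k)) ⟩
    n ℕ.* B                            ≤⟨ ℕ.m≤n+m (n ℕ.* B) B ⟩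
    suc n ℕ.* B                        ∎)
    where
    open ℕ.≤-Reasoning
    rest = sum (f ∘ punchIn s)
    r : ∀ a b → a ≡ (a ℤ.+ b) ℤ.- b
    r = ℤ-Solver.solve-∀

  𝟙-diff-≡ : ∀ {a b} q → a ≡ b → 𝟙 a ℤ.* q ℤ.- 𝟙 b ℤ.* q ≡ 0ℤ
  𝟙-diff-≡ {a} q refl = ℤ.+-inverseʳ (𝟙 a ℤ.* q)

  𝟙-diff-≢ : ∀ {a b} q → a ≢ b → ℤ.∣ 𝟙 a ℤ.* q ℤ.- 𝟙 b ℤ.* q ∣ ≡ ℤ.∣ q ∣
  𝟙-diff-≢ {true} {true} q a≢b = contradiction refl a≢b
  𝟙-diff-≢ {false} {false} q a≢b = contradiction refl a≢b
  𝟙-diff-≢ {true} {false} q _ = cong ℤ.∣_∣ (trans (ℤ.+-identityʳ _) (ℤ.*-identityˡ q))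
  𝟙-diff-≢ {false} {true} q _ = trans (cong ℤ.∣_∣
      (trans (ℤ.+-identityˡ _) (cong ℤ.-_ (ℤ.*-identityˡ q)))) (ℤ.∣-i∣≡∣i∣ q)

  𝟙-diff-≤ : ∀ a b q → ℤ.∣ 𝟙 a ℤ.* q ℤ.- 𝟙 b ℤ.* q ∣ ≤ ℤ.∣ q ∣
  𝟙-diff-≤ a b q with a Bool.≟ b
  ... | yes a≡b = subst (λ x → ℤ.∣ x ∣ ≤ ℤ.∣ q ∣) (sym (𝟙-diff-≡ q a≡b)) z≤n
  ... | no a≢b = ℕ.≤-reflexive (𝟙-diff-≢ q a≢b)

  ∣-∣-≤ : ∀ {a b d} → a ≤ b ℕ.+ d → b ≤ a ℕ.+ d → ℕ.∣ a - b ∣ ≤ d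
  ∣-∣-≤ {a} {b} {d} p q with ℕ.∣m-n∣≡[m∸n]∨[n∸m] a b
  ... | inj₁ eq = subst (_≤ d) (sym eq) (ℕ.m≤n+o⇒m∸n≤o a b p)
  ... | inj₂ eq = subst (_≤ d) (sym eq) (ℕ.m≤n+o⇒m∸n≤o b a q)

  ∣-∣-< : ∀ {a b d} → a < b ℕ.+ d → b < a ℕ.+ d → ℕ.∣ a - b ∣ < d
  ∣-∣-< {a} {b} {zero} p q = contradiction
      (ℕ.<-trans (subst (a <_) (ℕ.+-identityʳ b) p) (subst (b <_) (ℕ.+-identityʳ a) q)) (ℕ.n≮n a)
  ∣-∣-< {a} {b} {suc d} p q = s≤s (∣-∣-≤ (ℕ.s≤s⁻¹ (subst (suc a ≤_) (ℕ.+-suc b d) p))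
      (ℕ.s≤s⁻¹ (subst (suc b ≤_) (ℕ.+-suc a d) q)))

  -- The integer form of `Separated`: distances are integers, so the real bound n^{1/3} may be
  -- replaced by its floor.
  Spaced : ∀ {n} → ℕ → Subset n → Set
  Spaced r A = ∀ {a a′} → a ∈ A → a′ ∈ A → a ≢ a′ → r ≤ ℕ.∣ val a - val a′ ∣

  first-difference : ∀ {n} (A B : Subset n) → A ≢ B →
    ∃[ s ] (lookup A s ≢ lookup B s × (∀ j → toℕ j < toℕ s → lookup A j ≡ lookup B j))
  first-difference {n} A B A≢B
    with s , ≢s , below ← Fin.¬∀⟶∃¬-smallest n (λ j → lookup A j ≡ lookup B j)
        (λ j → lookup A j Bool.≟ lookup B j)
           (λ all → A≢B (trans (sym (tabulate∘lookup A)) (trans (tabulate-cong all) (tabulate∘lookup B))))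
    = s , ≢s , λ j j<s → subst (λ k → lookup A k ≡ lookup B k)
        (Fin.toℕ-injective (trans (Fin.toℕ-inject (fromℕ< j<s)) (Fin.toℕ-fromℕ< j<s))) (below (fromℕ< j<s))

  module _ {n : ℕ} (r : ℕ) (s : Fin n) where

    Near : Subset n → Subset n → Fin n → Set
    Near A B j = toℕ s < toℕ j × toℕ j < toℕ s ℕ.+ r × lookup A j ≢ lookup B j

    near? : ∀ A B j → Dec (Near A B j)
    near? A B j = toℕ s ℕ.<? toℕ j ×-dec (toℕ j ℕ.<? toℕ s ℕ.+ r) ×-dec ¬? (lookup A j Bool.≟ lookup B j)

    near-sym : ∀ {A B j} → Near A B j → Near B A j
    near-sym (p , q , ne) = p , q , ne ∘ sym

    -- With s in A, separation of A bars A from the gap above s. So every difference there belongs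
    -- to B, and two of them would be closer than B allows.
    near-unique′ : ∀ {A B} → lookup A s ≡ true → Spaced r A → Spaced r B →
                   ∀ {j k} → Near A B j → Near A B k → j ≡ k
    near-unique′ {A} {B} As spA spB {j} {k} nj@(s<j , j< , _) nk@(s<k , k< , _) = decidable-stable
        (j Fin.≟ k)
      λ j≢k → ℕ.<⇒≱ (∣-∣-< (ℕ.<-≤-trans j< (ℕ.+-monoˡ-≤ r (ℕ.<⇒≤ s<k)))
          (ℕ.<-≤-trans k< (ℕ.+-monoˡ-≤ r (ℕ.<⇒≤ s<j))))
               (spB (in-B nj) (in-B nk) j≢k)
      where
      ∈⁺ : ∀ {C : Subset n} {i} → lookup C i ≡ true → i ∈ C
      ∈⁺ {C} {i} = lookup⇒[]= i C
      in-B : ∀ {i} → Near A B i → i ∈ B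
      in-B {i} (s<i , i< , ne) with lookup A i in Ai | lookup B i in Bi
      ... | true  | true  = contradiction refl ne
      ... | false | false = contradiction refl ne
      ... | false | true  = ∈⁺ Bi
      ... | true  | false = contradiction
        (spA (∈⁺ As) (∈⁺ Ai) λ s≡i → ℕ.n≮n (toℕ s) (subst (λ x → toℕ s < toℕ x) (sym s≡i) s<i))
        (ℕ.<⇒≱ (∣-∣-< (ℕ.<-≤-trans s<i (ℕ.m≤m+n (toℕ i) r)) i<))

    near-unique : ∀ {A B} → lookup A s ≢ lookup B s → Spaced r A → Spaced r B →
                  ∀ {j k} → Near A B j → Near A B k → j ≡ k
    near-unique {A} {B} ne spA spB {j} {k} nj nk with lookup A s in As | lookup B s in Bs
    ... | true  | _     = near-unique′ {A} {B} As spA spB nj nk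
    ... | false | true  = near-unique′ {B} {A} Bs spB spA (near-sym {A} {B} nj) (near-sym {A} {B} nk)
    ... | false | false = contradiction refl ne

    next-difference : ∀ {A B} → lookup A s ≢ lookup B s → Spaced r A → Spaced r B →
      ∃[ e ] (val s < e × e ≤ suc n × (∀ j → Near A B j → e ≡ val j))
    next-difference {A} {B} ne spA spB with Fin.any? (near? A B)
    ... | yes (j , nj@(s<j , _)) = val j , s≤s s<j , ℕ.m≤n⇒m≤1+n (Fin.toℕ<n j) ,
            λ k nk → cong val (near-unique {A} {B} ne spA spB nj nk)
    -- With no difference to kill, any e above `val s` will do. When s is the last index this choice
    -- is n + 1, hence the bound `suc n` in the statement.
    ... | no none = suc (val s) , ℕ.n<1+n _ , s≤s (Fin.toℕ<n s) , λ k nk → contradiction (k , nk) none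

  -- One positive integer S, chosen before p, that every modulus failing to distinguish A from B
  -- must divide.
  MomentDifference : ∀ {n} → Subset n → Subset n → ℕ → Set
  MomentDifference A B e = ∃[ S ] (1 ≤ S × S ≤ 2 ℕ.^ e ×
    (∀ p → {{_ : NonZero p}} → (∀ i → Subset.∣ residue A p i ∣ ≡ Subset.∣ residue B p i ∣) → + p ℤ.∣ + S))

  module _ {n r ℓ : ℕ} (1≤n : 1 ≤ n) (1≤r : 1 ≤ r) (r≤n : r ≤ n) (n≤8r³ : n ≤ 8 ℕ.* (r ℕ.* r ℕ.* r))
    (n<2^ℓ : n < 2 ℕ.^ ℓ) (1≤ℓ : 1 ≤ ℓ) where

    private
      -- `2v^k≤T⁺` asks for D k² ≥ 3n². As D ≥ 4nr and n ≤ 8r³, it suffices that k² ≥ 6r². Then 2^m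
      -- = 4^ℓ exceeds n², and M ≥ 64n² dominates the coefficients of the recursion, since |u| ≤ 5n.
      k = 3 ℕ.* r
      m = 2 ℕ.* ℓ
      M = 2 ℕ.^ (6 ℕ.+ 2 ℕ.* ℓ)

    open ℕ.≤-Reasoning

    -- The left side bounds n summands of size at most n M^(km). In the exponent 2ℓ + 36rℓ + 12rℓ²
    -- every monomial is at most rℓ², which gives 50.
    n*nM^km≤ : n ℕ.* (n ℕ.* (M ℕ.^ k) ℕ.^ m) ≤ 2 ℕ.^ (50 ℕ.* (r ℕ.* (ℓ ℕ.* ℓ)))
    n*nM^km≤ = begin
      n ℕ.* (n ℕ.* (M ℕ.^ k) ℕ.^ m)
        ≤⟨ ℕ.*-mono-≤ (ℕ.<⇒≤ n<2^ℓ) (ℕ.*-monoˡ-≤ _ (ℕ.<⇒≤ n<2^ℓ)) ⟩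
      2 ℕ.^ ℓ ℕ.* (2 ℕ.^ ℓ ℕ.* (M ℕ.^ k) ℕ.^ m)
        ≡⟨ cong (λ y → 2 ℕ.^ ℓ ℕ.* (2 ℕ.^ ℓ ℕ.* y))
            (trans (cong (ℕ._^ m) (ℕ.^-*-assoc 2 a k)) (ℕ.^-*-assoc 2 (a ℕ.* k) m)) ⟩
      2 ℕ.^ ℓ ℕ.* (2 ℕ.^ ℓ ℕ.* 2 ℕ.^ (a ℕ.* k ℕ.* m))
        ≡⟨ cong (2 ℕ.^ ℓ ℕ.*_) (ℕ.^-distribˡ-+-* 2 ℓ _) ⟨
      2 ℕ.^ ℓ ℕ.* 2 ℕ.^ (ℓ ℕ.+ a ℕ.* k ℕ.* m)
        ≡⟨ ℕ.^-distribˡ-+-* 2 ℓ _ ⟨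
      2 ℕ.^ (ℓ ℕ.+ (ℓ ℕ.+ a ℕ.* k ℕ.* m))
        ≤⟨ ℕ.^-monoʳ-≤ 2 exponent ⟩
      2 ℕ.^ (50 ℕ.* (r ℕ.* (ℓ ℕ.* ℓ))) ∎
      where
      a = 6 ℕ.+ 2 ℕ.* ℓ
      r₁ : ∀ ℓ r → ℓ ℕ.+ (ℓ ℕ.+ (6 ℕ.+ 2 ℕ.* ℓ) ℕ.* (3 ℕ.* r) ℕ.* (2 ℕ.* ℓ))
                 ≡ 2 ℕ.* ℓ ℕ.+ 36 ℕ.* (r ℕ.* ℓ) ℕ.+ 12 ℕ.* (r ℕ.* (ℓ ℕ.* ℓ))
      r₁ = ℕ-Solver.solve-∀
      r₂ : ∀ x → 2 ℕ.* x ℕ.+ 36 ℕ.* x ℕ.+ 12 ℕ.* x ≡ 50 ℕ.* x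
      r₂ = ℕ-Solver.solve-∀
      ℓ≤ℓ² : ℓ ≤ ℓ ℕ.* ℓ
      ℓ≤ℓ² = ℕ.m≤m*n ℓ ℓ {{ℕ.>-nonZero 1≤ℓ}}
      x = r ℕ.* (ℓ ℕ.* ℓ)
      ℓ≤x : ℓ ≤ x
      ℓ≤x = ℕ.≤-trans ℓ≤ℓ² (ℕ.m≤n*m (ℓ ℕ.* ℓ) r {{ℕ.>-nonZero 1≤r}})
      exponent : ℓ ℕ.+ (ℓ ℕ.+ a ℕ.* k ℕ.* m) ≤ 50 ℕ.* x
      exponent = begin
        ℓ ℕ.+ (ℓ ℕ.+ a ℕ.* k ℕ.* m)                           ≡⟨ r₁ ℓ r ⟩
        2 ℕ.* ℓ ℕ.+ 36 ℕ.* (r ℕ.* ℓ) ℕ.+ 12 ℕ.* x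
          ≤⟨ ℕ.+-monoˡ-≤ (12 ℕ.* x) (ℕ.+-mono-≤ (ℕ.*-monoʳ-≤ 2 ℓ≤x) (ℕ.*-monoʳ-≤ 36 (ℕ.*-monoʳ-≤ r ℓ≤ℓ²))) ⟩
        2 ℕ.* x ℕ.+ 36 ℕ.* x ℕ.+ 12 ℕ.* x                     ≡⟨ r₂ x ⟩
        50 ℕ.* x                                              ∎

    module _ (s e : ℕ) where

      private
        c = n ℕ.+ (2 ℕ.* r ℕ.+ 2 ℕ.* s)
        B = n ℕ.* (n ℕ.^ k) ℕ.^ m

      u : ℤ → ℤ
      u x = + c ℤ.- + 2 ℤ.* x

      -- u maps [s + r , s + n] into [-n , n] and s to n + 2r; the factor e - x
      -- kills the only index within distance r above s where A and B may differ.
      Q : ℤ → ℤ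
      Q x = (+ e ℤ.- x) ℤ.* T (+ n) (u x) k ℤ.^ m

      Q-poly : Polynomial Q
      Q-poly = *-poly (-‿poly (const-poly (+ e)) id-poly)
        (^-poly m (T-poly (+ n) k (-‿poly (const-poly (+ c)) (*-poly (const-poly (+ 2)) id-poly))))

      ∣Q∣≡ : ∀ x → ℤ.∣ Q (+ x) ∣ ≡ ℕ.∣ e - x ∣ ℕ.* ℤ.∣ T (+ n) (u (+ x)) k ∣ ℕ.^ m
      ∣Q∣≡ x = trans (ℤ.abs-* (+ e ℤ.- + x) _) (cong₂ ℕ._*_ (∣+-+∣ e x) (∣^∣ (T (+ n) (u (+ x)) k) m))

      ∣u∣≡ : ∀ x → ℤ.∣ u (+ x) ∣ ≡ ℕ.∣ c - 2 ℕ.* x ∣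
      ∣u∣≡ x = trans (cong (λ y → ℤ.∣ + c ℤ.- y ∣) (sym (ℤ.pos-* 2 x))) (∣+-+∣ c (2 ℕ.* x))

      Q[e]≡0 : Q (+ e) ≡ 0ℤ
      Q[e]≡0 = cong (ℤ._* T (+ n) (u (+ e)) k ℤ.^ m) (ℤ.+-inverseʳ (+ e))

      module _ {x : ℕ} (1≤x : 1 ≤ x) (x≤n : x ≤ n) (1≤e : 1 ≤ e) (e≤n+1 : e ≤ suc n) where

        ∣e-x∣≤n : ℕ.∣ e - x ∣ ≤ n
        ∣e-x∣≤n = ∣-∣-≤ (ℕ.≤-trans e≤n+1 (ℕ.+-monoˡ-≤ n 1≤x)) (ℕ.≤-trans x≤n (ℕ.m≤n+m n e))

        ∣Q∣≤-far : s ℕ.+ r ≤ x → ℤ.∣ Q (+ x) ∣ ≤ B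
        ∣Q∣≤-far s+r≤x = subst (_≤ B) (sym (∣Q∣≡ x))
          (ℕ.*-mono-≤ ∣e-x∣≤n (ℕ.^-monoˡ-≤ m
              (∣T∣≤v^k {n} {u (+ x)} k (subst (_≤ n) (sym (∣u∣≡ x)) (∣-∣-≤ c≤ 2x≤)))))
          where
          r₁ : ∀ n r s → n ℕ.+ (2 ℕ.* r ℕ.+ 2 ℕ.* s) ≡ 2 ℕ.* (s ℕ.+ r) ℕ.+ n
          r₁ = ℕ-Solver.solve-∀
          c≤ : c ≤ 2 ℕ.* x ℕ.+ n
          c≤ = ℕ.≤-trans (ℕ.≤-reflexive (r₁ n r s)) (ℕ.+-monoˡ-≤ n (ℕ.*-monoʳ-≤ 2 s+r≤x))
          2x≤ : 2 ℕ.* x ≤ c ℕ.+ n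
          2x≤ = begin
            2 ℕ.* x            ≤⟨ ℕ.*-monoʳ-≤ 2 x≤n ⟩
            2 ℕ.* n            ≡⟨ cong (n ℕ.+_) (ℕ.+-identityʳ n) ⟩
            n ℕ.+ n            ≤⟨ ℕ.+-monoˡ-≤ n (ℕ.m≤m+n n _) ⟩
            c ℕ.+ n            ∎

        module _ (s≤n : s ≤ n) where

          64n²≤M : 64 ℕ.* (n ℕ.* n) ≤ M
          64n²≤M = begin
            64 ℕ.* (n ℕ.* n)
              ≤⟨ ℕ.*-monoʳ-≤ 64 (ℕ.*-mono-≤ (ℕ.<⇒≤ n<2^ℓ) (ℕ.<⇒≤ n<2^ℓ)) ⟩
            2 ℕ.^ 6 ℕ.* (2 ℕ.^ ℓ ℕ.* 2 ℕ.^ ℓ) ≡⟨ cong (2 ℕ.^ 6 ℕ.*_) (ℕ.^-distribˡ-+-* 2 ℓ ℓ) ⟨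
            2 ℕ.^ 6 ℕ.* 2 ℕ.^ (ℓ ℕ.+ ℓ)       ≡⟨ ℕ.^-distribˡ-+-* 2 6 (ℓ ℕ.+ ℓ) ⟨
            2 ℕ.^ (6 ℕ.+ (ℓ ℕ.+ ℓ))
              ≡⟨ cong (λ y → 2 ℕ.^ (6 ℕ.+ (ℓ ℕ.+ y))) (ℕ.+-identityʳ ℓ) ⟨
            M                                 ∎

          n≤n² : n ≤ n ℕ.* n
          n≤n² = ℕ.m≤m*n n n {{ℕ.>-nonZero 1≤n}}

          ∣u∣≤5n : ℤ.∣ u (+ x) ∣ ≤ 5 ℕ.* n
          ∣u∣≤5n = subst (_≤ 5 ℕ.* n) (sym (∣u∣≡ x)) (ℕ.≤-trans (ℕ.∣m-n∣≤m⊔n c (2 ℕ.* x)) (ℕ.⊔-lub c≤ 2x≤))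
            where
            r₁ : ∀ n → n ℕ.+ (2 ℕ.* n ℕ.+ 2 ℕ.* n) ≡ 5 ℕ.* n
            r₁ = ℕ-Solver.solve-∀
            c≤ : c ≤ 5 ℕ.* n
            c≤ = ℕ.≤-trans (ℕ.+-monoʳ-≤ n (ℕ.+-mono-≤ (ℕ.*-monoʳ-≤ 2 r≤n) (ℕ.*-monoʳ-≤ 2 s≤n)))
                (ℕ.≤-reflexive (r₁ n))
            2x≤ : 2 ℕ.* x ≤ 5 ℕ.* n
            2x≤ = ℕ.*-mono-≤ (ℕ.≤ᵇ⇒≤ 2 5 tt) x≤n

          ∣u∣+∣D∣≤M : ℤ.∣ u (+ x) ∣ ℕ.+ ℤ.∣ u (+ x) ℤ.* u (+ x) ℤ.- + n ℤ.* + n ∣ ≤ M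
          ∣u∣+∣D∣≤M = begin
            ℤ.∣ y ∣ ℕ.+ ℤ.∣ y ℤ.* y ℤ.- + n ℤ.* + n ∣
              ≤⟨ ℕ.+-monoʳ-≤ ℤ.∣ y ∣ (ℤ.∣i-j∣≤∣i∣+∣j∣ (y ℤ.* y) (+ n ℤ.* + n)) ⟩
            ℤ.∣ y ∣ ℕ.+ (ℤ.∣ y ℤ.* y ∣ ℕ.+ ℤ.∣ + n ℤ.* + n ∣)
              ≡⟨ cong (ℤ.∣ y ∣ ℕ.+_) (cong₂ ℕ._+_ (ℤ.abs-* y y) (ℤ.abs-* (+ n) (+ n))) ⟩
            ℤ.∣ y ∣ ℕ.+ (ℤ.∣ y ∣ ℕ.* ℤ.∣ y ∣ ℕ.+ n ℕ.* n)
              ≤⟨ ℕ.+-mono-≤ (ℕ.≤-trans ∣u∣≤5n (ℕ.*-monoʳ-≤ 5 n≤n²))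
                  (ℕ.+-monoˡ-≤ (n ℕ.* n) (ℕ.*-mono-≤ ∣u∣≤5n ∣u∣≤5n)) ⟩
            5 ℕ.* (n ℕ.* n) ℕ.+ (5 ℕ.* n ℕ.* (5 ℕ.* n) ℕ.+ n ℕ.* n)
              ≡⟨ r₁ n ⟩
            31 ℕ.* (n ℕ.* n)
              ≤⟨ ℕ.*-monoˡ-≤ (n ℕ.* n) (ℕ.≤ᵇ⇒≤ 31 64 tt) ⟩
            64 ℕ.* (n ℕ.* n)
              ≤⟨ 64n²≤M ⟩
            M ∎
            where
            y = u (+ x)
            r₁ : ∀ n → 5 ℕ.* (n ℕ.* n) ℕ.+ (5 ℕ.* n ℕ.* (5 ℕ.* n) ℕ.+ n ℕ.* n) ≡ 31 ℕ.* (n ℕ.* n)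
            r₁ = ℕ-Solver.solve-∀

          1+∣u∣≤M : 1 ℕ.+ ℤ.∣ u (+ x) ∣ ≤ M
          1+∣u∣≤M = begin
            1 ℕ.+ ℤ.∣ u (+ x) ∣    ≤⟨ ℕ.+-mono-≤ 1≤n ∣u∣≤5n ⟩
            6 ℕ.* n                ≤⟨ ℕ.*-mono-≤ (ℕ.≤ᵇ⇒≤ 6 64 tt) n≤n² ⟩
            64 ℕ.* (n ℕ.* n)       ≤⟨ 64n²≤M ⟩
            M                      ∎

          ∣Q∣≤ : ℤ.∣ Q (+ x) ∣ ≤ n ℕ.* (M ℕ.^ k) ℕ.^ m
          ∣Q∣≤ = subst (_≤ n ℕ.* (M ℕ.^ k) ℕ.^ m) (sym (∣Q∣≡ x))
            (ℕ.*-mono-≤ ∣e-x∣≤n (ℕ.^-monoˡ-≤ m (∣T∣≤M^k {+ n} {u (+ x)} ∣u∣+∣D∣≤M 1+∣u∣≤M k)))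

      -- Here n B = n² n^(km), while the value at s is at least (2 n^k)^m = 4^ℓ n^(km), the factor
      -- |e - s| being at least 1.
      nB<∣Q[s]∣ : s < e → n ℕ.* B < ℤ.∣ Q (+ s) ∣
      nB<∣Q[s]∣ s<e = begin-strict
        n ℕ.* (n ℕ.* (n ℕ.^ k) ℕ.^ m)            ≡⟨ ℕ.*-assoc n n _ ⟨
        n ℕ.* n ℕ.* (n ℕ.^ k) ℕ.^ m
          <⟨ ℕ.*-monoˡ-< _ {{ℕ.m^n≢0 (n ℕ.^ k) m {{ℕ.m^n≢0 n k {{n≢0}}}}}} (ℕ.*-mono-< n<2^ℓ n<2^ℓ) ⟩
        2 ℕ.^ ℓ ℕ.* 2 ℕ.^ ℓ ℕ.* (n ℕ.^ k) ℕ.^ m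
          ≡⟨ cong (ℕ._* (n ℕ.^ k) ℕ.^ m)
              (trans (sym (ℕ.^-distribˡ-+-* 2 ℓ ℓ))
              (cong (λ y → 2 ℕ.^ (ℓ ℕ.+ y)) (sym (ℕ.+-identityʳ ℓ)))) ⟩
        2 ℕ.^ m ℕ.* (n ℕ.^ k) ℕ.^ m              ≡⟨ ^-distribʳ-* 2 (n ℕ.^ k) m ⟨
        (2 ℕ.* n ℕ.^ k) ℕ.^ m
          ≤⟨ ℕ.^-monoˡ-≤ m (2v^k≤T⁺ n (2 ℕ.* r) k {{n≢0}} growth) ⟩
        T⁺ n (2 ℕ.* r) k ℕ.^ m
          ≡⟨ cong (λ y → ℤ.∣ y ∣ ℕ.^ m) (trans (cong (λ y → T (+ n) y k) u[s]≡) (T≡+T⁺ n (2 ℕ.* r) k)) ⟨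
        t                                        ≡⟨ ℕ.*-identityˡ t ⟨
        1 ℕ.* t                                  ≤⟨ ℕ.*-monoˡ-≤ t 1≤∣e-s∣ ⟩
        ℕ.∣ e - s ∣ ℕ.* t                        ≡⟨ ∣Q∣≡ s ⟨
        ℤ.∣ Q (+ s) ∣                            ∎
        where
        n≢0 = ℕ.>-nonZero 1≤n
        t = ℤ.∣ T (+ n) (u (+ s)) k ∣ ℕ.^ m
        ^-distribʳ-* : ∀ a b m → (a ℕ.* b) ℕ.^ m ≡ a ℕ.^ m ℕ.* b ℕ.^ m
        ^-distribʳ-* a b zero = refl
        ^-distribʳ-* a b (suc m) = trans (cong (a ℕ.* b ℕ.*_) (^-distribʳ-* a b m))
            (rr a b (a ℕ.^ m) (b ℕ.^ m))
          where
          rr : ∀ a b x y → a ℕ.* b ℕ.* (x ℕ.* y) ≡ a ℕ.* x ℕ.* (b ℕ.* y)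
          rr = ℕ-Solver.solve-∀
        u[s]≡ : u (+ s) ≡ + (n ℕ.+ 2 ℕ.* r)
        u[s]≡ = trans (cong₂ ℤ._-_ (trans (cong +_ (r₁ n r s)) (ℤ.pos-+ (n ℕ.+ 2 ℕ.* r) (2 ℕ.* s)))
            (sym (ℤ.pos-* 2 s)))
                  (r₂ (+ (n ℕ.+ 2 ℕ.* r)) (+ (2 ℕ.* s)))
          where
          r₁ : ∀ n r s → n ℕ.+ (2 ℕ.* r ℕ.+ 2 ℕ.* s) ≡ n ℕ.+ 2 ℕ.* r ℕ.+ 2 ℕ.* s
          r₁ = ℕ-Solver.solve-∀
          r₂ : ∀ a b → a ℤ.+ b ℤ.- b ≡ a
          r₂ = ℤ-Solver.solve-∀
        1≤∣e-s∣ : 1 ≤ ℕ.∣ e - s ∣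
        1≤∣e-s∣ = ℕ.≤-trans (ℕ.m<n⇒0<n∸m s<e) (ℕ.m∸n≤∣m-n∣ e s)
        growth : 3 ℕ.* (n ℕ.* n) ≤ (2 ℕ.* (n ℕ.* (2 ℕ.* r)) ℕ.+ 2 ℕ.* r ℕ.* (2 ℕ.* r)) ℕ.* (k ℕ.* k)
        -- The right side is 36nr³ + 36r⁴, the left at most 24nr³.
        growth = begin
          3 ℕ.* (n ℕ.* n)                          ≤⟨ ℕ.*-monoʳ-≤ 3 (ℕ.*-monoʳ-≤ n n≤8r³) ⟩
          3 ℕ.* (n ℕ.* (8 ℕ.* (r ℕ.* r ℕ.* r)))
            ≤⟨ ℕ.m≤m+n _ (12 ℕ.* (n ℕ.* (r ℕ.* r ℕ.* r)) ℕ.+ 36 ℕ.* (r ℕ.* r ℕ.* (r ℕ.* r))) ⟩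
          3 ℕ.* (n ℕ.* (8 ℕ.* (r ℕ.* r ℕ.* r))) ℕ.+
              (12 ℕ.* (n ℕ.* (r ℕ.* r ℕ.* r)) ℕ.+ 36 ℕ.* (r ℕ.* r ℕ.* (r ℕ.* r)))
                                                   ≡⟨ r₁ n r ⟩
          (2 ℕ.* (n ℕ.* (2 ℕ.* r)) ℕ.+ 2 ℕ.* r ℕ.* (2 ℕ.* r)) ℕ.* (3 ℕ.* r ℕ.* (3 ℕ.* r)) ∎
          where
          r₁ : ∀ n r → 3 ℕ.* (n ℕ.* (8 ℕ.* (r ℕ.* r ℕ.* r))) ℕ.+
              (12 ℕ.* (n ℕ.* (r ℕ.* r ℕ.* r)) ℕ.+ 36 ℕ.* (r ℕ.* r ℕ.* (r ℕ.* r)))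
                     ≡ (2 ℕ.* (n ℕ.* (2 ℕ.* r)) ℕ.+ 2 ℕ.* r ℕ.* (2 ℕ.* r)) ℕ.* (3 ℕ.* r ℕ.* (3 ℕ.* r))
          r₁ = ℕ-Solver.solve-∀

    ∃-moment-difference : (A B : Subset n) → A ≢ B → Spaced r A → Spaced r B →
                          MomentDifference A B (50 ℕ.* (r ℕ.* (ℓ ℕ.* ℓ)))
    ∃-moment-difference A B A≢B spA spB
      with s , ne , below ← first-difference A B A≢B
      with e , s<e , e≤ , near ← next-difference r s {A} {B} ne spA spB
      = ℤ.∣ Σ′ ∣ , ℕ.n≢0⇒n>0 (λ eq → Σ≢0 (ℤ.∣i∣≡0⇒i≡0 eq)) , Σ≤ , λ p eq →
          ℤ.∣-trans (subst ((+ p) ℤ.∣_) (sym (sum-minus {n} _ _))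
              (∣moment-moment {n} {p} poly A B eq)) ℤ.m∣∣m∣
      where
      q : ℤ → ℤ
      q = Q (val s) e
      poly : Polynomial q
      poly = Q-poly (val s) e
      f : Fin n → ℤ
      f j = 𝟙 (lookup A j) ℤ.* q (+ val j) ℤ.- 𝟙 (lookup B j) ℤ.* q (+ val j)
      Σ′ = sum f
      1≤e = ℕ.≤-trans (s≤s z≤n) s<e
      zero-term : ∀ {j} → f j ≡ 0ℤ → ∀ {b} → ℤ.∣ f j ∣ ≤ b
      zero-term {j} eq {b} = subst (λ x → ℤ.∣ x ∣ ≤ b) (sym eq) z≤n
      small : ∀ j → j ≢ s → ℤ.∣ f j ∣ ≤ n ℕ.* (n ℕ.^ (3 ℕ.* r)) ℕ.^ (2 ℕ.* ℓ)
      small j j≢s with ℕ.<-cmp (toℕ j) (toℕ s)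
      ... | tri< j<s _ _ = zero-term {j} (𝟙-diff-≡ (q (+ val j)) (below j j<s))
      ... | tri≈ _ j≡s _ = contradiction (Fin.toℕ-injective j≡s) j≢s
      ... | tri> _ _ s<j with toℕ j ℕ.<? toℕ s ℕ.+ r
      ...   | no j≮ = ℕ.≤-trans (𝟙-diff-≤ (lookup A j) (lookup B j) (q (+ val j)))
                (∣Q∣≤-far (val s) e (s≤s z≤n) (Fin.toℕ<n j) 1≤e e≤ (s≤s (ℕ.≮⇒≥ j≮)))
      ...   | yes j< with lookup A j Bool.≟ lookup B j
      ...     | yes eq = zero-term {j} (𝟙-diff-≡ (q (+ val j)) eq)
      ...     | no neq = ℕ.≤-trans (𝟙-diff-≤ (lookup A j) (lookup B j) (q (+ val j)))
                  (subst (λ x → ℤ.∣ x ∣ ≤ n ℕ.* (n ℕ.^ (3 ℕ.* r)) ℕ.^ (2 ℕ.* ℓ))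
                      (sym (trans (cong (λ x → q (+ x)) (sym (near j (s<j , j< , neq))))
                    (Q[e]≡0 (val s) e))) z≤n)
      Σ≢0 : Σ′ ≢ 0ℤ
      Σ≢0 = dominated⇒sum≢0 f s small (subst (_ <_) (sym (𝟙-diff-≢ (q (+ val s)) ne))
        (nB<∣Q[s]∣ (val s) e s<e))
      Σ≤ : ℤ.∣ Σ′ ∣ ≤ 2 ℕ.^ (50 ℕ.* (r ℕ.* (ℓ ℕ.* ℓ)))
      Σ≤ = ℕ.≤-trans (∣sum∣≤ {n} {f = f} λ j → ℕ.≤-trans (𝟙-diff-≤ (lookup A j) (lookup B j) (q (+ val j)))
             (∣Q∣≤ (val s) e (s≤s z≤n) (Fin.toℕ<n j) 1≤e e≤ (Fin.toℕ<n s)))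
           n*nM^km≤

-- From the real quantities n^{1/3} and log n to integer bounds.

module RealBounds where

  open import Data.Integer.Base as ℤ using (+_)
  import Data.Integer.Properties as ℤ
  open import Data.Nat.Base as ℕ using (ℕ; zero; suc; s≤s; z≤n)
  open import Data.Nat.DivMod as ℕ using (m/n*n≤m; m≡m%n+[m/n]*n; m%n<n)
  import Data.Nat.Properties as ℕ
  import Data.Nat.Tactic.RingSolver as ℕ-Solver
  open import Data.Product.Base using (∃-syntax; _×_; _,_; proj₁; proj₂)
  open import Data.Rational.Base as ℚ using (ℚ; mkℚ; _/_; 0ℚ; 1ℚ; ½; *<*; *≤*)
  import Data.Rational.Properties as ℚ
  open import Data.Rational.Unnormalised.Base as ℚᵘ using (mkℚᵘ)
  import Data.Rational.Unnormalised.Properties as ℚᵘ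
  open import Data.Sum.Base using (inj₁; inj₂)
  open import Defs
  open import Relation.Binary.PropositionalEquality

  frac-≤⁻¹ : ∀ a b c d → + a / suc b ℚ.≤ + c / suc d → a ℕ.* suc d ℕ.≤ c ℕ.* suc b
  frac-≤⁻¹ a b c d le = ℤ.drop‿+≤+ (subst₂ ℤ._≤_ (sym (ℤ.pos-* a (suc d))) (sym (ℤ.pos-* c (suc b)))
    (ℚᵘ.drop-*≤* (begin
      mkℚᵘ (+ a) b          ≃⟨ ℚ.toℚᵘ-fromℚᵘ (mkℚᵘ (+ a) b) ⟨
      ℚ.toℚᵘ (+ a / suc b)  ≤⟨ ℚ.toℚᵘ-mono-≤ le ⟩
      ℚ.toℚᵘ (+ c / suc d)  ≃⟨ ℚ.toℚᵘ-fromℚᵘ (mkℚᵘ (+ c) d) ⟩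
      mkℚᵘ (+ c) d          ∎)))
    where open ℚᵘ.≤-Reasoning

  frac-* : ∀ a b c d → (+ a / suc b) ℚ.* (+ c / suc d) ≡ + (a ℕ.* c) / (suc b ℕ.* suc d)
  frac-* a b c d = ℚ.toℚᵘ-injective (begin-equality
    ℚ.toℚᵘ ((+ a / suc b) ℚ.* (+ c / suc d))
      ≃⟨ ℚ.toℚᵘ-homo-* (+ a / suc b) (+ c / suc d) ⟩
    ℚ.toℚᵘ (+ a / suc b) ℚᵘ.* ℚ.toℚᵘ (+ c / suc d)
      ≃⟨ ℚᵘ.*-cong (ℚ.toℚᵘ-fromℚᵘ (mkℚᵘ (+ a) b)) (ℚ.toℚᵘ-fromℚᵘ (mkℚᵘ (+ c) d)) ⟩
    mkℚᵘ (+ a) b ℚᵘ.* mkℚᵘ (+ c) d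
      ≡⟨ cong (λ i → mkℚᵘ i (d ℕ.+ b ℕ.* suc d)) (sym (ℤ.pos-* a c)) ⟩
    mkℚᵘ (+ (a ℕ.* c)) (d ℕ.+ b ℕ.* suc d)
      ≃⟨ ℚ.toℚᵘ-fromℚᵘ (mkℚᵘ (+ (a ℕ.* c)) (d ℕ.+ b ℕ.* suc d)) ⟨
    ℚ.toℚᵘ (+ (a ℕ.* c) / (suc b ℕ.* suc d)) ∎)
    where open ℚᵘ.≤-Reasoning

  0≤frac : ∀ a b → 0ℚ ℚ.≤ + a / suc b
  0≤frac a b = frac-≤ 0 0 a b z≤n

  floor : ∀ q → 0ℚ ℚ.≤ q → ∃[ m ] (+ m / 1 ℚ.≤ q × q ℚ.< + suc m / 1)
  floor q@(mkℚ (+ a) d _) _ = m ,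
    subst (+ m / 1 ℚ.≤_) (ℚ.↥p/↧p≡p q) (frac-≤ m 0 a d
        (subst (m ℕ.* suc d ℕ.≤_) (sym (ℕ.*-identityʳ a)) (m/n*n≤m a (suc d)))) ,
    ℚ.≰⇒> λ le → ℕ.<⇒≱ a< (subst (suc m ℕ.* suc d ℕ.≤_) (ℕ.*-identityʳ a)
      (frac-≤⁻¹ (suc m) 0 a d (subst (+ suc m / 1 ℚ.≤_) (sym (ℚ.↥p/↧p≡p q)) le)))
    where
    m = a ℕ./ suc d
    a< : a ℕ.< suc m ℕ.* suc d
    a< = subst (ℕ._< suc m ℕ.* suc d) (sym (m≡m%n+[m/n]*n a (suc d)))
        (ℕ.+-monoˡ-< (m ℕ.* suc d) (m%n<n a (suc d)))
  floor (mkℚ ℤ.-[1+ _ ] _ _) (*≤* ())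

  ∑-≤ : ∀ {a b} f → (∀ i → 0ℚ ℚ.≤ f i) → a ℕ.≤ b → ∑ a f ℚ.≤ ∑ b f
  ∑-≤ {a} {b} f 0≤f a≤b = begin
    ∑ a f                             ≡⟨ ℚ.+-identityʳ (∑ a f) ⟨
    ∑ a f ℚ.+ 0ℚ
      ≤⟨ ℚ.+-monoʳ-≤ (∑ a f) (0≤∑ (b ℕ.∸ a) (λ i → f (a ℕ.+ i)) (λ i → 0≤f (a ℕ.+ i))) ⟩
    ∑ a f ℚ.+ ∑ (b ℕ.∸ a) (λ i → f (a ℕ.+ i)) ≡⟨ ∑-+ a (b ℕ.∸ a) f ⟨
    ∑ (a ℕ.+ (b ℕ.∸ a)) f             ≡⟨ cong (λ c → ∑ c f) (ℕ.m+[n∸m]≡n a≤b) ⟩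
    ∑ b f                             ∎
    where
    open ℚ.≤-Reasoning
    0≤∑ : ∀ a f → (∀ i → 0ℚ ℚ.≤ f i) → 0ℚ ℚ.≤ ∑ a f
    0≤∑ zero f h = ℚ.≤-refl
    0≤∑ (suc a) f h = ℚ.+-mono-≤ (0≤∑ a f h) (h a)

  -- Each of the h dyadic blocks between 1 and 2^h contributes at least 1/2.
  riemann-lower : ∀ h n k → 2 ℕ.^ h ℕ.≤ n → + h / 2 ℚ.≤ riemann n k
  riemann-lower h n k 2^h≤n = ℚ.≤-trans (dyadic h)
    (∑-≤ g (λ i → 0≤frac 1 (K ℕ.+ i)) (ℕ.+-cancelˡ-≤ K _ _ (begin
      K ℕ.+ end h                 ≡⟨ K+end h ⟩
      2 ℕ.^ h ℕ.* K               ≤⟨ ℕ.*-monoˡ-≤ K 2^h≤n ⟩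
      n ℕ.* K                     ≡⟨ cong (ℕ._* K) (ℕ.m+[n∸m]≡n (ℕ.≤-trans (ℕ.m^n>0 2 h) 2^h≤n)) ⟨
      K ℕ.+ (n ℕ.∸ 1) ℕ.* K       ∎)))
    where
    open ℕ.≤-Reasoning
    K = suc k
    g : ℕ → ℚ
    g j = + 1 / suc (K ℕ.+ j)
    -- `end h` is (2^h - 1) K, the number of mesh intervals in [1 , 2^h]. The next block has b = 2^h
    -- K terms, each at least 1/(2b).
    end : ℕ → ℕ
    end zero = 0
    end (suc h) = end h ℕ.+ 2 ℕ.^ h ℕ.* K
    K+end : ∀ h → K ℕ.+ end h ≡ 2 ℕ.^ h ℕ.* K
    K+end zero = trans (ℕ.+-identityʳ K) (sym (ℕ.+-identityʳ K))
    K+end (suc h) = trans (sym (ℕ.+-assoc K (end h) _))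
        (trans (cong (ℕ._+ 2 ℕ.^ h ℕ.* K) (K+end h)) (r (2 ℕ.^ h) K))
      where
      r : ∀ x K → x ℕ.* K ℕ.+ x ℕ.* K ≡ 2 ℕ.* x ℕ.* K
      r = ℕ-Solver.solve-∀
    half≤block : ∀ b → 1 ℕ.≤ b → (f : ℕ → ℚ) →
        (∀ i → i ℕ.< b → + 1 / suc (ℕ.pred (b ℕ.+ b)) ℚ.≤ f i) → + 1 / 2 ℚ.≤ ∑ b f
    half≤block b@(suc b′) _ f h = ℚ.≤-trans (frac-≤ 1 1 b (ℕ.pred (b ℕ.+ b)) (ℕ.≤-reflexive (r b′)))
      (ℚ.≤-trans (ℚ.≤-reflexive (sym (∑-const b (ℕ.pred (b ℕ.+ b))))) (∑-mono b h))
      where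
      r : ∀ b′ → 1 ℕ.* suc (b′ ℕ.+ suc b′) ≡ suc b′ ℕ.* 2
      r = ℕ-Solver.solve-∀
    dyadic : ∀ h → + h / 2 ℚ.≤ ∑ (end h) g
    dyadic zero = ℚ.≤-refl
    dyadic (suc h) = ℚ.≤-trans (ℚ.≤-reflexive
        (trans (cong (λ c → + c / 2) (ℕ.+-comm 1 h)) (sym (frac-+ h 1 1))))
      (ℚ.≤-trans (ℚ.+-mono-≤ (dyadic h) (half≤block b (ℕ.*-mono-≤ (ℕ.m^n>0 2 h) (s≤s {n = k} z≤n))
          (λ i → g (end h ℕ.+ i)) λ i i<b →
          frac-≤ 1 (ℕ.pred (b ℕ.+ b)) 1 (K ℕ.+ (end h ℕ.+ i)) (ℕ.*-monoʳ-≤ 1 (index i i<b))))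
        (ℚ.≤-reflexive (sym (∑-+ (end h) b g))))
      where
      b = 2 ℕ.^ h ℕ.* K
      index : ∀ i → i ℕ.< b → suc (K ℕ.+ (end h ℕ.+ i)) ℕ.≤ suc (ℕ.pred (b ℕ.+ b))
      index i i<b = begin
        suc (K ℕ.+ (end h ℕ.+ i))
          ≡⟨ cong suc (trans (sym (ℕ.+-assoc K (end h) i)) (cong (ℕ._+ i) (K+end h))) ⟩
        suc (b ℕ.+ i)                 ≤⟨ ℕ.+-monoʳ-< b i<b ⟩
        b ℕ.+ b
          ≤⟨ ℕ.≤-reflexive (sym (ℕ.suc-pred
              (b ℕ.+ b) {{ℕ.>-nonZero (ℕ.≤-trans (s≤s z≤n) (ℕ.+-monoʳ-< b i<b))}})) ⟩
        suc (ℕ.pred (b ℕ.+ b))        ∎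

  -- The number r (i + 1) has cube at most n (i + 1)³, so already every truncation, and not merely
  -- the limit, is at least r.
  ∛-lower : ∀ n i → + ⌊∛ n ⌋ / 1 ℚ.≤ seq (∛ n) i
  ∛-lower n i = frac-≤ r 0 ⌊∛ m ⌋ i (ℕ.≤-trans (ℕ.≮⇒≥ λ lt → ℕ.n≮n m (begin-strict
    m                          <⟨ ⌊∛⌋-upper m ⟩
    suc ⌊∛ m ⌋ ℕ.^ 3           ≤⟨ ℕ.^-monoˡ-≤ 3 lt ⟩
    (r ℕ.* suc i) ℕ.^ 3        ≡⟨ cube-* r (suc i) ⟩
    r ℕ.^ 3 ℕ.* suc i ℕ.^ 3    ≤⟨ ℕ.*-monoˡ-≤ (suc i ℕ.^ 3) (⌊∛⌋-lower n) ⟩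
    m                          ∎)) (ℕ.≤-reflexive (sym (ℕ.*-identityʳ ⌊∛ m ⌋))))
    where
    open ℕ.≤-Reasoning
    r = ⌊∛ n ⌋
    m = n ℕ.* suc i ℕ.^ 3
    cube-* : ∀ a b → (a ℕ.* b) ℕ.^ 3 ≡ a ℕ.^ 3 ℕ.* b ℕ.^ 3
    cube-* a b = r′ a b
      where
      r′ : ∀ a b → (a ℕ.* b) ℕ.* ((a ℕ.* b) ℕ.* ((a ℕ.* b) ℕ.* 1)) ≡ (a ℕ.* (a ℕ.* (a ℕ.* 1))) ℕ.*
          (b ℕ.* (b ℕ.* (b ℕ.* 1)))
      r′ = ℕ-Solver.solve-∀

  -- An error of ½ is harmless between integers: if d < r, the approximations would be at least d +
  -- 1 and at most d + ½.
  ∛≤fromℕ⇒≤ : ∀ n d → ∛ n ≤ᴿ fromℕ d → ⌊∛ n ⌋ ℕ.≤ d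
  ∛≤fromℕ⇒≤ n d le with N , ≤d+½ ← le ½ (ℚ.positive⁻¹ ½) = ℕ.≮⇒≥ λ d<r →
    ℚ.<-irrefl refl (ℚ.<-≤-trans (ℚ.+-monoʳ-< (+ d / 1) {½} {1ℚ} (*<* (ℤ.+<+ (s≤s (s≤s z≤n)))))
      (ℚ.≤-trans (d+1≤ d<r) (≤d+½ N ℕ.≤-refl)))
    where
    d+1≤ : d ℕ.< ⌊∛ n ⌋ → ∀ {i} → + d / 1 ℚ.+ 1ℚ ℚ.≤ seq (∛ n) i
    d+1≤ d<r {i} = ℚ.≤-trans (ℚ.≤-reflexive (frac-+ d 1 0))
      (ℚ.≤-trans (frac-≤ (d ℕ.+ 1) 0 ⌊∛ n ⌋ 0
          (ℕ.*-monoˡ-≤ 1 (subst (ℕ._≤ ⌊∛ n ⌋) (ℕ.+-comm 1 d) d<r))) (∛-lower n i))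

  *-mono-≤-nonNeg : ∀ {p q r s} → 0ℚ ℚ.≤ p → 0ℚ ℚ.≤ r → p ℚ.≤ q → r ℚ.≤ s → p ℚ.* r ℚ.≤ q ℚ.* s
  *-mono-≤-nonNeg {p} {q} {r} {s} 0≤p 0≤r p≤q r≤s = ℚ.≤-trans
    (ℚ.*-monoʳ-≤-nonNeg r {{ℚ.nonNegative 0≤r}} p≤q)
    (ℚ.*-monoˡ-≤-nonNeg q {{ℚ.nonNegative (ℚ.≤-trans 0≤p p≤q)}} r≤s)

  ^ᴿ-lower : ∀ x a b i → + a / suc b ℚ.≤ seq x i → ∀ k →
             + (a ℕ.^ k) / suc (ℕ.pred (suc b ℕ.^ k)) ℚ.≤ seq (x ^ᴿ k) i
  ^ᴿ-lower x a b i le zero = ℚ.≤-refl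
  ^ᴿ-lower x a b i le (suc k) = ℚ.≤-trans
    (ℚ.≤-trans (frac-≤ (a ℕ.* a ℕ.^ k) _ (a ℕ.* a ℕ.^ k) _ (ℕ.≤-reflexive (cong (a ℕ.* a ℕ.^ k ℕ.*_) eq)))
      (ℚ.≤-reflexive (sym (frac-* a b (a ℕ.^ k) (ℕ.pred (suc b ℕ.^ k))))))
    (*-mono-≤-nonNeg (0≤frac a b) (0≤frac (a ℕ.^ k) _) le (^ᴿ-lower x a b i le k))
    where
    eq : suc b ℕ.* suc (ℕ.pred (suc b ℕ.^ k)) ≡ suc (ℕ.pred (suc b ℕ.* suc b ℕ.^ k))
    eq = trans (cong (suc b ℕ.*_) (ℕ.suc-pred (suc b ℕ.^ k) {{ℕ.m^n≢0 (suc b) k}}))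
           (sym (ℕ.suc-pred (suc b ℕ.* suc b ℕ.^ k) {{ℕ.m^n≢0 (suc b) (suc k)}}))

  scale : ℕ → ℕ → ℝ
  scale c n = fromℕ c *ᴿ ∛ n *ᴿ log n ^ᴿ 6

  -- The factor 64 = 2^6 pays for the sixth power of the estimate log n ≥ h/2.
  scale-lower : ∀ c n h i → 2 ℕ.^ h ℕ.≤ n → + (c ℕ.* ⌊∛ n ⌋ ℕ.* h ℕ.^ 6) / 1 ℚ.≤ seq (scale (64 ℕ.* c) n) i
  scale-lower c n h i 2^h≤n = ℚ.≤-trans
    (ℚ.≤-trans (frac-≤ (c ℕ.* r ℕ.* h ℕ.^ 6) 0 (64 ℕ.* c ℕ.* r ℕ.* h ℕ.^ 6) 63
        (ℕ.≤-reflexive (r′ c r (h ℕ.^ 6))))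
      (ℚ.≤-reflexive (sym (trans (cong (ℚ._* (+ (h ℕ.^ 6) / 64)) (frac-* (64 ℕ.* c) 0 r 0))
          (frac-* (64 ℕ.* c ℕ.* r) 0 (h ℕ.^ 6) 63)))))
    (*-mono-≤-nonNeg (ℚ.≤-trans (0≤frac (64 ℕ.* c ℕ.* r) 0)
        (ℚ.≤-reflexive (sym (frac-* (64 ℕ.* c) 0 r 0)))) (0≤frac (h ℕ.^ 6) 63)
      (*-mono-≤-nonNeg (0≤frac (64 ℕ.* c) 0) (0≤frac r 0) ℚ.≤-refl (∛-lower n i))
      (^ᴿ-lower (log n) h 1 i (riemann-lower h n i 2^h≤n) 6))
    where
    r = ⌊∛ n ⌋
    r′ : ∀ c r x → c ℕ.* r ℕ.* x ℕ.* 64 ≡ 64 ℕ.* c ℕ.* r ℕ.* x ℕ.* 1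
    r′ = ℕ-Solver.solve-∀

  ∣-∣<⇒< : ∀ {p q r} → ℚ.∣ p ℚ.- q ∣ ℚ.< r → p ℚ.< q ℚ.+ r
  ∣-∣<⇒< {p} {q} {r} lt = subst (ℚ._< q ℚ.+ r) eq (ℚ.+-monoʳ-< q (ℚ.≤-<-trans (p≤∣p∣ (p ℚ.- q)) lt))
    where
    eq : q ℚ.+ (p ℚ.- q) ≡ p
    eq = trans (sym (ℚ.+-assoc q p (ℚ.- q)))
        (trans (cong (ℚ._- q) (ℚ.+-comm q p))
        (trans (ℚ.+-assoc p q (ℚ.- q)) (trans (cong (p ℚ.+_) (ℚ.+-inverseʳ q)) (ℚ.+-identityʳ p))))
    p≤∣p∣ : ∀ p → p ℚ.≤ ℚ.∣ p ∣
    p≤∣p∣ p with ℚ.≤-total 0ℚ p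
    ... | inj₁ 0≤p = ℚ.≤-reflexive (sym (ℚ.0≤p⇒∣p∣≡p 0≤p))
    ... | inj₂ p≤0 = ℚ.≤-trans p≤0 (ℚ.0≤∣p∣ p)

  -- A real has no computable floor, so m is the floor of a single term beyond which the sequence
  -- moves by less than 1. Later terms then lie between m - 1 and m + 2, and this loss must be
  -- recovered when p is chosen.
  approximate : ∀ x → (∀ i → 0ℚ ℚ.≤ seq x i) → ∀ l → (∀ i → + l / 1 ℚ.≤ seq x i) → ∃[ m ] (l ℕ.≤ m ×
    ∃[ N ] (∀ i → N ℕ.≤ i → + m / 1 ℚ.≤ seq x i ℚ.+ 1ℚ × seq x i ℚ.≤ + (m ℕ.+ 2) / 1))
  approximate x 0≤x l l≤x with N , close ← cauchy x 1ℚ (ℚ.positive⁻¹ 1ℚ) with m , m≤ , <m+1 ← floor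
      (seq x N) (0≤x N)
    = m , ℕ.s≤s⁻¹ (ℕ.≰⇒> λ m+1≤l → ℚ.<-irrefl refl
        (ℚ.<-≤-trans <m+1 (ℚ.≤-trans (frac-≤ (suc m) 0 l 0 (ℕ.*-monoˡ-≤ 1 m+1≤l)) (l≤x N)))) ,
      N , λ i N≤i →
        ℚ.≤-trans m≤ (ℚ.<⇒≤ (∣-∣<⇒< (close N i ℕ.≤-refl N≤i))) ,
        ℚ.≤-trans (ℚ.<⇒≤ (∣-∣<⇒< (close i N N≤i ℕ.≤-refl)))
          (ℚ.≤-trans (ℚ.+-monoˡ-≤ 1ℚ (ℚ.<⇒≤ <m+1)) (ℚ.≤-reflexive (trans (frac-+ (suc m) 1 0)
            (cong (λ c → + c / 1) (sym (ℕ.+-suc m 1))))))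

  fromℕ-≤ : ∀ {x p m N} → (∀ i → N ℕ.≤ i → + m / 1 ℚ.≤ seq x i ℚ.+ 1ℚ) → p ℕ.< m → fromℕ p ≤ᴿ x
  fromℕ-≤ {x} {p} {m} {N} m≤ p<m ε ε>0 = N , λ i N≤i → ℚ.≤-trans
    (ℚ.≮⇒≥ λ x<p → ℚ.<-irrefl refl (ℚ.<-≤-trans (ℚ.+-monoˡ-< 1ℚ x<p)
        (ℚ.≤-trans (ℚ.≤-reflexive (frac-+ p 1 0))
      (ℚ.≤-trans (frac-≤ (p ℕ.+ 1) 0 m 0 (ℕ.*-monoˡ-≤ 1 (subst (ℕ._≤ m) (ℕ.+-comm 1 p) p<m))) (m≤ i N≤i)))))
    (ℚ.≤-trans (ℚ.≤-reflexive (sym (ℚ.+-identityʳ (seq x i)))) (ℚ.+-monoʳ-≤ (seq x i) (ℚ.<⇒≤ ε>0)))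

  half-scale-≤ : ∀ {c n p m N} → (∀ i → N ℕ.≤ i → seq (scale c n) i ℚ.≤ + m / 1) → m ℕ.≤ 2 ℕ.* p →
                 fromℚ ½ *ᴿ fromℕ c *ᴿ ∛ n *ᴿ log n ^ᴿ 6 ≤ᴿ fromℕ p
  half-scale-≤ {c} {n} {p} {m} {N} ≤m m≤2p ε ε>0 = N , λ i N≤i → ℚ.≤-trans
    (ℚ.≤-trans (ℚ.≤-reflexive (assoc (+ c / 1) (seq (∛ n) i) (seq (log n ^ᴿ 6) i)))
      (ℚ.≤-trans (ℚ.*-monoˡ-≤-nonNeg ½ (≤m i N≤i))
        (ℚ.≤-trans (ℚ.≤-reflexive (frac-* 1 1 m 0)) (frac-≤ (1 ℕ.* m) 1 p 0
          (subst₂ ℕ._≤_ (sym (trans (ℕ.*-identityʳ (1 ℕ.* m)) (ℕ.*-identityˡ m))) (ℕ.*-comm 2 p) m≤2p)))))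
    (ℚ.≤-trans (ℚ.≤-reflexive (sym (ℚ.+-identityʳ (+ p / 1)))) (ℚ.+-monoʳ-≤ (+ p / 1) (ℚ.<⇒≤ ε>0)))
    where
    assoc : ∀ a b c → ½ ℚ.* a ℚ.* b ℚ.* c ≡ ½ ℚ.* (a ℚ.* b ℚ.* c)
    assoc a b c = trans (cong (ℚ._* c) (ℚ.*-assoc ½ a b)) (ℚ.*-assoc ½ (a ℚ.* b) c)

  -- Both real inequalities on p are reduced to p < m and m + 2 ≤ 2p, whose margins absorb the
  -- errors of `approximate`.
  scale-approximation : ∀ c n h → 2 ℕ.^ h ℕ.≤ n → ∃[ m ] (c ℕ.* ⌊∛ n ⌋ ℕ.* h ℕ.^ 6 ℕ.≤ m ×
    (∀ p → p ℕ.< m → fromℕ p ≤ᴿ scale (64 ℕ.* c) n) ×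
    (∀ p → m ℕ.+ 2 ℕ.≤ 2 ℕ.* p → fromℚ ½ *ᴿ fromℕ (64 ℕ.* c) *ᴿ ∛ n *ᴿ log n ^ᴿ 6 ≤ᴿ fromℕ p))
  scale-approximation c n h 2^h≤n = conclude (approximate (scale (64 ℕ.* c) n)
    (λ i → ℚ.≤-trans (0≤frac (c ℕ.* ⌊∛ n ⌋ ℕ.* h ℕ.^ 6) 0) (scale-lower c n h i 2^h≤n))
    (c ℕ.* ⌊∛ n ⌋ ℕ.* h ℕ.^ 6) (λ i → scale-lower c n h i 2^h≤n))
    where
    conclude : _ → _
    conclude (m , l≤m , N , bounds) = m , l≤m ,
      (λ p → fromℕ-≤ {scale (64 ℕ.* c) n} {p} {m} {N} (λ i N≤i → proj₁ (bounds i N≤i))) ,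
      (λ p → half-scale-≤ {64 ℕ.* c} {n} {p} {m ℕ.+ 2} {N} (λ i N≤i → proj₂ (bounds i N≤i)))

-- Choice of the constant and of the prime.

open import Defs
open import Data.Fin.Base using (Fin)
open import Data.Fin.Subset using (Subset; ∣_∣)
open import Data.Nat.Base using (ℕ; _≤_)
open import Data.Nat.Primality using (Prime)
open import Data.Product.Base using (Σ-syntax; _×_)
open import Data.Rational.Base using (0ℚ; ½)
open import Relation.Binary.PropositionalEquality using (_≢_)

import Data.Fin.Properties as Fin
import Data.Integer.Divisibility.Signed as ℤ
open import Data.Nat.Base using (suc; _<_; _+_; _*_; _^_; z≤n; s≤s; >-nonZero)
open import Data.Nat.Primality using (prime⇒nonZero)
open import Data.Nat.Properties
open import Data.Nat.Tactic.RingSolver using (solve-∀)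
open import Data.Product.Base using (∃-syntax; _,_)
import Data.Rational.Base as ℚ
import Data.Rational.Properties as ℚ
open import Data.Unit.Base using (tt)
open import Relation.Binary.PropositionalEquality using (_≡_; sym; cong; subst)
open import Relation.Nullary using (yes; no; contradiction)
open import Relation.Nullary.Decidable using (¬?; decidable-stable)
open Primes using (⌊log₂⌋; ∃-half; ∃-prime-∤)
open Moments using (MomentDifference; Spaced; ∃-moment-difference)
open RealBounds using (scale-approximation; ∛≤fromℕ⇒≤)

∃-residue-difference : ∀ {n e N} {A B : Subset n} → 2 ^ 40 ≤ N → 4 * e ≤ N → MomentDifference A B e →
  ∃[ p ] (Prime p × 2 + N ≤ p × p ≤ 2 * N × (∃[ i ] ∣ residue A p i ∣ ≢ ∣ residue B p i ∣))
∃-residue-difference {e = e} {N} {A} {B} 2^40≤N 4e≤N (S , 1≤S , S≤ , ∣S)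
  with p , pp , 2+N≤p , p≤2N , p∤S ← ∃-prime-∤ {N} {S} {e} 2^40≤N 4e≤N 1≤S S≤
  with Fin.any? (λ i → ¬? (∣ residue A p i ∣ ≟ ∣ residue B p i ∣))
... | yes found = p , pp , 2+N≤p , p≤2N , found
... | no none = contradiction (ℤ.∣⇒∣ᵤ (∣S p {{prime⇒nonZero pp}} λ i → decidable-stable
    (_ ≟ _) λ ne → none (i , ne))) p∤S

module _ (a : ℕ) (2^40≤a : 2 ^ 40 ≤ a) where

  -- The final C′ is 64 c. The 64 compensates for log n ≥ h/2, the 8 covers halving m and rounding,
  -- and a makes N at least 2^40 and larger than a multiple of log |S|.
  c = 8 * a

  -- The scale is C′ n^{1/3} (log n)^6 ≥ c r h² with r = ⌊n^{1/3}⌋, h = ⌊log₂ n⌋.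
  module _ {r h m N : ℕ} (1≤r : 1 ≤ r) (1≤h : 1 ≤ h) (c≤m : c * r * h ^ 6 ≤ m) (m≤ : m ≤ 2 * N + 2) where

    open ≤-Reasoning

    private
      y = r * (h * h)

      1≤y : 1 ≤ y
      1≤y = *-mono-≤ 1≤r (*-mono-≤ 1≤h 1≤h)

      h²≤h^6 : h * h ≤ h ^ 6
      h²≤h^6 = subst (_≤ h ^ 6) (cong (h *_) (*-identityʳ h))
          (^-monoʳ-≤ h {{>-nonZero 1≤h}} {2} {6} (s≤s (s≤s z≤n)))

      ay≤N : a * y ≤ N
      -- The additive 2 in `m≤` is absorbed by 1 ≤ a y, which gives 2 (a y + 1) ≤ 4 a y.
      ay≤N = +-cancelʳ-≤ 1 _ _ (*-cancelˡ-≤ 2 (begin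
        2 * (a * y + 1)
          ≤⟨ *-monoʳ-≤ 2 (+-monoʳ-≤ (a * y) (*-mono-≤ (≤-trans (m^n>0 2 40) 2^40≤a) 1≤y)) ⟩
        2 * (a * y + a * y)              ≡⟨ rr a y ⟩
        4 * a * y                        ≤⟨ *-monoˡ-≤ y (*-monoˡ-≤ a (≤ᵇ⇒≤ 4 8 tt)) ⟩
        c * (r * (h * h))                ≤⟨ *-monoʳ-≤ c (*-monoʳ-≤ r h²≤h^6) ⟩
        c * (r * h ^ 6)                  ≡⟨ *-assoc c r (h ^ 6) ⟨
        c * r * h ^ 6                    ≤⟨ c≤m ⟩
        m                                ≤⟨ m≤ ⟩
        2 * N + 2                        ≡⟨ *-distribˡ-+ 2 N 1 ⟨
        2 * (N + 1)                      ∎))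
        where
        rr : ∀ a y → 2 * (a * y + a * y) ≡ 4 * a * y
        rr = solve-∀

    2^40≤N : 2 ^ 40 ≤ N
    2^40≤N = ≤-trans 2^40≤a (≤-trans (m≤m*n a y {{>-nonZero 1≤y}}) ay≤N)

    -- The exponent is the one for ℓ = h + 1 ≤ 2h, so the left side is at most 800 r h², and 800 is
    -- below a.
    4e≤N : 4 * (50 * (r * (suc h * suc h))) ≤ N
    4e≤N = begin
      4 * (50 * (r * (suc h * suc h)))
        ≤⟨ *-monoʳ-≤ 4 (*-monoʳ-≤ 50 (*-monoʳ-≤ r (*-mono-≤ 1+h≤2h 1+h≤2h))) ⟩
      4 * (50 * (r * (2 * h * (2 * h))))      ≡⟨ rr r h ⟩
      800 * y
        ≤⟨ *-monoˡ-≤ y (≤-trans (≤ᵇ⇒≤ 800 (2 ^ 40) tt) 2^40≤a) ⟩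
      a * y                                   ≤⟨ ay≤N ⟩
      N                                       ∎
      where
      1+h≤2h : suc h ≤ 2 * h
      1+h≤2h = +-mono-≤ 1≤h (≤-reflexive (sym (+-identityʳ h)))
      rr : ∀ r h → 4 * (50 * (r * (2 * h * (2 * h)))) ≡ 800 * (r * (h * h))
      rr = solve-∀

  module _ (n : ℕ) (2≤n : 2 ≤ n) where

    private
      r = ⌊∛ n ⌋

      1≤n : 1 ≤ n
      1≤n = ≤-trans (s≤s z≤n) 2≤n

    1≤⌊∛n⌋ : 1 ≤ r
    1≤⌊∛n⌋ = n≢0⇒n>0 λ r≡0 → <⇒≱ (subst (λ x → n < suc x ^ 3) r≡0 (⌊∛⌋-upper n)) 1≤n

    ⌊∛n⌋≤n : r ≤ n
    ⌊∛n⌋≤n = ≤-trans (m≤m*n r (r ^ 2) {{m^n≢0 r 2 {{>-nonZero 1≤⌊∛n⌋}}}}) (⌊∛⌋-lower n)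

    -- Rounding n^{1/3} down costs at most a factor of 2, as r + 1 ≤ 2r; the Chebyshev growth
    -- estimate is calibrated to this 8.
    n≤8⌊∛n⌋³ : n ≤ 8 * (r * r * r)
    n≤8⌊∛n⌋³ = begin
      n                ≤⟨ <⇒≤ (⌊∛⌋-upper n) ⟩
      suc r ^ 3        ≤⟨ ^-monoˡ-≤ 3 (+-mono-≤ 1≤⌊∛n⌋ (≤-reflexive (sym (+-identityʳ r)))) ⟩
      (2 * r) ^ 3      ≡⟨ rr r ⟩
      8 * (r * r * r)  ∎
      where
      open ≤-Reasoning
      rr : ∀ r → 2 * r * (2 * r * (2 * r * 1)) ≡ 8 * (r * r * r)
      rr = solve-∀

    module _ {h m : ℕ} (2^h≤n : 2 ^ h ≤ n) (n<2^1+h : n < 2 ^ suc h) (c≤m : c * r * h ^ 6 ≤ m) where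

      1≤h : 1 ≤ h
      1≤h = n≢0⇒n>0 λ h≡0 → <⇒≱ (subst (λ x → n < 2 ^ suc x) h≡0 n<2^1+h) 2≤n

      1≤m : 1 ≤ m
      1≤m = ≤-trans (*-mono-≤ (*-mono-≤ 1≤c 1≤⌊∛n⌋) (m^n>0 h {{>-nonZero 1≤h}} 6)) c≤m
        where
        1≤c : 1 ≤ c
        1≤c = ≤-trans (≤-trans (m^n>0 2 40) 2^40≤a) (m≤n*m a 8)

      ∃-distinguishing-prime : ∀ {A B : Subset n} → A ≢ B → Spaced r A → Spaced r B →
        ∃[ p ] (Prime p × p < m × m + 2 ≤ 2 * p × (∃[ i ] ∣ residue A p i ∣ ≢ ∣ residue B p i ∣))
      ∃-distinguishing-prime {A} {B} A≢B spA spB = conclude (∃-half m 1≤m)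
        where
        e = 50 * (r * (suc h * suc h))
        moments : MomentDifference A B e
        moments = ∃-moment-difference {n} {r} {suc h} 1≤n 1≤⌊∛n⌋ ⌊∛n⌋≤n n≤8⌊∛n⌋³ n<2^1+h
            (s≤s z≤n) A B A≢B spA spB
        conclude : ∃[ N ] (2 * N < m × m ≤ 2 * N + 2) →
          ∃[ p ] (Prime p × p < m × m + 2 ≤ 2 * p × (∃[ i ] ∣ residue A p i ∣ ≢ ∣ residue B p i ∣))
        conclude (N , 2N<m , m≤) = conclude′ (∃-residue-difference {e = e} {N} {A} {B}
          (2^40≤N {r} {h} {m} {N} 1≤⌊∛n⌋ 1≤h c≤m m≤) (4e≤N {r} {h} {m} {N} 1≤⌊∛n⌋ 1≤h c≤m m≤) moments)
          where
          conclude′ : ∃[ p ] (Prime p × 2 + N ≤ p × p ≤ 2 * N ×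
              (∃[ i ] ∣ residue A p i ∣ ≢ ∣ residue B p i ∣)) → _
          conclude′ (p , pp , 2+N≤p , p≤2N , i , ne) = p , pp , ≤-<-trans p≤2N 2N<m ,
            -- m + 2 ≤ 2N + 4 = 2 (N + 2) ≤ 2p: the reason for asking p ≥ N + 2 and not just p > N.
            ≤-trans (+-monoˡ-≤ 2 m≤) (≤-trans (≤-reflexive (rr N)) (*-monoʳ-≤ 2 2+N≤p)) , i , ne
            where
            rr : ∀ N → 2 * N + 2 + 2 ≡ 2 * (2 + N)
            rr = solve-∀

    distinguish : (A B : Subset n) → A ≢ B → Separated (∛ n) A → Separated (∛ n) B →
      Σ[ p ∈ ℕ ] (Prime p ×
        fromℚ ½ *ᴿ fromℕ (64 * c) *ᴿ ∛ n *ᴿ log n ^ᴿ 6 ≤ᴿ fromℕ p ×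
        fromℕ p ≤ᴿ fromℕ (64 * c) *ᴿ ∛ n *ᴿ log n ^ᴿ 6 ×
        (Σ[ i ∈ Fin p ] ∣ residue A p i ∣ ≢ ∣ residue B p i ∣))
    distinguish A B A≢B sepA sepB = at-log (⌊log₂⌋ n 1≤n)
      where
      Goal = Σ[ p ∈ ℕ ] (Prime p ×
        fromℚ ½ *ᴿ fromℕ (64 * c) *ᴿ ∛ n *ᴿ log n ^ᴿ 6 ≤ᴿ fromℕ p ×
        fromℕ p ≤ᴿ fromℕ (64 * c) *ᴿ ∛ n *ᴿ log n ^ᴿ 6 ×
        (Σ[ i ∈ Fin p ] ∣ residue A p i ∣ ≢ ∣ residue B p i ∣))
      spaced : ∀ {A : Subset n} → Separated (∛ n) A → Spaced r A
      spaced sep {a} {a′} a∈ a′∈ a≢a′ = ∛≤fromℕ⇒≤ n _ (sep a∈ a′∈ a≢a′)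
      at-log : ∃[ h ] (2 ^ h ≤ n × n < 2 ^ suc h) → Goal
      at-log (h , 2^h≤n , n<2^1+h) = at-scale (scale-approximation c n h 2^h≤n)
        where
        at-scale : _ → Goal
        at-scale (m , c≤m , <m⇒≤scale , ≤2p⇒scale≤) = at-prime
            (∃-distinguishing-prime {h} {m} 2^h≤n n<2^1+h c≤m {A} {B} A≢B (spaced {A} sepA)
            (spaced {B} sepB))
          where
          at-prime : _ → Goal
          at-prime (p , pp , p<m , m+2≤2p , i , ne) = p , pp , ≤2p⇒scale≤ p m+2≤2p ,
              <m⇒≤scale p p<m , i , ne

theorem2 : Σ[ C′ ∈ ℝ ] (fromℚ 0ℚ <ᴿ C′ ×
    ((n : ℕ) → 2 ≤ n → (A B : Subset n) → A ≢ B →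
    Separated (∛ n) A → Separated (∛ n) B →
    Σ[ p ∈ ℕ ] (Prime p ×
    fromℚ ½ *ᴿ C′ *ᴿ ∛ n *ᴿ log n ^ᴿ 6 ≤ᴿ fromℕ p ×
    fromℕ p ≤ᴿ C′ *ᴿ ∛ n *ᴿ log n ^ᴿ 6 ×
    (Σ[ i ∈ Fin p ] ∣ residue A p i ∣ ≢ ∣ residue B p i ∣))))
theorem2 = fromℕ (64 * (8 * 2 ^ 40)) ,
  (ℚ.1ℚ , ℚ.positive⁻¹ ℚ.1ℚ , 0 , λ i _ → frac-≤ 1 0 (64 * (8 * 2 ^ 40)) 0
      (≤ᵇ⇒≤ (1 * 1) (64 * (8 * 2 ^ 40) * 1) tt)) ,
  distinguish (2 ^ 40) ≤-refl
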